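{- Let $f\in\mathcal{C}(K,\mathfrak{o}_p)$ be such that $0=\lim_{x\to\infty}f(x)=\lim_{x\to\infty}\hat f(x)=f(0)=\hat f(0)$. Let $\tilde\chi:K^\times\to\mathbf{C}_p^\times$ be a continuous character with $\tilde\chi(\pi)=1$, and for any $\lambda\in\mathbf{C}_p^\times$ let $\chi_\lambda:K^\times\to\mathbf{C}_p^\times$ be the unramified character with $\chi_\lambda(\pi)=\lambda$. Then the zeta integral $Z(f,\tilde\chi\chi_\lambda)=\int_K f(x)\tilde\chi\chi_\lambda(x)\,dx$ is a rigid analytic function of $\lambda$ on the Laurent domain $\{\lambda\in\mathbf{C}_p^\times:|\lambda|_p=1\}$, and satisfies a local functional equation (an identity of rigid meromorphic functions of $\lambda$ on this domain) $$\int_K f(x)\tilde\chi\chi_\lambda(x)\,dx=\rho(\tilde\chi\chi_\lambda)\int_K\hat f(x)\tilde\chi^{ -1}\chi_{q\lambda^{ -1}}(x)\,dx ,$$ where $\lambda\mapsto\rho(\tilde\chi\chi_\lambda)$ is a rigid meromorphic function on $\mathbf{C}_p^\times$ independent of $f$. Moreover, if both $f$ and $\hat f$ are of Schwartz class $c$ for some $c\ge1$, then this functional equation implies that $Z(f,\tilde\chi\chi_\lambda)$ can be meromorphically continued to the annulus $\{\lambda\in\mathbf{C}_p^\times: c^{ -1}\le|\lambda|_p\le c\}$.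
   Context: $\ell\neq p$ are primes; $K$ is a finite extension of $\mathbf{Q}_\ell$ with valuation ring $\mathfrak{o}_K$, maximal ideal $\mathfrak{l}=(\pi)$ with fixed uniformizer $\pi$, $q=\#\mathfrak{o}_K/(\pi)$; $\mathfrak{d}=(\pi^\delta)$ is the different of $\mathfrak{o}_K/\mathbf{Z}_\ell$; $\mathrm{tr}:K\to\mathbf{Q}_\ell$ is the trace. $\mathbf{C}_p$ is the completion of an algebraic closure of $\mathbf{Q}_p$, with absolute value $|\cdot|_p$, $|p|_p=1/p$, and ring of integers $\mathfrak{o}_p$. A square root $q^{1/2}\in\mathbf{C}_p$ of $q$ is fixed. $\mathcal{C}(K,\mathfrak{o}_p)$ is the set of continuous functions $K\to\mathfrak{o}_p$. Dissipative functions and integration: a continuous $f:K\to\mathfrak{o}_p$ is dissipative if $\lim_{x\to\infty}f(x)=0$; likewise a $\mathbf{C}_p$-valued dissipative function is a continuous $f:K\to\mathbf{C}_p$ with $\lim_{x\to\infty}f(x)=0$. $dx$ is the linear functional on compactly supported locally constant functions with $dx(\mathbf{1}_{a+\mathfrak{l}^n})=q^{ -n-\delta/2}$ ($a\in K$, $n\in\mathbf{Z}$), extended to $\mathbf{C}_p$-valued dissipative functions by continuity for the sup norm; the extension is written $\int_K f(x)\,dx$. Fourier transform: fix $\zeta=(\zeta_n)_{n\ge0}$ with $\zeta_n\in\mathfrak{o}_p$ a primitive $\ell^n$-th root of unity and $\zeta_{n+1}^\ell=\zeta_n$. For $x\in\mathbf{Q}_\ell$, $\zeta^x=\zeta_t^{x\ell^t}$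 if $\mathrm{ord}_\ell(x)=-t<0$ and $\zeta^x=1$ if $x\in\mathbf{Z}_\ell$. For dissipative $f$, $\hat f(\xi)=\int_K f(x)\zeta^{\mathrm{tr}(x\xi)}\,dx$. Characters: a multiplicative character is a continuous homomorphism $\chi:K^\times\to\mathbf{C}_p^\times$; it is unramified if trivial on $\mathfrak{o}_K^\times$; its modulus is $|\chi(\pi)|_p$. Schwartz class: for $c$ a positive real number, a dissipative $f:K\to\mathfrak{o}_p$ is of Schwartz class $c$ if for every multiplicative character $\chi$ of modulus $c$ the limit $\lim_{x\to0}f(x)\chi(x)$ exists and, with $f\chi(0)$ defined to be this limit, the resulting function $f\chi$ on $K$ is ($\mathbf{C}_p$-valued) dissipative. In zeta integrals $\int_K f(x)\chi(x)\,dx$ the integrand at $x=0$ is $\lim_{x\to0}f(x)\chi(x)$. A rigid analytic function on a domain $\{\lambda\in\mathbf{C}_p^\times: r\le|\lambda|_p\le s\}$ is one given by a Laurent series in $\lambda$ with $\mathbf{C}_p$-coefficients converging on it; meromorphic functions are locally quotients of analytic ones (by non-zero-divisors).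
   Formalization: In the last claim c ≥ 1 is restricted to rational powers of p: for other real c > 1 no character has modulus c, so the Schwartz condition is vacuous and the continuation fails, e.g. for f a sum of p^k times indicators of the shells of order k!, adjusted to have integral 0. -}

module Defs where

open import Level using (0ℓ)
open import Algebra.Bundles using (CommutativeRing)
open import Algebra.Morphism.Structures using (module RingMorphisms)
open import Data.Fin.Base using (Fin; toℕ)
open import Data.Integer.Base as ℤ using (ℤ; +_; -[1+_])
open import Data.List.Base using (List; []; _∷_)
open import Data.List.Relation.Unary.Any using (Any)
open import Data.Nat.Base as ℕ using (ℕ; zero; suc)
open import Data.Nat.Divisibility using (_∣_)
open import Data.Nat.Primality using (Prime)
open import Data.Product.Base using (Σ; ∃; ∃-syntax; _×_; _,_; proj₁; proj₂)
open import Data.Rational.Base as ℚ using (ℚ; 0ℚ; 1ℚ)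
import Data.Rational.Properties as ℚ
open import Data.Sum.Base using (_⊎_)
open import Data.Unit.Base using (⊤)
open import Data.Vec.Functional using (Vector)
open import Function.Bundles using (_⇔_)
open import Relation.Binary.Construct.Add.Supremum.NonStrict ℚ._≤_
  using (_≤⁺_; ≤⁺-dec)
open import Relation.Binary.Construct.Add.Supremum.Strict ℚ._<_
  using (_<⁺_)
open import Relation.Binary.PropositionalEquality.Core using (_≡_)
open import Relation.Nullary using (¬_; yes; no)
open import Relation.Nullary.Construct.Add.Supremum using (_⁺; [_]; ⊤⁺)

import Algebra.Definitions.RawMonoid as RawMonoid
import Algebra.Properties.Semiring.Exp as Exp

-- An absolute value with |x| ∈ {0} ∪ r^ℚ is written additively:
-- |x| = r^(- v x), with v 0 = ⊤⁺.  Every absolute value in this file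
-- (on ℚ_ℓ, K, ℚ_p, its algebraic closure and ℂ_p) is of this kind.

_+⁺_ : ℚ ⁺ → ℚ ⁺ → ℚ ⁺
[ x ] +⁺ [ y ] = [ x ℚ.+ y ]
[ x ] +⁺ ⊤⁺    = ⊤⁺
⊤⁺    +⁺ y     = ⊤⁺

record ValuedField : Set₁ where
  field
    commutativeRing : CommutativeRing 0ℓ 0ℓ

  open CommutativeRing commutativeRing public

  field
    1≉0      : 1# ≉ 0#
    -- The value at 0# is unconstrained and never used.
    inv      : Carrier → Carrier
    inv-cong : ∀ {x y} → x ≈ y → inv x ≈ inv y
    inverse  : ∀ x → x ≉ 0# → x * inv x ≈ 1#

    v        : Carrier → ℚ ⁺
    v-cong   : ∀ {x y} → x ≈ y → v x ≡ v y
    v-0      : v 0# ≡ ⊤⁺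
    v-⊤⇒0    : ∀ x → v x ≡ ⊤⁺ → x ≈ 0#
    v-*      : ∀ x y → v (x * y) ≡ v x +⁺ v y
    v-+      : ∀ (N : ℚ) x y → [ N ] ≤⁺ v x → [ N ] ≤⁺ v y → [ N ] ≤⁺ v (x + y)

  open RawMonoid +-rawMonoid public using (sum) renaming (_×_ to _·_)
  open Exp semiring public using (_^_)

  fromℕ : ℕ → Carrier
  fromℕ n = n · 1#

  _^ℤ_ : Carrier → ℤ → Carrier
  x ^ℤ (+ n)    = x ^ n
  x ^ℤ -[1+ n ] = inv x ^ suc n

  Close : ℚ → Carrier → Carrier → Set
  Close N x y = [ N ] ≤⁺ v (x - y)

  Integral : Carrier → Set
  Integral x = [ 0ℚ ] ≤⁺ v x

  Converges : (ℕ → Carrier) → Carrier → Set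
  Converges s a = ∀ N → ∃[ n₀ ] ∀ n → n₀ ℕ.≤ n → Close N (s n) a

  Cauchy : (ℕ → Carrier) → Set
  Cauchy s = ∀ N → ∃[ n₀ ] ∀ m n → n₀ ℕ.≤ m → n₀ ℕ.≤ n → Close N (s m) (s n)

  Complete : Set
  Complete = ∀ s → Cauchy s → ∃[ a ] Converges s a

  partialSum : (ℕ → Carrier) → ℕ → Carrier
  partialSum a n = sum {n} (λ i → a (toℕ i))

  Units : Set
  Units = Σ Carrier (_≉ 0#)

  *-≉0 : ∀ {x y} → x ≉ 0# → y ≉ 0# → x * y ≉ 0#
  *-≉0 {x} {y} x≉0 y≉0 xy≈0 = y≉0
    (trans (sym (*-identityˡ y))
    (trans (*-congʳ (trans (sym (inverse x x≉0)) (*-comm x (inv x))))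
    (trans (*-assoc (inv x) x y)
    (trans (*-congˡ xy≈0) (zeroʳ (inv x))))))

  inv-≉0 : ∀ {x} → x ≉ 0# → inv x ≉ 0#
  inv-≉0 {x} x≉0 x⁻¹≈0 =
    1≉0 (trans (sym (inverse x x≉0)) (trans (*-congˡ x⁻¹≈0) (zeroʳ x)))

  _*ᵘ_ : Units → Units → Units
  (x , x≉0) *ᵘ (y , y≉0) = x * y , *-≉0 x≉0 y≉0

  invᵘ : Units → Units
  invᵘ (x , x≉0) = inv x , inv-≉0 x≉0

record ValuedExtension (A B : ValuedField) : Set where
  private
    module A = ValuedField A
    module B = ValuedField B
  open RingMorphisms A.rawRing B.rawRing using (IsRingHomomorphism)
  field
    ⟦_⟧   : A.Carrier → B.Carrier
    homo  : IsRingHomomorphism ⟦_⟧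
    v-⟦_⟧ : ∀ x → B.v ⟦ x ⟧ ≡ A.v x

  Dense : Set
  Dense = ∀ (N : ℚ) y → ∃[ x ] B.Close N y ⟦ x ⟧

-- ℚ_r, as a completion of ℚ for the r-adic absolute value.
record PAdicNumbers (r : ℕ) : Set₁ where
  field
    valuedField : ValuedField
  open ValuedField valuedField public
  open RingMorphisms ℚ.+-*-rawRing rawRing using (IsRingHomomorphism)
  field
    ι         : ℚ → Carrier
    ι-homo    : IsRingHomomorphism ι
    -- By multiplicativity these two say that v ∘ ι is ord_r.
    v-r       : v (fromℕ r) ≡ [ 1ℚ ]
    v-coprime : ∀ a → ¬ (r ∣ a) → v (fromℕ a) ≡ [ 0ℚ ]
    ι-dense   : ∀ (N : ℚ) x → ∃[ y ] Close N x (ι y)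
    complete  : Complete

record FiniteExtension (A : ValuedField) : Set₁ where
  field
    valuedField : ValuedField
    extension   : ValuedExtension A valuedField
  open ValuedField valuedField public
  open ValuedExtension extension public
  private module A = ValuedField A

  combination : ∀ {d} → Vector Carrier d → Vector A.Carrier d → Carrier
  combination e c = sum (λ i → ⟦ c i ⟧ * e i)

  field
    degree : ℕ
    basis  : Vector Carrier degree
    coord  : Carrier → Vector A.Carrier degree
    spans  : ∀ x → x ≈ combination basis (coord x)
    unique : ∀ x c → x ≈ combination basis c → ∀ i → c i A.≈ coord x i

  tr : Carrier → A.Carrier
  tr x = A.sum (λ i → coord (x * basis i) i)

record AlgebraicClosure (A : ValuedField) : Set₁ where
  field
    valuedField : ValuedField
    extension   : ValuedExtension A valuedField
  open ValuedField valuedField public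
  open ValuedExtension extension public
  private module A = ValuedField A

  -- Xⁿ + Σ_{i<n} aᵢ Xⁱ at x
  monicAt : ∀ {n} → Vector Carrier n → Carrier → Carrier
  monicAt {n} a x = x ^ n + sum (λ i → a i * x ^ toℕ i)

  field
    algebraic : ∀ x → ∃[ n ] Σ (Vector A.Carrier n) λ a →
                  monicAt (λ i → ⟦ a i ⟧) x ≈ 0#
    closed    : ∀ {n} (a : Vector Carrier (suc n)) → ∃[ x ] monicAt a x ≈ 0#

-- ℂ_p, normalised by |p|_p = 1/p, i.e. v p = 1.
record ComplexPAdicNumbers (p : ℕ) : Set₁ where
  field
    ℚₚ          : PAdicNumbers p
    closure     : AlgebraicClosure (PAdicNumbers.valuedField ℚₚ)
    valuedField : ValuedField
    extension   : ValuedExtension (AlgebraicClosure.valuedField closure) valuedField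
  open ValuedField valuedField public
  open ValuedExtension extension public using (Dense)
  field
    dense    : Dense
    complete : Complete

-- A finite extension K of ℚ_ℓ with uniformizer π, residue cardinality q
-- and different (π^δ).  The valuation of K extends that of ℚ_ℓ, so
-- v π = 1/e.
record LocalField (ℓ : ℕ) : Set₁ where
  field
    ℚℓ        : PAdicNumbers ℓ
    finiteExt : FiniteExtension (PAdicNumbers.valuedField ℚℓ)
  private module ℚℓ = PAdicNumbers ℚℓ
  open FiniteExtension finiteExt public

  field
    π       : Units
    ϖ       : ℚ
    v-π     : v (proj₁ π) ≡ [ ϖ ]
    ϖ>0     : 0ℚ ℚ.< ϖ
    π-least : ∀ x → [ 0ℚ ] <⁺ v x → [ ϖ ] ≤⁺ v x

  -- x ∈ 𝔩ⁿ iff ordπ n ≤ v x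
  ordπ : ℤ → ℚ
  ordπ n = (n ℚ./ 1) ℚ.* ϖ

  field
    q            : ℕ
    residue      : Fin q → Carrier
    residue-int  : ∀ i → Integral (residue i)
    residue-surj : ∀ x → Integral x → ∃[ i ] Close ϖ x (residue i)
    residue-inj  : ∀ i j → Close ϖ (residue i) (residue j) → i ≡ j

    -- The inverse different { x | tr (x 𝔬) ⊆ ℤ_ℓ } is (π^-δ).
    δ         : ℕ
    different : ∀ x → (∀ y → Integral y → ℚℓ.Integral (tr (x * y)))
                      ⇔ [ ordπ (ℤ.- (+ δ)) ] ≤⁺ v x

record Setting (ℓ p : ℕ) : Set₁ where
  field
    ℓ-prime : Prime ℓ
    p-prime : Prime p
    ℓ≢p     : ¬ (ℓ ≡ p)
    K       : LocalField ℓ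
    ℂₚ      : ComplexPAdicNumbers p
  private
    module K  = LocalField K
    module ℚℓ = PAdicNumbers K.ℚℓ
    module C  = ComplexPAdicNumbers ℂₚ

  field
    q½    : C.Units
    q½²≈q : proj₁ q½ C.* proj₁ q½ C.≈ C.fromℕ K.q

    ζ           : ℕ → C.Carrier
    ζ-root      : ∀ n → ζ n C.^ (ℓ ℕ.^ n) C.≈ C.1#
    ζ-primitive : ∀ n k → 0 ℕ.< k → k ℕ.< ℓ ℕ.^ n → ¬ (ζ n C.^ k C.≈ C.1#)
    ζ-compat    : ∀ n → ζ (suc n) C.^ ℓ C.≈ ζ n

  -- z = ζ^x.  If ord_ℓ x = -t < 0, the ℓ-adic integer x ℓ^t acts as an
  -- exponent of ζ_t through any natural number m congruent to it mod ℓ^t.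
  IsζPower : ℚℓ.Carrier → C.Carrier → Set
  IsζPower x z =
    (ℚℓ.Integral x × z C.≈ C.1#) ⊎
    (∃[ t ] ∃[ m ] 0 ℕ.< t ×
       ℚℓ.v x ≡ [ ℤ.- (+ t) ℚ./ 1 ] ×
       ℚℓ.Close (+ t ℚ./ 1) (x ℚℓ.* ℚℓ.fromℕ (ℓ ℕ.^ t)) (ℚℓ.fromℕ m) ×
       z C.≈ ζ t C.^ m)

  field
    ζ^      : ℚℓ.Carrier → C.Carrier
    ζ^-spec : ∀ x → IsζPower x (ζ^ x)

module Analysis {ℓ p : ℕ} (S : Setting ℓ p) where
  open Setting S public
  module K  = LocalField K
  module ℚℓ = PAdicNumbers K.ℚℓ
  module C  = ComplexPAdicNumbers ℂₚ

  Fun : Set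
  Fun = K.Carrier → C.Carrier

  record Continuous (f : Fun) : Set where
    field
      cong       : ∀ {x y} → x K.≈ y → f x C.≈ f y
      continuous : ∀ x N → ∃[ M ] ∀ y → K.Close M y x → C.Close N (f y) (f x)

  VanishesAt∞ : Fun → Set
  VanishesAt∞ f = ∀ N → ∃[ M ] ∀ x → K.v x ≤⁺ [ M ] → [ N ] ≤⁺ C.v (f x)

  Dissipative : Fun → Set
  Dissipative f = Continuous f × VanishesAt∞ f

  IntegerValued : Fun → Set
  IntegerValued f = ∀ x → C.Integral (f x)

  -- Σ c · 1_{a + 𝔩ⁿ} over the triples (c , a , n); these are exactly the
  -- compactly supported locally constant functions.
  StepFun : Set
  StepFun = List (C.Carrier × K.Carrier × ℤ)

  indicator : K.Carrier → ℤ → Fun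
  indicator a n x with ≤⁺-dec ℚ._≤?_ [ K.ordπ n ] (K.v (x K.- a))
  ... | yes _ = C.1#
  ... | no  _ = C.0#

  step : StepFun → Fun
  step []                x = C.0#
  step ((c , a , n) ∷ φ) x = c C.* indicator a n x C.+ step φ x

  -- dx (1_{a + 𝔩ⁿ}) = q^(-n-δ/2) = (q^½)^(-(2n+δ))
  dx : StepFun → C.Carrier
  dx []                = C.0#
  dx ((c , a , n) ∷ φ) =
    c C.* (proj₁ q½ C.^ℤ (ℤ.- (+ 2 ℤ.* n ℤ.+ + K.δ))) C.+ dx φ

  -- ∫_K F(x) dx = I.  As q^½ is a p-adic unit, |dx φ| ≤ sup |φ|, so this
  -- is the graph of the extension of dx by sup-norm continuity; its domain,
  -- the uniform closure of the step functions, is the dissipative functions.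
  ∫_≈_ : Fun → C.Carrier → Set
  ∫ F ≈ I = ∀ (N : ℚ) → ∃[ φ ] (∀ x → C.Close N (F x) (step φ x)) × C.Close N I (dx φ)

  IsFourierTransform : Fun → Fun → Set
  IsFourierTransform f f̂ =
    ∀ ξ → ∫ (λ x → f x C.* ζ^ (K.tr (x K.* ξ))) ≈ f̂ ξ

  record Character : Set where
    field
      χ          : K.Units → C.Units
      cong       : ∀ x y → proj₁ x K.≈ proj₁ y → proj₁ (χ x) C.≈ proj₁ (χ y)
      homo       : ∀ x y → proj₁ (χ (x K.*ᵘ y)) C.≈ proj₁ (χ x) C.* proj₁ (χ y)
      continuous : ∀ x N → ∃[ M ] ∀ y → K.Close M (proj₁ y) (proj₁ x) →
                   C.Close N (proj₁ (χ y)) (proj₁ (χ x))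

    Unramified : Set
    Unramified = ∀ x → K.v (proj₁ x) ≡ [ 0ℚ ] → proj₁ (χ x) C.≈ C.1#

    -- The modulus |χ(π)|_p is p^γ.
    Modulus : ℚ → Set
    Modulus γ = C.v (proj₁ (χ K.π)) ≡ [ ℚ.- γ ]

  open Character public using (χ; Unramified)

  Fun× : Set
  Fun× = K.Units → C.Units

  _∙_ : Fun× → Fun× → Fun×
  (χ ∙ ψ) x = χ x C.*ᵘ ψ x

  _⁻¹ : Fun× → Fun×
  (χ ⁻¹) x = C.invᵘ (χ x)

  -- F = f χ on K^×, and F 0 = lim_{x→0} f(x) χ(x).
  record ExtendedProduct (f : Fun) (χ : Fun×) (F : Fun) : Set where
    field
      away-from-0 : ∀ x → F (proj₁ x) C.≈ f (proj₁ x) C.* proj₁ (χ x)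
      limit-at-0  : ∀ N → ∃[ M ] ∀ (x : K.Units) → [ M ] ≤⁺ K.v (proj₁ x) →
                    C.Close N (f (proj₁ x) C.* proj₁ (χ x)) (F K.0#)

  -- f is of Schwartz class c = p^γ.  Moduli of characters lie in
  -- |ℂ_p^×| = p^ℚ, so γ is rational; for any other real c the condition
  -- on characters would be empty.
  SchwartzClass : ℚ → Fun → Set
  SchwartzClass γ f =
    Dissipative f × IntegerValued f ×
    (∀ (ψ : Character) → Character.Modulus ψ γ →
       ∃[ F ] ExtendedProduct f (Character.χ ψ) F × Dissipative F)

  Zeta_,_≈_ : Fun → Fun× → C.Carrier → Set
  Zeta f , χ ≈ I = ∃[ F ] ExtendedProduct f χ F × ∫ F ≈ I

  -- p^(-β) ≤ |λ|_p ≤ p^(-α)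
  Annulus : ℚ → ℚ → C.Units → Set
  Annulus α β (x , _) = [ α ] ≤⁺ C.v x × C.v x ≤⁺ [ β ]

  LaurentSum : (ℤ → C.Carrier) → C.Units → C.Carrier → Set
  LaurentSum a (x , _) s = ∃[ s₊ ] ∃[ s₋ ]
    C.Converges (C.partialSum (λ n → a (+ n) C.* (x C.^ℤ (+ n)))) s₊ ×
    C.Converges (C.partialSum (λ n → a -[1+ n ] C.* (x C.^ℤ -[1+ n ]))) s₋ ×
    s C.≈ s₊ C.+ s₋

  record Analytic (α β : ℚ) : Set where
    field
      coeff    : ℤ → C.Carrier
      value    : ∀ x → Annulus α β x → C.Carrier
      converge : ∀ x (x∈ : Annulus α β x) → LaurentSum coeff x (value x x∈)

  open Analytic public using (value)

  NonZeroDivisor : ∀ {α β} → Analytic α β → Set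
  NonZeroDivisor {α} {β} h = ∀ (g : Analytic α β) →
    (∀ x x∈ → value g x x∈ C.* value h x x∈ C.≈ C.0#) →
    ∀ x x∈ → value g x x∈ C.≈ C.0#

  -- A rotation-invariant domain, as a set of valuations.
  Domain : Set₁
  Domain = ℚ → Set

  _∈[_,_] : ℚ → ℚ → ℚ → Set
  w ∈[ α , β ] = α ℚ.≤ w × w ℚ.≤ β

  ℂₚ× : Domain
  ℂₚ× _ = ⊤

  annulus : ℚ → ℚ → Domain
  annulus α β w = w ∈[ α , β ]

  -- Compatible quotients of analytic functions on the members of an
  -- admissible covering by closed annuli: each closed annulus inside the
  -- domain is covered by finitely many members.
  record Meromorphic (D : Domain) : Set₁ where
    field
      Index      : Set
      lo hi      : Index → ℚ
      inside     : ∀ i w → w ∈[ lo i , hi i ] → D w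
      admissible : ∀ α β → (∀ w → w ∈[ α , β ] → D w) →
                   ∃[ is ] ∀ w → w ∈[ α , β ] → Any (λ i → w ∈[ lo i , hi i ]) is
      num den    : ∀ i → Analytic (lo i) (hi i)
      regular    : ∀ i → NonZeroDivisor (den i)

      compatible : ∀ i j x (x∈i : Annulus (lo i) (hi i) x) (x∈j : Annulus (lo j) (hi j) x) →
        value (num i) x x∈i C.* value (den j) x x∈j
          C.≈ value (num j) x x∈j C.* value (den i) x x∈i

  -- g = ρ h on the annulus, as meromorphic functions.
  _≈_·_ : ∀ {D α β} → Analytic α β → Meromorphic D → Analytic α β → Set
  _≈_·_ {_} {α} {β} g ρ h =
    ∀ i x (x∈ : Annulus α β x)
      (x∈i : Annulus (Meromorphic.lo ρ i) (Meromorphic.hi ρ i) x) →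
      value (Meromorphic.den ρ i) x x∈i C.* value g x x∈ C.≈ value (Meromorphic.num ρ i) x x∈i C.* value h x x∈

  _Continues_ : ∀ {D α β} → Meromorphic D → Analytic α β → Set
  _Continues_ {_} {α} {β} M g =
    ∀ i x (x∈ : Annulus α β x)
      (x∈i : Annulus (Meromorphic.lo M i) (Meromorphic.hi M i) x) →
      value (Meromorphic.num M i) x x∈i C.≈ value (Meromorphic.den M i) x x∈i C.* value g x x∈

  q≉0 : ¬ (C.fromℕ K.q C.≈ C.0#)
  q≉0 q≈0 = C.*-≉0 (proj₂ q½) (proj₂ q½) (C.trans q½²≈q q≈0)

  qᵘ : C.Units
  qᵘ = C.fromℕ K.q , q≉0

-- Let aₙ be the integral of f χ̃ over the shell πⁿ𝔬^×, and eₙ that of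
-- f̂ χ̃⁻¹ over π⁻ⁿ𝔬^×, times q⁻ⁿ.  Since f and f̂ vanish at 0 and at ∞, both
-- sequences tend to 0, and on |λ| = 1 the two zeta integrals are Σ aₙ λⁿ and
-- Σ eₙ λⁿ.  By Fubini, the second family of coefficients consists of integrals
-- of f against the Fourier transforms of χ̃⁻¹ on shells.  If χ̃ is ramified
-- such a transform is a Gauss sum times χ̃ on a single shell, and the Gauss sum
-- is nonzero by Fourier inversion; if χ̃ is unramified it is a difference of
-- multiples of indicators of balls.  Either way
--     aₙ - b aₙ₋₁ = c (eₙ₋ₖ - d eₙ₋ₖ₊₁)
-- with b, c, d, k depending only on χ̃, that is, ρ = c λᵏ (1 - d λ⁻¹)/(1 - b λ).
-- The uniform continuity of f is read off from its integral f̂(0), that of f̂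
-- from the Riemann sums of f.
--
-- If f and f̂ are of Schwartz class c, the limits of f(x) χ(x) at 0 vanish, as
-- comparing χ(π) = z with χ(π) = -z shows.  So Σ aₙ λⁿ converges for
-- 1 ≤ |λ| ≤ c and Σ eₙ λⁿ for c⁻¹ ≤ |λ| ≤ 1, where ρ Σ eₙ λⁿ continues Z.

module Submission where

-- Every integral is reduced to a finite sum. To any given precision an integrand is periodic and
-- supported in a ball, so it lives on 𝔩⁻ᴮ/𝔩ᴮ for some B, and its integral is the volume of a class
-- times a sum over digit expansions. Fubini is then the interchange of two finite sums. At
-- precision ⊤⁺ the same congruences are equalities, so one set of lemmas serves exact and
-- approximate statements. The estimates survive because q^½ and the values of ψ and χ̃ are units of
-- ℂₚ. None of this is given. The number q is known only as the size of a residue system, so |q| = 1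
-- has to be proved, and |χ̃| = 1 comes from compactness of the unit group. In the unramified case b
-- = q⁻¹, so the zero λ = q of 1 - b λ lies on the circle |λ| = 1 itself, where division by it is
-- impossible. Hence the relations between coefficients and between series keep their denominators
-- cleared, and a separate argument shows that 1 - b λ is not a zero divisor.

open import Level using (0ℓ)
open import Algebra.Bundles using (CommutativeRing)
import Algebra.Solver.Ring.AlmostCommutativeRing as ACR
import Algebra.Solver.Ring
open import Data.Fin.Base as Fin using (Fin; toℕ; fromℕ<) renaming (zero to fzero; suc to fsuc)
open import Data.Integer.Base as ℤ using (ℤ; +_; -[1+_])
import Data.Integer.Properties as ℤ
open import Data.Maybe.Base using (Maybe; just; nothing)
open import Data.Nat.Base as ℕ using (ℕ; zero; suc)
import Data.Nat.Properties as ℕ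
open import Data.Product.Base using (Σ; ∃; ∃-syntax; _×_; _,_; proj₁; proj₂)
open import Data.Rational.Base as ℚ using (ℚ; 0ℚ; 1ℚ)
import Data.Rational.Properties as ℚ
open import Data.Sum.Base using (_⊎_; inj₁; inj₂)
open import Data.Empty using (⊥; ⊥-elim)
open import Relation.Binary.Construct.Add.Supremum.NonStrict ℚ._≤_
open import Relation.Binary.PropositionalEquality.Core as ≡ using (_≡_)
import Relation.Nullary.Decidable.Core as Dec
open import Relation.Nullary using (¬_; yes; no; Dec)
open import Relation.Nullary.Construct.Add.Supremum using (_⁺; [_]; ⊤⁺; ≡-dec)
open import Relation.Binary.Definitions using (tri<; tri≈; tri>)
import Algebra.Properties.Group ℚ.+-0-group as ℚG
import Data.Integer.DivMod as ℤ
import Data.Rational.Unnormalised.Base as ℚᵘ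
import Data.Rational.Unnormalised.Properties as ℚᵘ
import Data.Integer.Tactic.RingSolver as ℤ-Ring
open import Function.Bundles using (Equivalence)
open import Function.Base using (_∘_)
open import Relation.Binary.Construct.Add.Supremum.Strict ℚ._<_ using (_<⁺_; [_]; [_]<⊤⁺)
import Data.Fin.Properties as Fin
open import Data.Fin.Permutation using (Permutation; permutation)
import Algebra.Properties.Semiring.Sum as SemiringSum
import Algebra.Properties.Semiring.Mult as Mult
open import Data.List.Base using ([]; _∷_)
open import Data.List.Relation.Unary.Any using (Any; here; there)
open import Data.Nat.Divisibility as ℕ using (_∣_)
import Data.Nat.DivMod as ℕ
open import Data.Nat.Primality as Prime using (Prime)
open import Data.Bool.Base using (Bool; true; false)
open import Data.Unit.Base using (tt)
open import Algebra.Morphism.Structures using (module RingMorphisms)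
open import Defs

-- The standard ring solvers need coefficients whose equality computes, so
-- a commutative ring is solved over ℤ.
module IntegerSolver (R : CommutativeRing 0ℓ 0ℓ) where
  open CommutativeRing R
  open import Algebra.Properties.Ring ring
  open import Algebra.Properties.Semiring.Mult.TCOptimised semiring renaming (_×_ to _·_)
  open import Algebra.Properties.AbelianGroup +-abelianGroup using (⁻¹-∙-comm)
  open import Relation.Binary.Reasoning.Setoid setoid

  fromℤ : ℤ → Carrier
  fromℤ (+ n)    = n · 1#
  fromℤ -[1+ n ] = - (suc n · 1#)

  fromℤ-neg : ∀ n → fromℤ (ℤ.- (+ n)) ≈ - (n · 1#)
  fromℤ-neg zero    = sym -0#≈0#
  fromℤ-neg (suc n) = refl

  fromℤ-⊖ : ∀ m n → fromℤ (m ℤ.⊖ n) ≈ m · 1# - n · 1#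
  fromℤ-⊖ m       zero    = sym (trans (+-congˡ -0#≈0#) (+-identityʳ _))
  fromℤ-⊖ zero    (suc n) = sym (+-identityˡ _)
  fromℤ-⊖ (suc m) (suc n) = begin
    fromℤ (suc m ℤ.⊖ suc n)              ≡⟨ ≡.cong fromℤ (ℤ.[1+m]⊖[1+n]≡m⊖n m n) ⟩
    fromℤ (m ℤ.⊖ n)                      ≈⟨ fromℤ-⊖ m n ⟩
    m · 1# - n · 1#                      ≈⟨ +-congˡ (trans (+-congʳ (-‿inverseʳ 1#)) (+-identityˡ _)) ⟨
    m · 1# + (1# - 1# - n · 1#)          ≈⟨ +-congˡ (+-assoc _ _ _) ⟩
    m · 1# + (1# + (- 1# - n · 1#))      ≈⟨ +-assoc _ _ _ ⟨
    m · 1# + 1# + (- 1# - n · 1#)        ≈⟨ +-cong (+-comm _ _) (⁻¹-∙-comm _ _) ⟩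
    1# + m · 1# - (1# + n · 1#)          ≈⟨ +-cong (×-homo-+ 1# 1 m) (-‿cong (×-homo-+ 1# 1 n)) ⟨
    suc m · 1# - suc n · 1#              ∎

  fromℤ-+ : ∀ i j → fromℤ (i ℤ.+ j) ≈ fromℤ i + fromℤ j
  fromℤ-+ (+ m)    (+ n)    = ×-homo-+ 1# m n
  fromℤ-+ (+ m)    -[1+ n ] = fromℤ-⊖ m (suc n)
  fromℤ-+ -[1+ m ] (+ n)    = trans (fromℤ-⊖ n (suc m)) (+-comm _ _)
  fromℤ-+ -[1+ m ] -[1+ n ] = begin
    - (suc (suc (m ℕ.+ n)) · 1#)        ≡⟨ ≡.cong (λ k → - (suc k · 1#)) (ℕ.+-suc m n) ⟨
    - ((suc m ℕ.+ suc n) · 1#)          ≈⟨ -‿cong (×-homo-+ 1# (suc m) (suc n)) ⟩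
    - (suc m · 1# + suc n · 1#)         ≈⟨ ⁻¹-∙-comm _ _ ⟨
    - (suc m · 1#) - suc n · 1#         ∎

  fromℤ-* : ∀ i j → fromℤ (i ℤ.* j) ≈ fromℤ i * fromℤ j
  fromℤ-* (+ m)    (+ n)    = trans (reflexive (≡.cong fromℤ (≡.sym (ℤ.pos-* m n)))) (×1-homo-* m n)
  fromℤ-* (+ m)    -[1+ n ] = begin
    fromℤ (+ m ℤ.* -[1+ n ])              ≡⟨ ≡.cong fromℤ (ℤ.neg-distribʳ-* (+ m) (+ suc n)) ⟨
    fromℤ (ℤ.- (+ m ℤ.* + suc n))         ≡⟨ ≡.cong (λ k → fromℤ (ℤ.- k)) (ℤ.pos-* m (suc n)) ⟨
    fromℤ (ℤ.- (+ (m ℕ.* suc n)))         ≈⟨ fromℤ-neg (m ℕ.* suc n) ⟩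
    - ((m ℕ.* suc n) · 1#)                ≈⟨ -‿cong (×1-homo-* m (suc n)) ⟩
    - (m · 1# * (suc n · 1#))             ≈⟨ -‿distribʳ-* _ _ ⟩
    m · 1# * - (suc n · 1#)               ∎
  fromℤ-* -[1+ m ] (+ n)    = begin
    fromℤ (-[1+ m ] ℤ.* + n)              ≡⟨ ≡.cong fromℤ (ℤ.neg-distribˡ-* (+ suc m) (+ n)) ⟨
    fromℤ (ℤ.- (+ suc m ℤ.* + n))         ≡⟨ ≡.cong (λ k → fromℤ (ℤ.- k)) (ℤ.pos-* (suc m) n) ⟨
    fromℤ (ℤ.- (+ (suc m ℕ.* n)))         ≈⟨ fromℤ-neg (suc m ℕ.* n) ⟩
    - ((suc m ℕ.* n) · 1#)                ≈⟨ -‿cong (×1-homo-* (suc m) n) ⟩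
    - (suc m · 1# * (n · 1#))             ≈⟨ -‿distribˡ-* _ _ ⟩
    - (suc m · 1#) * (n · 1#)             ∎
  fromℤ-* -[1+ m ] -[1+ n ] = begin
    (suc m ℕ.* suc n) · 1#                ≈⟨ ×1-homo-* (suc m) (suc n) ⟩
    suc m · 1# * (suc n · 1#)             ≈⟨ -‿involutive _ ⟨
    - - (suc m · 1# * (suc n · 1#))       ≈⟨ -‿cong (-‿distribʳ-* _ _) ⟩
    - (suc m · 1# * - (suc n · 1#))       ≈⟨ -‿distribˡ-* _ _ ⟩
    - (suc m · 1#) * - (suc n · 1#)       ∎

  fromℤ-‿neg : ∀ i → fromℤ (ℤ.- i) ≈ - fromℤ i
  fromℤ-‿neg (+ n)    = fromℤ-neg n
  fromℤ-‿neg -[1+ n ] = sym (-‿involutive _)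

  homomorphism : ℤ.+-*-rawRing ACR.-Raw-AlmostCommutative⟶ ACR.fromCommutativeRing R
  homomorphism = record
    { ⟦_⟧    = fromℤ
    ; +-homo = fromℤ-+
    ; *-homo = fromℤ-*
    ; -‿homo = fromℤ-‿neg
    ; 0-homo = refl
    ; 1-homo = refl
    }

  private
    _coeff≟_ : ∀ i j → Maybe (fromℤ i ≈ fromℤ j)
    i coeff≟ j with i ℤ.≟ j
    ... | yes ≡.refl = just refl
    ... | no  _      = nothing

  open Algebra.Solver.Ring ℤ.+-*-rawRing (ACR.fromCommutativeRing R) homomorphism _coeff≟_ public
    using (solve; _:=_; _:+_; _:*_; _:-_; :-_; _:^_; con)

-- Values in ℚ with a top element, and general valued fields.

⁺-refl : ∀ {a} → a ≤⁺ a
⁺-refl = ≤⁺-reflexive-≡ ℚ.≤-reflexive ≡.refl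

⁺-reflexive : ∀ {a b} → a ≡ b → a ≤⁺ b
⁺-reflexive = ≤⁺-reflexive-≡ ℚ.≤-reflexive

⁺-trans : ∀ {a b c} → a ≤⁺ b → b ≤⁺ c → a ≤⁺ c
⁺-trans = ≤⁺-trans ℚ.≤-trans

⁺-mono : ∀ {a b c d} → a ≤⁺ b → c ≤⁺ d → (a +⁺ c) ≤⁺ (b +⁺ d)
⁺-mono [ p ]   [ q ]   = [ ℚ.+-mono-≤ p q ]
⁺-mono [ p ]   (_ ≤⊤⁺) = _ ≤⊤⁺
⁺-mono (_ ≤⊤⁺) _       = _ ≤⊤⁺

_≤⁺?_ : ∀ a b → Dec (a ≤⁺ b)
_≤⁺?_ = ≤⁺-dec ℚ._≤?_

+⁺-identityˡ : ∀ a → [ 0ℚ ] +⁺ a ≡ a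
+⁺-identityˡ [ x ] = ≡.cong [_] (ℚ.+-identityˡ x)
+⁺-identityˡ ⊤⁺    = ≡.refl

+⁺-identityʳ : ∀ a → a +⁺ [ 0ℚ ] ≡ a
+⁺-identityʳ [ x ] = ≡.cong [_] (ℚ.+-identityʳ x)
+⁺-identityʳ ⊤⁺    = ≡.refl

⁺-absorb : ∀ N {a} → [ 0ℚ ] ≤⁺ a → N ≤⁺ (a +⁺ N)
⁺-absorb N 0≤a = ⁺-trans (⁺-reflexive (≡.sym (+⁺-identityˡ N))) (⁺-mono 0≤a ⁺-refl)

⁺-unbounded⇒⊤ : ∀ {a} → (∀ N → [ N ] ≤⁺ a) → a ≡ ⊤⁺
⁺-unbounded⇒⊤ {⊤⁺}    _ = ≡.refl
⁺-unbounded⇒⊤ {[ x ]} h =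
  ⊥-elim (ℚ.<-irrefl ≡.refl (ℚ.<-≤-trans x<x+1 ([≤]-injective (h (x ℚ.+ 1ℚ)))))
  where
  x<x+1 : x ℚ.< x ℚ.+ 1ℚ
  x<x+1 = ≡.subst (ℚ._< x ℚ.+ 1ℚ) (ℚ.+-identityʳ x)
            (ℚ.+-monoʳ-< x (ℚ.positive⁻¹ 1ℚ))

[]-injective : ∀ {x y : ℚ} → _≡_ {A = ℚ ⁺} [ x ] [ y ] → x ≡ y
[]-injective ≡.refl = ≡.refl

-- Read for values in a field: if a product of two integral elements is a unit, its first factor is
-- a unit. In this form it shows that q and the values of χ̃ are units.
nonneg-sum≡0 : ∀ {a b} → [ 0ℚ ] ≤⁺ a → [ 0ℚ ] ≤⁺ b → a +⁺ b ≡ [ 0ℚ ] → a ≡ [ 0ℚ ]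
nonneg-sum≡0 {[ a ]} {[ b ]} [ 0≤a ] [ 0≤b ] eq = ≡.cong [_] (ℚ.≤-antisym
  (ℚ.≤-trans (≡.subst (ℚ._≤ a ℚ.+ b) (ℚ.+-identityʳ a) (ℚ.+-monoʳ-≤ a 0≤b)) (ℚ.≤-reflexive ([]-injective eq))) 0≤a)

x-y+y≡x : ∀ x y → x ℚ.- y ℚ.+ y ≡ x
x-y+y≡x x y = ≡.trans (ℚ.+-assoc x (ℚ.- y) y) (≡.trans (≡.cong (x ℚ.+_) (ℚ.+-inverseˡ y)) (ℚ.+-identityʳ x))

y+[x-y]≡x : ∀ x y → y ℚ.+ (x ℚ.- y) ≡ x
y+[x-y]≡x x y = ≡.trans (ℚ.+-comm y (x ℚ.- y)) (x-y+y≡x x y)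

double≡0⇒0 : ∀ x → x ℚ.+ x ≡ 0ℚ → x ≡ 0ℚ
double≡0⇒0 x eq with ℚ.<-cmp x 0ℚ
... | tri< x<0 _ _ = ⊥-elim (ℚ.<-irrefl eq (ℚ.+-mono-< x<0 x<0))
... | tri≈ _ x≡0 _ = x≡0
... | tri> _ _ 0<x = ⊥-elim (ℚ.<-irrefl (≡.sym eq) (ℚ.+-mono-< 0<x 0<x))

module ValuedFieldProperties (F : ValuedField) where
  open ValuedField F
  open import Algebra.Properties.Ring ring
  open import Algebra.Properties.CommutativeSemiring.Exp commutativeSemiring using (^-distrib-*; ^-congˡ)
  open IntegerSolver commutativeRing
  open import Relation.Binary.Reasoning.Setoid setoid

  ≉0-resp : ∀ {x y} → x ≈ y → x ≉ 0# → y ≉ 0#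
  ≉0-resp x≈y x≉0 y≈0 = x≉0 (trans x≈y y≈0)

  val : ∀ {x} → x ≉ 0# → ∃[ a ] v x ≡ [ a ]
  val {x} x≉0 with v x in eq
  ... | [ a ] = a , ≡.refl
  ... | ⊤⁺    = ⊥-elim (x≉0 (v-⊤⇒0 x eq))

  v≡[]⇒≉0 : ∀ {x a} → v x ≡ [ a ] → x ≉ 0#
  v≡[]⇒≉0 vx≡a x≈0 with ≡.trans (≡.sym vx≡a) (≡.trans (v-cong x≈0) v-0)
  ... | ()

  _≈0? : ∀ x → Dec (x ≈ 0#)
  x ≈0? with v x in eq
  ... | [ a ] = no (v≡[]⇒≉0 eq)
  ... | ⊤⁺    = yes (v-⊤⇒0 x eq)

  _≈?_ : ∀ x y → Dec (x ≈ y)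
  x ≈? y = Dec.map′ (x-y≈0⇒x≈y x y) (λ x≈y → trans (+-congʳ x≈y) (-‿inverseʳ y)) ((x - y) ≈0?)
    where
    x-y≈0⇒x≈y : ∀ x y → x - y ≈ 0# → x ≈ y
    x-y≈0⇒x≈y x y e = trans (solve 2 (λ x y → x := (x :- y) :+ y) refl x y) (trans (+-congʳ e) (+-identityˡ y))

  unbounded⇒0 : ∀ {x} → (∀ N → [ N ] ≤⁺ v x) → x ≈ 0#
  unbounded⇒0 {x} h = v-⊤⇒0 x (⁺-unbounded⇒⊤ h)

  ≤v-resp : ∀ {N x y} → x ≈ y → N ≤⁺ v x → N ≤⁺ v y
  ≤v-resp x≈y N≤ = ⁺-trans N≤ (⁺-reflexive (v-cong x≈y))

  ≤v-0 : ∀ {N} → N ≤⁺ v 0#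
  ≤v-0 = ⁺-trans (_ ≤⊤⁺) (⁺-reflexive (≡.sym v-0))

  ≈0⇒≤v : ∀ {N x} → x ≈ 0# → N ≤⁺ v x
  ≈0⇒≤v x≈0 = ≤v-resp (sym x≈0) ≤v-0

  v-*-[] : ∀ {x y a b} → v x ≡ [ a ] → v y ≡ [ b ] → v (x * y) ≡ [ a ℚ.+ b ]
  v-*-[] {x} {y} vx vy = ≡.trans (v-* x y) (≡.cong₂ _+⁺_ vx vy)

  v-1 : v 1# ≡ [ 0ℚ ]
  v-1 with val 1≉0
  ... | a , v1≡a = ≡.trans v1≡a (≡.cong [_] a≡0)
    where
    a+a≡a : a ℚ.+ a ≡ a
    a+a≡a = []-injective (≡.trans (≡.sym (v-*-[] v1≡a v1≡a)) (≡.trans (v-cong (*-identityˡ 1#)) v1≡a))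
    a≡0 : a ≡ 0ℚ
    a≡0 = ℚG.identityʳ-unique a a a+a≡a

  v-inv : ∀ {x a} → v x ≡ [ a ] → v (inv x) ≡ [ ℚ.- a ]
  v-inv {x} {a} vx with val (inv-≉0 (v≡[]⇒≉0 vx))
  ... | b , vx⁻¹ = ≡.trans vx⁻¹ (≡.cong [_] (ℚG.inverseʳ-unique a b
    ([]-injective (≡.trans (≡.sym (v-*-[] vx vx⁻¹)) (≡.trans (v-cong (inverse x (v≡[]⇒≉0 vx))) v-1)))))

  v-‿1 : v (- 1#) ≡ [ 0ℚ ]
  v-‿1 with val (λ -1≈0 → 1≉0 (trans (sym (-‿involutive 1#)) (trans (-‿cong -1≈0) -0#≈0#)))
  ... | a , v-1≡a = ≡.trans v-1≡a (≡.cong [_] (double≡0⇒0 a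
    ([]-injective (≡.trans (≡.sym (v-*-[] v-1≡a v-1≡a))
      (≡.trans (v-cong (solve 0 (:- con (+ 1) :* :- con (+ 1) := con (+ 1)) refl)) v-1)))))

  v-neg : ∀ x → v (- x) ≡ v x
  v-neg x = ≡.trans (v-cong (sym (-1*x≈-x x))) (≡.trans (v-* (- 1#) x) (≡.trans (≡.cong (_+⁺ v x) v-‿1) (+⁺-identityˡ (v x))))

  -- Admitting N = ⊤⁺ is what lets the congruences of `Approx` include equality; in that case both
  -- summands are zero.
  ≤v-+ : ∀ {N x y} → N ≤⁺ v x → N ≤⁺ v y → N ≤⁺ v (x + y)
  ≤v-+ {[ N ]} {x} {y} N≤x N≤y = v-+ N x y N≤x N≤y
  ≤v-+ {⊤⁺}    {x} {y} ⊤≤x ⊤≤y = ≈0⇒≤v (trans (+-cong (≈0 ⊤≤x) (≈0 ⊤≤y)) (+-identityˡ 0#))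
    where
    ≈0 : ∀ {z} → ⊤⁺ ≤⁺ v z → z ≈ 0#
    ≈0 {z} ⊤≤ with v z in eq
    ... | ⊤⁺ = v-⊤⇒0 z eq

  ≤v-neg : ∀ {N x} → N ≤⁺ v x → N ≤⁺ v (- x)
  ≤v-neg {x = x} N≤ = ⁺-trans N≤ (⁺-reflexive (≡.sym (v-neg x)))

  ≤v-- : ∀ {N x y} → N ≤⁺ v x → N ≤⁺ v y → N ≤⁺ v (x - y)
  ≤v-- N≤x N≤y = ≤v-+ N≤x (≤v-neg N≤y)

  ≤v-* : ∀ {M N x y} → M ≤⁺ v x → N ≤⁺ v y → (M +⁺ N) ≤⁺ v (x * y)
  ≤v-* {x = x} {y} M≤x N≤y = ⁺-trans (⁺-mono M≤x N≤y) (⁺-reflexive (≡.sym (v-* x y)))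

  ≤v-scale : ∀ {N c x} → Integral c → N ≤⁺ v x → N ≤⁺ v (c * x)
  ≤v-scale {N} {c} {x} 0≤c N≤x =
    ⁺-trans N≤x (⁺-trans (⁺-absorb (v x) 0≤c) (⁺-reflexive (≡.sym (v-* c x))))

  unit-integral : ∀ {x} → v x ≡ [ 0ℚ ] → Integral x
  unit-integral vx = ⁺-reflexive (≡.sym vx)

  unit-inv : ∀ {x} → v x ≡ [ 0ℚ ] → v (inv x) ≡ [ 0ℚ ]
  unit-inv = v-inv

  unit-* : ∀ {x y} → v x ≡ [ 0ℚ ] → v y ≡ [ 0ℚ ] → v (x * y) ≡ [ 0ℚ ]
  unit-* = v-*-[]

  unit-^ : ∀ {x} → v x ≡ [ 0ℚ ] → ∀ n → v (x ^ n) ≡ [ 0ℚ ]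
  unit-^ vx zero    = v-1
  unit-^ vx (suc n) = unit-* vx (unit-^ vx n)

  unit-^ℤ : ∀ {x} → v x ≡ [ 0ℚ ] → ∀ n → v (x ^ℤ n) ≡ [ 0ℚ ]
  unit-^ℤ vx (+ n)    = unit-^ vx n
  unit-^ℤ vx -[1+ n ] = unit-^ (unit-inv vx) (suc n)

  unit-cancel : ∀ {N c x} → v c ≡ [ 0ℚ ] → N ≤⁺ v (c * x) → N ≤⁺ v x
  unit-cancel {N} {c} {x} vc N≤ = ≤v-resp
    (trans (sym (*-assoc _ _ _)) (trans (*-congʳ (trans (*-comm _ _) (inverse c (v≡[]⇒≉0 vc)))) (*-identityˡ x)))
    (≤v-scale (unit-integral (unit-inv vc)) N≤)

  integral-* : ∀ {x y} → Integral x → Integral y → Integral (x * y)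
  integral-* = ≤v-scale

  integral-1 : Integral 1#
  integral-1 = unit-integral v-1

  integral-^ : ∀ {x} → Integral x → ∀ n → Integral (x ^ n)
  integral-^ vx zero    = integral-1
  integral-^ vx (suc n) = integral-* vx (integral-^ vx n)

  integral-fromℕ : ∀ n → Integral (fromℕ n)
  integral-fromℕ zero    = ≤v-0
  integral-fromℕ (suc n) = ≤v-+ integral-1 (integral-fromℕ n)

  ≤v-sum : ∀ {N n} {t : Fin n → Carrier} → (∀ i → N ≤⁺ v (t i)) → N ≤⁺ v (sum t)
  ≤v-sum {n = zero}  h = ≤v-0
  ≤v-sum {n = suc n} h = ≤v-+ (h fzero) (≤v-sum (λ i → h (fsuc i)))

  -- Were v y positive, x = y - (y - x) would have positive value as well.
  v-unit-perturb : ∀ {x y ε} → v x ≡ [ 0ℚ ] → 0ℚ ℚ.< ε → [ ε ] ≤⁺ v (y - x) → v y ≡ [ 0ℚ ]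
  v-unit-perturb {x} {y} {ε} vx 0<ε ε≤ with v y in eq | 0≤y
    where
    0≤y : Integral y
    0≤y = ≤v-resp (solve 2 (λ x y → (y :- x) :+ x := y) refl x y)
      (≤v-+ (⁺-trans [ ℚ.<⇒≤ 0<ε ] ε≤) (unit-integral vx))
  ... | ⊤⁺ | _ = ⊥-elim (1≤0 (≤v-resp (solve 2 (λ x y → y :- (y :- x) := x) refl x y)
                   (≤v-- (⁺-trans (_ ≤⊤⁺) (⁺-reflexive (≡.sym eq))) ε≤)))
    where
    1≤0 : ¬ ([ ε ] ≤⁺ v x)
    1≤0 h with ⁺-trans h (⁺-reflexive vx)
    ... | [ ε≤0 ] = ℚ.<-irrefl ≡.refl (ℚ.<-≤-trans 0<ε ε≤0)
  ... | [ b ] | [ 0≤b ] with b ℚ.≤? 0ℚ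
  ...   | yes b≤0 = ≡.cong [_] (ℚ.≤-antisym b≤0 0≤b)
  ...   | no  b≰0 = ⊥-elim (contra (≤v-resp (solve 2 (λ x y → y :- (y :- x) := x) refl x y)
                   (≤v-- (⁺-trans [ ℚ.p⊓q≤p b ε ] (⁺-reflexive (≡.sym eq))) (⁺-trans [ ℚ.p⊓q≤q b ε ] ε≤))))
    where
    contra : ¬ ([ b ℚ.⊓ ε ] ≤⁺ v x)
    contra h with ⁺-trans h (⁺-reflexive vx)
    ... | [ m≤0 ] with ℚ.⊓-sel b ε
    ...   | inj₁ m≡b = b≰0 (≡.subst (ℚ._≤ 0ℚ) m≡b m≤0)
    ...   | inj₂ m≡ε = ℚ.<-irrefl ≡.refl (ℚ.<-≤-trans 0<ε (≡.subst (ℚ._≤ 0ℚ) m≡ε m≤0))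

  inverseˡ : ∀ {x} → x ≉ 0# → inv x * x ≈ 1#
  inverseˡ {x} x≉0 = trans (*-comm _ _) (inverse x x≉0)

  *-cancelˡ : ∀ {c x y} → c ≉ 0# → c * x ≈ c * y → x ≈ y
  *-cancelˡ {c} {x} {y} c≉0 eq = begin
    x               ≈⟨ *-identityˡ x ⟨
    1# * x          ≈⟨ *-congʳ (inverseˡ c≉0) ⟨
    inv c * c * x   ≈⟨ *-assoc _ _ _ ⟩
    inv c * (c * x) ≈⟨ *-congˡ eq ⟩
    inv c * (c * y) ≈⟨ *-assoc _ _ _ ⟨
    inv c * c * y   ≈⟨ *-congʳ (inverseˡ c≉0) ⟩
    1# * y          ≈⟨ *-identityˡ y ⟩
    y               ∎

  *-≈0 : ∀ {x y} → x ≉ 0# → x * y ≈ 0# → y ≈ 0#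
  *-≈0 x≉0 xy≈0 = *-cancelˡ x≉0 (trans xy≈0 (sym (zeroʳ _)))

  inv-unique : ∀ {x y} → x * y ≈ 1# → y ≈ inv x
  inv-unique {x} {y} xy≈1 = *-cancelˡ x≉0 (trans xy≈1 (sym (inverse x x≉0)))
    where
    x≉0 : x ≉ 0#
    x≉0 x≈0 = 1≉0 (trans (sym xy≈1) (trans (*-congʳ x≈0) (zeroˡ y)))

  inv-* : ∀ {x y} → x ≉ 0# → y ≉ 0# → inv (x * y) ≈ inv x * inv y
  inv-* {x} {y} x≉0 y≉0 = sym (inv-unique (begin
    x * y * (inv x * inv y)   ≈⟨ solve 4 (λ a b c d → a :* b :* (c :* d) := (a :* c) :* (b :* d)) refl x y _ _ ⟩
    x * inv x * (y * inv y)   ≈⟨ *-cong (inverse x x≉0) (inverse y y≉0) ⟩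
    1# * 1#                   ≈⟨ *-identityˡ 1# ⟩
    1#                        ∎))

  inv-involutive : ∀ {x} → x ≉ 0# → inv (inv x) ≈ x
  inv-involutive x≉0 = sym (inv-unique (inverseˡ x≉0))

  ^ℤ-cong : ∀ {x y} → x ≈ y → ∀ n → x ^ℤ n ≈ y ^ℤ n
  ^ℤ-cong x≈y (+ n)    = ^-congˡ n x≈y
  ^ℤ-cong x≈y -[1+ n ] = ^-congˡ (suc n) (inv-cong x≈y)

  ^ℤ-suc : ∀ {x} → x ≉ 0# → ∀ n → x ^ℤ (ℤ.suc n) ≈ x * x ^ℤ n
  ^ℤ-suc x≉0 (+ n)          = refl
  ^ℤ-suc {x} x≉0 -[1+ zero ]  = sym (trans (*-congˡ (*-identityʳ _)) (inverse x x≉0))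
  ^ℤ-suc {x} x≉0 -[1+ suc n ] = begin
    inv x ^ suc n                 ≈⟨ *-identityˡ _ ⟨
    1# * inv x ^ suc n            ≈⟨ *-congʳ (inverse x x≉0) ⟨
    x * inv x * inv x ^ suc n     ≈⟨ *-assoc _ _ _ ⟩
    x * (inv x * inv x ^ suc n)   ∎

  ^ℤ-pred : ∀ {x} → x ≉ 0# → ∀ n → x ^ℤ (ℤ.pred n) ≈ inv x * x ^ℤ n
  ^ℤ-pred {x} x≉0 n = *-cancelˡ x≉0 (begin
    x * x ^ℤ (ℤ.pred n)         ≈⟨ ^ℤ-suc x≉0 (ℤ.pred n) ⟨
    x ^ℤ (ℤ.suc (ℤ.pred n))     ≡⟨ ≡.cong (x ^ℤ_) (ℤ.suc-pred n) ⟩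
    x ^ℤ n                      ≈⟨ *-identityˡ _ ⟨
    1# * x ^ℤ n                 ≈⟨ *-congʳ (inverse x x≉0) ⟨
    x * inv x * x ^ℤ n          ≈⟨ *-assoc _ _ _ ⟩
    x * (inv x * x ^ℤ n)        ∎)

  ^ℤ-+ : ∀ {x} → x ≉ 0# → ∀ m n → x ^ℤ (m ℤ.+ n) ≈ x ^ℤ m * x ^ℤ n
  ^ℤ-+ {x} x≉0 (+ zero)  n = trans (reflexive (≡.cong (x ^ℤ_) (ℤ.+-identityˡ n))) (sym (*-identityˡ _))
  ^ℤ-+ {x} x≉0 (+ suc m) n = begin
    x ^ℤ (+ suc m ℤ.+ n)            ≡⟨ ≡.cong (x ^ℤ_) (ℤ.+-assoc (+ 1) (+ m) n) ⟩
    x ^ℤ (ℤ.suc (+ m ℤ.+ n))        ≈⟨ ^ℤ-suc x≉0 (+ m ℤ.+ n) ⟩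
    x * x ^ℤ (+ m ℤ.+ n)            ≈⟨ *-congˡ (^ℤ-+ x≉0 (+ m) n) ⟩
    x * (x ^ m * x ^ℤ n)            ≈⟨ *-assoc _ _ _ ⟨
    x * x ^ m * x ^ℤ n              ∎
  ^ℤ-+ {x} x≉0 -[1+ zero ]  n = trans (^ℤ-pred x≉0 n) (*-congʳ (sym (*-identityʳ _)))
  ^ℤ-+ {x} x≉0 -[1+ suc m ] n = begin
    x ^ℤ (-[1+ suc m ] ℤ.+ n)       ≡⟨ ≡.cong (x ^ℤ_) (ℤ.+-assoc -[1+ 0 ] -[1+ m ] n) ⟩
    x ^ℤ (ℤ.pred (-[1+ m ] ℤ.+ n))  ≈⟨ ^ℤ-pred x≉0 (-[1+ m ] ℤ.+ n) ⟩
    inv x * x ^ℤ (-[1+ m ] ℤ.+ n)   ≈⟨ *-congˡ (^ℤ-+ x≉0 -[1+ m ] n) ⟩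
    inv x * (inv x ^ suc m * x ^ℤ n) ≈⟨ *-assoc _ _ _ ⟨
    inv x * inv x ^ suc m * x ^ℤ n  ∎

  ^ℤ-≉0 : ∀ {x} → x ≉ 0# → ∀ n → x ^ℤ n ≉ 0#
  ^ℤ-≉0 {x} x≉0 n eq = 1≉0 (begin
    1#                      ≡⟨ ≡.cong (x ^ℤ_) (ℤ.+-inverseʳ n) ⟨
    x ^ℤ (n ℤ.- n)          ≈⟨ ^ℤ-+ x≉0 n (ℤ.- n) ⟩
    x ^ℤ n * x ^ℤ (ℤ.- n)   ≈⟨ *-congʳ eq ⟩
    0# * x ^ℤ (ℤ.- n)       ≈⟨ zeroˡ _ ⟩
    0#                      ∎)

  ^ℤ-inverse : ∀ {x} → x ≉ 0# → ∀ n → x ^ℤ n * x ^ℤ (ℤ.- n) ≈ 1#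
  ^ℤ-inverse {x} x≉0 n =
    trans (sym (^ℤ-+ x≉0 n (ℤ.- n))) (reflexive (≡.cong (x ^ℤ_) (ℤ.+-inverseʳ n)))

  ^ℤ-distrib-* : ∀ {x y} → x ≉ 0# → y ≉ 0# → ∀ n → (x * y) ^ℤ n ≈ x ^ℤ n * y ^ℤ n
  ^ℤ-distrib-* x≉0 y≉0 (+ n)    = ^-distrib-* _ _ n
  ^ℤ-distrib-* x≉0 y≉0 -[1+ n ] = trans (^-congˡ (suc n) (inv-* x≉0 y≉0)) (^-distrib-* _ _ (suc n))

  inv-^ℤ : ∀ {x} → x ≉ 0# → ∀ n → inv x ^ℤ n ≈ x ^ℤ (ℤ.- n)
  inv-^ℤ x≉0 (+ zero)   = refl
  inv-^ℤ x≉0 (+ suc n)  = refl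
  inv-^ℤ x≉0 -[1+ n ]   = ^-congˡ (suc n) (inv-involutive x≉0)

  1^ : ∀ n → 1# ^ n ≈ 1#
  1^ zero    = refl
  1^ (suc n) = trans (*-identityˡ _) (1^ n)

  -- Congruence modulo { z | N ≤ v z }; for N = ⊤⁺ this is equality.
  module Approx (N : ℚ ⁺) where

    infix 4 _~_
    _~_ : Carrier → Carrier → Set
    x ~ y = N ≤⁺ v (x - y)

    ≈⇒~ : ∀ {x y} → x ≈ y → x ~ y
    ≈⇒~ {x} {y} x≈y = ≈0⇒≤v (trans (+-congʳ x≈y) (-‿inverseʳ y))

    ~-refl : ∀ {x} → x ~ x
    ~-refl = ≈⇒~ refl

    ~-sym : ∀ {x y} → x ~ y → y ~ x
    ~-sym {x} {y} h = ≤v-resp (solve 2 (λ x y → :- (x :- y) := y :- x) refl x y) (≤v-neg h)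

    ~-trans : ∀ {x y z} → x ~ y → y ~ z → x ~ z
    ~-trans {x} {y} {z} h k =
      ≤v-resp (solve 3 (λ x y z → (x :- y) :+ (y :- z) := x :- z) refl x y z) (≤v-+ h k)

    ~-+ : ∀ {x y x′ y′} → x ~ y → x′ ~ y′ → (x + x′) ~ (y + y′)
    ~-+ {x} {y} {x′} {y′} h k =
      ≤v-resp (solve 4 (λ x y a b → (x :- y) :+ (a :- b) := (x :+ a) :- (y :+ b)) refl x y x′ y′) (≤v-+ h k)

    ~-neg : ∀ {x y} → x ~ y → (- x) ~ (- y)
    ~-neg {x} {y} h = ≤v-resp (solve 2 (λ x y → :- (x :- y) := (:- x) :- (:- y)) refl x y) (≤v-neg h)

    ~-scale : ∀ {c x y} → Integral c → x ~ y → (c * x) ~ (c * y)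
    ~-scale {c} {x} {y} 0≤c h =
      ≤v-resp (solve 3 (λ c x y → c :* (x :- y) := c :* x :- c :* y) refl c x y) (≤v-scale 0≤c h)

    ~0⇒ : ∀ {x} → x ~ 0# → N ≤⁺ v x
    ~0⇒ {x} = ≤v-resp (trans (+-congˡ -0#≈0#) (+-identityʳ x))

    ⇒~0 : ∀ {x} → N ≤⁺ v x → x ~ 0#
    ⇒~0 {x} = ≤v-resp (sym (trans (+-congˡ -0#≈0#) (+-identityʳ x)))

    ~-sum : ∀ {n} {s t : Fin n → Carrier} → (∀ i → s i ~ t i) → sum s ~ sum t
    ~-sum {zero}  h = ~-refl
    ~-sum {suc n} h = ~-+ (h fzero) (~-sum (λ i → h (fsuc i)))

  ~⊤⇒≈ : ∀ {x y} → ⊤⁺ ≤⁺ v (x - y) → x ≈ y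
  ~⊤⇒≈ {x} {y} h with v (x - y) in eq
  ... | ⊤⁺ = x-y≈0⇒x≈y _ _ (v-⊤⇒0 _ eq)
    where
    x-y≈0⇒x≈y : ∀ x y → x - y ≈ 0# → x ≈ y
    x-y≈0⇒x≈y x y e = trans (solve 2 (λ x y → x := (x :- y) :+ y) refl x y) (trans (+-congʳ e) (+-identityˡ y))

  close⇒≈ : ∀ {x y} → (∀ N → Close N x y) → x ≈ y
  close⇒≈ h = ~⊤⇒≈ (⁺-reflexive (≡.sym (⁺-unbounded⇒⊤ h)))

-- Integer multiples of a positive rational.

toℚᵘ-/1 : ∀ n → ℚ.toℚᵘ (n ℚ./ 1) ℚᵘ.≃ ℚᵘ.mkℚᵘ n 0
toℚᵘ-/1 n = ℚ.toℚᵘ-fromℚᵘ (ℚᵘ.mkℚᵘ n 0)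

/1-+ : ∀ m n → (m ℤ.+ n) ℚ./ 1 ≡ m ℚ./ 1 ℚ.+ n ℚ./ 1
/1-+ m n = ℚ.toℚᵘ-injective
  (ℚᵘ.≃-trans (toℚᵘ-/1 (m ℤ.+ n))
  (ℚᵘ.≃-trans (ℚᵘ.*≡* (numerators m n))
  (ℚᵘ.≃-trans (ℚᵘ.+-cong (ℚᵘ.≃-sym (toℚᵘ-/1 m)) (ℚᵘ.≃-sym (toℚᵘ-/1 n)))
              (ℚᵘ.≃-sym (ℚ.toℚᵘ-homo-+ (m ℚ./ 1) (n ℚ./ 1))))))
  where
  numerators : ∀ m n → (m ℤ.+ n) ℤ.* + 1 ≡ (m ℤ.* + 1 ℤ.+ n ℤ.* + 1) ℤ.* + 1
  numerators = ℤ-Ring.solve-∀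

/1-mono-≤ : ∀ {m n} → m ℤ.≤ n → m ℚ./ 1 ℚ.≤ n ℚ./ 1
/1-mono-≤ {m} {n} m≤n = ℚ.toℚᵘ-cancel-≤
  (ℚᵘ.≤-respˡ-≃ (ℚᵘ.≃-sym (toℚᵘ-/1 m)) (ℚᵘ.≤-respʳ-≃ (ℚᵘ.≃-sym (toℚᵘ-/1 n))
    (ℚᵘ.*≤* (ℤ.*-monoʳ-≤-nonNeg (+ 1) m≤n))))

/1-mono-< : ∀ {m n} → m ℤ.< n → m ℚ./ 1 ℚ.< n ℚ./ 1
/1-mono-< {m} {n} m<n = ℚ.toℚᵘ-cancel-<
  (ℚᵘ.<-respˡ-≃ (ℚᵘ.≃-sym (toℚᵘ-/1 m)) (ℚᵘ.<-respʳ-≃ (ℚᵘ.≃-sym (toℚᵘ-/1 n))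
    (ℚᵘ.*<* (ℤ.*-monoʳ-<-pos (+ 1) m<n))))

floor-≤ : ∀ x → ℚ.floor x ℚ./ 1 ℚ.≤ x
floor-≤ x@record{} = ℚ.toℚᵘ-cancel-≤
  (ℚᵘ.≤-respˡ-≃ (ℚᵘ.≃-sym (toℚᵘ-/1 (ℚ.floor x)))
    (ℚᵘ.*≤* (ℤ.≤-trans (ℤ.[n/d]*d≤n (ℚ.↥ x) (ℚ.↧ x)) (ℤ.≤-reflexive (≡.sym (ℤ.*-identityʳ (ℚ.↥ x)))))))

<-floor+1 : ∀ x → x ℚ.< ℤ.suc (ℚ.floor x) ℚ./ 1
<-floor+1 x@record{} = ℚ.toℚᵘ-cancel-<
  (ℚᵘ.<-respʳ-≃ (ℚᵘ.≃-sym (toℚᵘ-/1 (ℤ.suc (ℚ.floor x))))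
    (ℚᵘ.*<* (ℤ.≤-<-trans (ℤ.≤-reflexive (ℤ.*-identityʳ (ℚ.↥ x)))
      (ℤ.<-≤-trans (ℤ.n<s[n/ℕd]*d (ℚ.↥ x) (ℚ.↧ₙ x))
        (ℤ.≤-reflexive (≡.cong (λ k → ℤ.suc k ℤ.* ℚ.↧ x) (≡.sym (ℤ.*-identityˡ (ℚ.↥ x ℤ./ℕ ℚ.↧ₙ x)))))))))

ℚ-cancel : ∀ a b → (a ℚ.+ b) ℚ.- b ≡ a
ℚ-cancel a b = ≡.trans (ℚ.+-assoc a b (ℚ.- b)) (≡.trans (≡.cong (a ℚ.+_) (ℚ.+-inverseʳ b)) (ℚ.+-identityʳ a))

i≤∣i∣ : ∀ i → i ℤ.≤ + ℤ.∣ i ∣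
i≤∣i∣ (+ n)    = ℤ.≤-refl
i≤∣i∣ -[1+ n ] = ℤ.-≤+

-∣i∣≤i : ∀ i → ℤ.- (+ ℤ.∣ i ∣) ℤ.≤ i
-∣i∣≤i (+ zero)  = ℤ.≤-refl
-∣i∣≤i (+ suc n) = ℤ.-≤+
-∣i∣≤i -[1+ n ]  = ℤ.≤-refl

i<suc[i] : ∀ i → i ℤ.< ℤ.suc i
i<suc[i] i = ℤ.suc[i]≤j⇒i<j ℤ.≤-refl

i<i+suc[n] : ∀ i n → i ℤ.< i ℤ.+ + suc n
i<i+suc[n] i n = ℤ.<-≤-trans (i<suc[i] i) (ℤ.≤-trans (ℤ.≤-reflexive (ℤ.+-comm (+ 1) i)) (ℤ.+-monoʳ-≤ i (ℤ.+≤+ (ℕ.s≤s ℕ.z≤n))))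

module Multiples (w : ℚ) (0<w : 0ℚ ℚ.< w) where
  private instance
    pos-w : ℚ.Positive w
    pos-w = ℚ.positive 0<w
    nonNeg-w : ℚ.NonNegative w
    nonNeg-w = ℚ.pos⇒nonNeg w
    nonZero-w : ℚ.NonZero w
    nonZero-w = ℚ.pos⇒nonZero w

  -- For w = ϖ this is `ordπ` by definition, so these lemmas apply directly to the filtration of a
  -- local field. The choice w = 1 serves for powers of p, and w = - a for powers of an element of
  -- negative value a.
  mul : ℤ → ℚ
  mul n = (n ℚ./ 1) ℚ.* w

  mul-+ : ∀ m n → mul (m ℤ.+ n) ≡ mul m ℚ.+ mul n
  mul-+ m n = ≡.trans (≡.cong (ℚ._* w) (/1-+ m n)) (ℚ.*-distribʳ-+ w (m ℚ./ 1) (n ℚ./ 1))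

  mul-0 : mul (+ 0) ≡ 0ℚ
  mul-0 = ℚ.*-zeroˡ w

  mul-1 : mul (+ 1) ≡ w
  mul-1 = ℚ.*-identityˡ w

  mul-neg : ∀ n → mul (ℤ.- n) ≡ ℚ.- mul n
  mul-neg n = ℚG.inverseʳ-unique (mul n) (mul (ℤ.- n))
    (≡.trans (≡.sym (mul-+ n (ℤ.- n))) (≡.trans (≡.cong mul (ℤ.+-inverseʳ n)) mul-0))

  mul-suc : ∀ n → mul (ℤ.suc n) ≡ w ℚ.+ mul n
  mul-suc n = ≡.trans (mul-+ (+ 1) n) (≡.cong (ℚ._+ mul n) mul-1)

  mul-mono-≤ : ∀ {m n} → m ℤ.≤ n → mul m ℚ.≤ mul n
  mul-mono-≤ m≤n = ℚ.*-monoʳ-≤-nonNeg w (/1-mono-≤ m≤n)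

  mul-mono-< : ∀ {m n} → m ℤ.< n → mul m ℚ.< mul n
  mul-mono-< m<n = ℚ.*-monoˡ-<-pos w (/1-mono-< m<n)

  mul-cancel-≤ : ∀ {m n} → mul m ℚ.≤ mul n → m ℤ.≤ n
  mul-cancel-≤ {m} {n} h with m ℤ.≤? n
  ... | yes m≤n = m≤n
  ... | no  m≰n = ⊥-elim (ℚ.<-irrefl ≡.refl (ℚ.<-≤-trans (mul-mono-< (ℤ.≰⇒> m≰n)) h))

  mul-injective : ∀ {m n} → mul m ≡ mul n → m ≡ n
  mul-injective eq = ℤ.≤-antisym (mul-cancel-≤ (ℚ.≤-reflexive eq)) (mul-cancel-≤ (ℚ.≤-reflexive (≡.sym eq)))

  quotient : ∀ x → (x ℚ.* ℚ.1/ w) ℚ.* w ≡ x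
  quotient x = ≡.trans (ℚ.*-assoc x (ℚ.1/ w) w) (≡.trans (≡.cong (x ℚ.*_) (ℚ.*-inverseˡ w)) (ℚ.*-identityʳ x))

  floor-mul : ∀ x → ∃[ n ] mul n ℚ.≤ x × x ℚ.< mul (ℤ.suc n)
  floor-mul x = ℚ.floor y
    , ≡.subst (mul (ℚ.floor y) ℚ.≤_) (quotient x) (ℚ.*-monoʳ-≤-nonNeg w (floor-≤ y))
    , ≡.subst (ℚ._< mul (ℤ.suc (ℚ.floor y))) (quotient x) (ℚ.*-monoˡ-<-pos w (<-floor+1 y))
    where y = x ℚ.* ℚ.1/ w

  archimedean : ∀ x → ∃[ B ] (x ℚ.≤ mul (+ B)) × (mul (ℤ.- (+ B)) ℚ.≤ x)
  archimedean x with floor-mul x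
  ... | n , n≤x , x<1+n = B
    , ℚ.≤-trans (ℚ.<⇒≤ x<1+n) (mul-mono-≤ (ℤ.≤-trans (ℤ.+-monoʳ-≤ (+ 1) (i≤∣i∣ n)) ℤ.≤-refl))
    , ℚ.≤-trans (mul-mono-≤ (ℤ.≤-trans (ℤ.neg-mono-≤ (ℤ.+≤+ (ℕ.n≤1+n ℤ.∣ n ∣))) (-∣i∣≤i n))) n≤x
    where
    B = suc ℤ.∣ n ∣

-- Ideals, shells and digits of a local field.

module LocalFieldProperties {ℓ : ℕ} (L : LocalField ℓ) where
  open LocalField L
  open ValuedFieldProperties valuedField public
  open Multiples ϖ ϖ>0 public
  open IntegerSolver commutativeRing

  infix 4 _∈𝔩_
  -- A record rather than an abbreviation, so that n can be inferred from the type: unification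
  -- could not recover it from `ordπ n`. The same applies to `Shell`.
  record _∈𝔩_ (x : Carrier) (n : ℤ) : Set where
    constructor mem
    field ≤v : [ ordπ n ] ≤⁺ v x
  open _∈𝔩_ public

  record Shell (n : ℤ) (x : Carrier) : Set where
    constructor shell
    field v≡ : v x ≡ [ ordπ n ]
  open Shell public

  π^ : ℤ → Carrier
  π^ n = proj₁ π ^ℤ n

  π^-≉0 : ∀ n → π^ n ≉ 0#
  π^-≉0 = ^ℤ-≉0 (proj₂ π)

  π^-+ : ∀ m n → π^ (m ℤ.+ n) ≈ π^ m * π^ n
  π^-+ = ^ℤ-+ (proj₂ π)

  π^-inverse : ∀ n → π^ n * π^ (ℤ.- n) ≈ 1#
  π^-inverse = ^ℤ-inverse (proj₂ π)

  infix 4 _∈𝔩?_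
  _∈𝔩?_ : ∀ x n → Dec (x ∈𝔩 n)
  x ∈𝔩? n = Dec.map′ mem ≤v ([ ordπ n ] ≤⁺? v x)

  ∈-cong : ∀ {n x y} → x ≈ y → x ∈𝔩 n → y ∈𝔩 n
  ∈-cong x≈y (mem x∈) = mem (≤v-resp x≈y x∈)

  ∈-≡ : ∀ {m n x} → m ≡ n → x ∈𝔩 m → x ∈𝔩 n
  ∈-≡ ≡.refl x∈ = x∈

  0∈ : ∀ {n} → 0# ∈𝔩 n
  0∈ = mem ≤v-0

  ∈-+ : ∀ {n x y} → x ∈𝔩 n → y ∈𝔩 n → x + y ∈𝔩 n
  ∈-+ (mem x∈) (mem y∈) = mem (≤v-+ x∈ y∈)

  ∈-neg : ∀ {n x} → x ∈𝔩 n → - x ∈𝔩 n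
  ∈-neg (mem x∈) = mem (≤v-neg x∈)

  ∈-- : ∀ {n x y} → x ∈𝔩 n → y ∈𝔩 n → x - y ∈𝔩 n
  ∈-- x∈ y∈ = ∈-+ x∈ (∈-neg y∈)

  ∈--0 : ∀ {n x} → x ∈𝔩 n → x - 0# ∈𝔩 n
  ∈--0 x∈ = ∈-- x∈ 0∈

  ∈--0⁻¹ : ∀ {n x} → x - 0# ∈𝔩 n → x ∈𝔩 n
  ∈--0⁻¹ {x = x} x∈ = ∈-cong (solve 1 (λ x → x :- con (+ 0) := x) refl x) x∈

  ∈-mono : ∀ {m n x} → m ℤ.≤ n → x ∈𝔩 n → x ∈𝔩 m
  ∈-mono m≤n (mem x∈) = mem (⁺-trans [ mul-mono-≤ m≤n ] x∈)

  ∈-* : ∀ {m n x y} → x ∈𝔩 m → y ∈𝔩 n → x * y ∈𝔩 (m ℤ.+ n)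
  ∈-* {m} {n} {x} {y} (mem x∈) (mem y∈) =
    mem (≡.subst (λ a → [ a ] ≤⁺ v (x * y)) (≡.sym (mul-+ m n)) (≤v-* x∈ y∈))

  integral⇒∈ : ∀ {x} → Integral x → x ∈𝔩 + 0
  integral⇒∈ {x} 0≤ = mem (≡.subst (λ a → [ a ] ≤⁺ v x) (≡.sym mul-0) 0≤)

  ∈⇒integral : ∀ {x} → x ∈𝔩 + 0 → Integral x
  ∈⇒integral {x} (mem x∈) = ≡.subst (λ a → [ a ] ≤⁺ v x) mul-0 x∈

  close⇒∈ : ∀ {x} → [ ϖ ] ≤⁺ v x → x ∈𝔩 + 1
  close⇒∈ {x} ϖ≤ = mem (≡.subst (λ a → [ a ] ≤⁺ v x) (≡.sym mul-1) ϖ≤)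

  ∈⇒close : ∀ {x} → x ∈𝔩 + 1 → [ ϖ ] ≤⁺ v x
  ∈⇒close {x} (mem x∈) = ≡.subst (λ a → [ a ] ≤⁺ v x) mul-1 x∈

  shell-* : ∀ {m n x y} → Shell m x → Shell n y → Shell (m ℤ.+ n) (x * y)
  shell-* {m} {n} (shell sx) (shell sy) = shell (≡.trans (v-*-[] sx sy) (≡.cong [_] (≡.sym (mul-+ m n))))

  shell-inv : ∀ {n x} → Shell n x → Shell (ℤ.- n) (inv x)
  shell-inv {n} (shell sx) = shell (≡.trans (v-inv sx) (≡.cong [_] (≡.sym (mul-neg n))))

  unit⇒shell : ∀ {x} → v x ≡ [ 0ℚ ] → Shell (+ 0) x
  unit⇒shell vx = shell (≡.trans vx (≡.cong [_] (≡.sym mul-0)))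

  shell⇒unit : ∀ {x} → Shell (+ 0) x → v x ≡ [ 0ℚ ]
  shell⇒unit (shell sx) = ≡.trans sx (≡.cong [_] mul-0)

  shell-π : Shell (+ 1) (proj₁ π)
  shell-π = shell (≡.trans v-π (≡.cong [_] (≡.sym mul-1)))

  shell-π^ : ∀ n → Shell n (π^ n)
  shell-π^ (+ zero)      = unit⇒shell v-1
  shell-π^ (+ suc n)     = shell-* shell-π (shell-π^ (+ n))
  shell-π^ -[1+ zero ]   = shell-* (shell-inv shell-π) (shell-π^ (+ 0))
  shell-π^ -[1+ suc n ]  = shell-* (shell-inv shell-π) (shell-π^ -[1+ n ])

  shell⇒∈ : ∀ {n x} → Shell n x → x ∈𝔩 n
  shell⇒∈ (shell sx) = mem (⁺-reflexive (≡.sym sx))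

  π^∈ : ∀ n → π^ n ∈𝔩 n
  π^∈ n = shell⇒∈ (shell-π^ n)

  shell⇒≉0 : ∀ {n x} → Shell n x → x ≉ 0#
  shell⇒≉0 (shell sx) = v≡[]⇒≉0 sx

  shell-∈⇒≤ : ∀ {m n x} → Shell n x → x ∈𝔩 m → m ℤ.≤ n
  shell-∈⇒≤ {m} (shell sx) (mem x∈) with ≡.subst ([ ordπ m ] ≤⁺_) sx x∈
  ... | [ h ] = mul-cancel-≤ h

  shell-unique : ∀ {m n x} → Shell m x → Shell n x → m ≡ n
  shell-unique (shell sm) (shell sn) = mul-injective ([]-injective (≡.trans (≡.sym sm) sn))

  shell-cong : ∀ {n x y} → x ≈ y → Shell n x → Shell n y
  shell-cong x≈y (shell sx) = shell (≡.trans (≡.sym (v-cong x≈y)) sx)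

  shell-≡ : ∀ {m n x} → m ≡ n → Shell m x → Shell n x
  shell-≡ ≡.refl sx = sx

  -- Dividing x by πⁿ with n the integral part of v x / ϖ leaves a value in [0, ϖ), and `π-least`
  -- excludes everything in it but 0. So the values of nonzero elements are the integer multiples of
  -- ϖ.
  shell-exists : ∀ {x} → x ≉ 0# → ∃[ n ] Shell n x
  shell-exists {x} x≉0 with val x≉0
  ... | a , vx≡a with floor-mul a
  ...   | n , n≤a , a<1+n = n , shell (≡.trans vx≡a (≡.cong [_] a≡n))
    where
    y = x * π^ (ℤ.- n)
    b = a ℚ.- ordπ n
    vy : v y ≡ [ b ]
    vy = v-*-[] vx≡a (≡.trans (v≡ (shell-π^ (ℤ.- n))) (≡.cong [_] (mul-neg n)))
    b<ϖ : b ℚ.< ϖ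
    b<ϖ = ≡.subst (b ℚ.<_) (≡.trans (≡.cong (ℚ._- ordπ n) (mul-suc n)) (ℚ-cancel ϖ (ordπ n)))
            (ℚ.+-monoˡ-< (ℚ.- ordπ n) a<1+n)
    b≮0 : ¬ (0ℚ ℚ.< b)
    b≮0 0<b with ⁺-trans (π-least y (≡.subst ([ 0ℚ ] <⁺_) (≡.sym vy) [ 0<b ])) (⁺-reflexive vy)
    ... | [ ϖ≤b ] = ℚ.<-irrefl ≡.refl (ℚ.<-≤-trans b<ϖ ϖ≤b)
    0≤b : 0ℚ ℚ.≤ b
    0≤b = ≡.subst (ℚ._≤ b) (ℚ.+-inverseʳ (ordπ n)) (ℚ.+-monoˡ-≤ (ℚ.- ordπ n) n≤a)
    b≡0 : b ≡ 0ℚ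
    b≡0 = ℚ.≤-antisym (ℚ.≮⇒≥ b≮0) 0≤b
    a≡n : a ≡ ordπ n
    a≡n = ℚG.x∙y⁻¹≈ε⇒x≈y a (ordπ n) b≡0

  shell? : ∀ n x → Dec (Shell n x)
  shell? n x = Dec.map′ shell v≡ (≡-dec ℚ._≟_ (v x) [ ordπ n ])

  ∉⇒shell : ∀ {n x} → ¬ (x ∈𝔩 n) → ∃[ m ] m ℤ.< n × Shell m x
  ∉⇒shell {n} {x} x∉ =
    let m , sx = shell-exists (λ x≈0 → x∉ (mem (≈0⇒≤v x≈0)))
    in m , ℤ.≰⇒> (λ n≤m → x∉ (∈-mono n≤m (shell⇒∈ sx))) , sx

  ∈∧∉⇒shell : ∀ {n x} → x ∈𝔩 n → ¬ (x ∈𝔩 ℤ.suc n) → Shell n x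
  ∈∧∉⇒shell {n} {x} x∈ x∉ = let m , m<1+n , sx = ∉⇒shell x∉ in shell-≡
    (ℤ.≤-antisym (≡.subst (m ℤ.≤_) (ℤ.pred-suc n) (ℤ.i<j⇒i≤pred[j] m<1+n)) (shell-∈⇒≤ sx x∈)) sx

  shell⇒∉ : ∀ {m n x} → Shell m x → m ℤ.< n → ¬ (x ∈𝔩 n)
  shell⇒∉ sx m<n x∈ = ℤ.<⇒≱ m<n (shell-∈⇒≤ sx x∈)

  -- If y had order greater than n, so would x = y - (y - x), since n < m.
  shell-perturb : ∀ {m n x y} → Shell n x → n ℤ.< m → y - x ∈𝔩 m → Shell n y
  shell-perturb {m} {n} {x} {y} sx n<m d∈ = ∈∧∉⇒shell
    (∈-cong (solve 2 (λ x y → (y :- x) :+ x := y) refl x y) (∈-+ (∈-mono (ℤ.<⇒≤ n<m) d∈) (shell⇒∈ sx)))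
    (λ y∈ → shell⇒∉ sx (i<suc[i] n)
              (∈-cong (solve 2 (λ x y → y :- (y :- x) := x) refl x y)
                (∈-- y∈ (∈-mono (ℤ.i<j⇒suc[i]≤j n<m) d∈))))

  unit-∈ : ∀ {u n x} → v u ≡ [ 0ℚ ] → x ∈𝔩 n → u * x ∈𝔩 n
  unit-∈ vu (mem x∈) = mem (≤v-scale (unit-integral vu) x∈)

  -- The coefficient of πⁿ in an expansion of x: rescale x to an integral element, take its residue
  -- and scale back.
  digit : ∀ n {x} → x ∈𝔩 n → ∃[ d ] (x - π^ n * residue d) ∈𝔩 ℤ.suc n
  digit n {x} x∈ with residue-surj (π^ (ℤ.- n) * x)
                     (∈⇒integral (∈-≡ (ℤ.+-inverseˡ n) (∈-* (π^∈ (ℤ.- n)) x∈)))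
  ... | d , close = d , ∈-≡ (ℤ.+-comm n (+ 1)) (∈-cong eq (∈-* (π^∈ n) (close⇒∈ close)))
    where
    open import Relation.Binary.Reasoning.Setoid setoid
    eq : π^ n * (π^ (ℤ.- n) * x - residue d) ≈ x - π^ n * residue d
    eq = begin
      π^ n * (π^ (ℤ.- n) * x - residue d)       ≈⟨ solve 4 (λ a b x r → a :* (b :* x :- r) := a :* b :* x :- a :* r) refl (π^ n) (π^ (ℤ.- n)) x (residue d) ⟩
      π^ n * π^ (ℤ.- n) * x - π^ n * residue d  ≈⟨ +-congʳ (trans (*-congʳ (π^-inverse n)) (*-identityˡ x)) ⟩
      x - π^ n * residue d                      ∎

  digit-unique : ∀ n {d e} → (π^ n * residue d - π^ n * residue e) ∈𝔩 ℤ.suc n → d ≡ e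
  digit-unique n {d} {e} h = residue-inj d e (∈⇒close (∈-≡ -n+1+n (∈-cong eq (∈-* (π^∈ (ℤ.- n)) h))))
    where
    open import Relation.Binary.Reasoning.Setoid setoid
    -n+1+n : ℤ.- n ℤ.+ ℤ.suc n ≡ + 1
    -n+1+n = ≡.trans (≡.cong (λ k → ℤ.- n ℤ.+ k) (ℤ.+-comm (+ 1) n))
             (≡.trans (≡.sym (ℤ.+-assoc (ℤ.- n) n (+ 1))) (≡.cong (ℤ._+ + 1) (ℤ.+-inverseˡ n)))
    eq : π^ (ℤ.- n) * (π^ n * residue d - π^ n * residue e) ≈ residue d - residue e
    eq = begin
      π^ (ℤ.- n) * (π^ n * residue d - π^ n * residue e)
        ≈⟨ solve 4 (λ a b x r → b :* (a :* x :- a :* r) := a :* b :* (x :- r)) refl (π^ n) (π^ (ℤ.- n)) (residue d) (residue e) ⟩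
      π^ n * π^ (ℤ.- n) * (residue d - residue e)
        ≈⟨ trans (*-congʳ (π^-inverse n)) (*-identityˡ _) ⟩
      residue d - residue e ∎

-- Sums over the classes of one ideal modulo another.

injective⇒surjective : ∀ {n} (f : Fin n → Fin n) → (∀ {i j} → f i ≡ f j → i ≡ j) → ∀ j → ∃[ i ] f i ≡ j
injective⇒surjective {suc n} f f-inj j with Fin.any? (λ i → f i Fin.≟ j)
... | yes hit  = hit
-- Removing a missed value j would map `Fin (suc n)` injectively into `Fin n`.
... | no  miss = ⊥-elim (ℕ.1+n≰n (Fin.injective⇒≤ {f = λ i → Fin.punchOut (j≢ i)}
                   (λ eq → f-inj (Fin.punchOut-injective (j≢ _) (j≢ _) eq))))
  where
  j≢ : ∀ i → ¬ (j ≡ f i)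
  j≢ i eq = miss (i , ≡.sym eq)

injective⇒permutation : ∀ {n} (f : Fin n → Fin n) → (∀ {i j} → f i ≡ f j → i ≡ j) → Permutation n n
injective⇒permutation f f-inj = permutation f (proj₁ ∘ surj) (proj₂ ∘ surj) (λ i → f-inj (proj₂ (surj (f i))))
  where surj = injective⇒surjective f f-inj

-- Σ𝔩 a n h is the sum of h over the representatives of 𝔩ᵃ/𝔩ᵃ⁺ⁿ that
-- have a digit expansion Σ_{a ≤ i < a+n} dᵢ πⁱ.
module DigitSums {ℓ : ℕ} (L : LocalField ℓ) (F : ValuedField) where
  private
    module K where
      open LocalField L public
      open LocalFieldProperties L public
    module C where
      open ValuedField F public
      open ValuedFieldProperties F public
    module SK = IntegerSolver K.commutativeRing
    module Sum = SemiringSum C.semiring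
  open K using (_∈𝔩_; π^; residue)

  Σ𝔩 : ℤ → ℕ → (K.Carrier → C.Carrier) → C.Carrier
  Σ𝔩 a zero    h = h K.0#
  Σ𝔩 a (suc n) h = C.sum (λ d → Σ𝔩 (ℤ.suc a) n (λ r → h (π^ a K.* residue d K.+ r)))

  step∈ : ∀ a {r} d → r ∈𝔩 ℤ.suc a → π^ a K.* residue d K.+ r ∈𝔩 a
  step∈ a d r∈ = K.∈-+ (K.∈-≡ (ℤ.+-identityʳ a) (K.∈-* (K.π^∈ a) (K.integral⇒∈ (K.residue-int d))))
                       (K.∈-mono (ℤ.i≤suc[i] a) r∈)

  suc-shift : ∀ a n → a ℤ.+ + suc n ≡ ℤ.suc a ℤ.+ + n
  suc-shift a n = lemma a (+ n)
    where
    lemma : ∀ a b → a ℤ.+ (+ 1 ℤ.+ b) ≡ + 1 ℤ.+ a ℤ.+ b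
    lemma = ℤ-Ring.solve-∀

  module _ (N : ℚ ⁺) where
    open C.Approx N

    Periodic : ℤ → (K.Carrier → C.Carrier) → Set
    Periodic b h = ∀ x y → x K.- y ∈𝔩 b → h x ~ h y

    periodic-shift : ∀ {b h} c → Periodic b h → Periodic b (λ r → h (c K.+ r))
    periodic-shift c per x y x-y∈ = per _ _
      (K.∈-cong (SK.solve 3 (λ c x y → x :- y := (c :+ x) :- (c :+ y)) K.refl c x y) x-y∈)
      where open SK

    Σ-~-cong : ∀ a n {h g} → (∀ x → x ∈𝔩 a → h x ~ g x) → Σ𝔩 a n h ~ Σ𝔩 a n g
    Σ-~-cong a zero    h~g = h~g K.0# K.0∈
    Σ-~-cong a (suc n) h~g = ~-sum (λ d → Σ-~-cong (ℤ.suc a) n (λ r r∈ → h~g _ (step∈ a d r∈)))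

    sum-single : ∀ {n} (t : Fin n → C.Carrier) i → (∀ j → ¬ (j ≡ i) → t j ~ C.0#) → C.sum t ~ t i
    sum-single {suc n} t i h = ~-trans (≈⇒~ (Sum.sum-remove {i = i} t))
      (~-trans (~-+ ~-refl (~-trans (~-sum {t = λ _ → C.0#} (λ j → h _ (Fin.punchInᵢ≢i i j))) (≈⇒~ (Sum.sum-replicate-zero n))))
               (≈⇒~ (C.+-identityʳ _)))

  Σ-cong : ∀ a n {h g} → (∀ x → x ∈𝔩 a → h x C.≈ g x) → Σ𝔩 a n h C.≈ Σ𝔩 a n g
  Σ-cong a n h≈g = C.~⊤⇒≈ (Σ-~-cong ⊤⁺ a n (λ x x∈ → C.Approx.≈⇒~ ⊤⁺ (h≈g x x∈)))

  Σ-+ : ∀ a n h g → Σ𝔩 a n (λ x → h x C.+ g x) C.≈ Σ𝔩 a n h C.+ Σ𝔩 a n g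
  Σ-+ a zero    h g = C.refl
  Σ-+ a (suc n) h g = C.trans (Sum.sum-cong-≋ {K.q} (λ d → Σ-+ (ℤ.suc a) n _ _)) (Sum.∑-distrib-+ {K.q} _ _)

  Σ-* : ∀ a n c h → Σ𝔩 a n (λ x → c C.* h x) C.≈ c C.* Σ𝔩 a n h
  Σ-* a zero    c h = C.refl
  Σ-* a (suc n) c h = C.trans (Sum.sum-cong-≋ {K.q} (λ d → Σ-* (ℤ.suc a) n c _)) (C.sym (Sum.*-distribˡ-sum {K.q} c _))

  Σ-0 : ∀ a n → Σ𝔩 a n (λ _ → C.0#) C.≈ C.0#
  Σ-0 a zero    = C.refl
  Σ-0 a (suc n) = C.trans (Sum.sum-cong-≋ {K.q} (λ d → Σ-0 (ℤ.suc a) n)) (Sum.sum-replicate-zero K.q)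

  Σ-≤v : ∀ {N} a n {h} → (∀ x → x ∈𝔩 a → N ≤⁺ C.v (h x)) → N ≤⁺ C.v (Σ𝔩 a n h)
  Σ-≤v a zero    h = h K.0# K.0∈
  Σ-≤v a (suc n) h = C.≤v-sum (λ d → Σ-≤v (ℤ.suc a) n (λ r r∈ → h _ (step∈ a d r∈)))

  Σ-sum : ∀ a n {m} (h : Fin m → K.Carrier → C.Carrier) →
    Σ𝔩 a n (λ x → C.sum (λ i → h i x)) C.≈ C.sum (λ i → Σ𝔩 a n (h i))
  Σ-sum a n {zero}  h = Σ-0 a n
  Σ-sum a n {suc m} h = C.trans (Σ-+ a n _ _) (C.+-congˡ (Σ-sum a n (h ∘ fsuc)))

  Σ-swap : ∀ a n b m (h : K.Carrier → K.Carrier → C.Carrier) →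
    Σ𝔩 a n (λ x → Σ𝔩 b m (h x)) C.≈ Σ𝔩 b m (λ y → Σ𝔩 a n (λ x → h x y))
  Σ-swap a zero    b m h = C.refl
  Σ-swap a (suc n) b m h =
    C.trans (Sum.sum-cong-≋ {K.q} (λ d → Σ-swap (ℤ.suc a) n b m _)) (C.sym (Σ-sum b m {K.q} _))

  Σ-π : ∀ k a n {h} → (∀ {x y} → x K.≈ y → h x C.≈ h y) →
    Σ𝔩 (k ℤ.+ a) n h C.≈ Σ𝔩 a n (λ x → h (π^ k K.* x))
  Σ-π k a zero    h-cong = h-cong (K.sym (K.zeroʳ _))
  Σ-π k a (suc n) {h} h-cong = Sum.sum-cong-≋ {K.q} λ d →
    C.trans (C.reflexive (≡.cong (λ b → Σ𝔩 b n (λ r → h (π^ (k ℤ.+ a) K.* residue d K.+ r))) (shift k a)))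
    (C.trans (Σ-π k (ℤ.suc a) n (λ x≈y → h-cong (K.+-congˡ x≈y)))
      (Σ-cong (ℤ.suc a) n (λ r _ → h-cong
        (K.trans (K.+-congʳ (K.*-congʳ (K.π^-+ k a)))
          (SK.solve 4 (λ a b c r → a :* b :* c :+ a :* r := a :* (b :* c :+ r)) K.refl (π^ k) (π^ a) (residue d) r)))))
    where
    open SK
    shift : ∀ k a → + 1 ℤ.+ (k ℤ.+ a) ≡ k ℤ.+ (+ 1 ℤ.+ a)
    shift = ℤ-Ring.solve-∀

  module _ (N : ℚ ⁺) where
    open C.Approx N

    -- The map x ↦ u x + t permutes the classes, but the residues are an arbitrary system, so digits
    -- carry: `σ` permutes the leading digits, and each of them passes its own translation on to the
    -- tail. This is why multiplication by a unit and translation are treated in one induction.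
    Σ-affine : ∀ a n {h u t} → K.v u ≡ [ 0ℚ ] → t ∈𝔩 a → Periodic N (a ℤ.+ + n) h →
      Σ𝔩 a n (λ x → h (u K.* x K.+ t)) ~ Σ𝔩 a n h
    Σ-affine a zero {h} {u} {t} vu t∈ per = per _ _ (K.∈-≡ (≡.sym (ℤ.+-identityʳ a))
      (K.∈-cong (SK.solve 2 (λ u t → t := (u :* con (+ 0) :+ t) :- con (+ 0)) K.refl u t) t∈))
      where open SK
    Σ-affine a (suc n) {h} {u} {t} vu t∈ per = ~-trans
      (~-sum {K.q} (λ d → ~-trans
        (Σ-~-cong N (ℤ.suc a) n (λ r r∈ → per _ _ (K.mem (K.≈0⇒≤v
          (SK.solve 6 (λ u p d r t e → (u :* (p :* d :+ r) :+ t) :- (p :* e :+ (u :* r :+ (u :* (p :* d) :+ t :- p :* e))) := con (+ 0)) K.refl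
            u (π^ a) (residue d) r t (residue (σ d)))))))
        (Σ-affine (ℤ.suc a) n vu (rest∈ d)
          (periodic-shift N _ (≡.subst (λ b → Periodic N b h) (suc-shift a n) per)))))
      (≈⇒~ (C.sym (Sum.sum-permute (λ d → Σ𝔩 (ℤ.suc a) n (λ r → h (π^ a K.* residue d K.+ r))) (injective⇒permutation σ σ-injective))))
      where
      open SK
      image : Fin K.q → K.Carrier
      image d = u K.* (π^ a K.* residue d) K.+ t
      image∈ : ∀ d → image d ∈𝔩 a
      image∈ d = K.∈-+ (K.unit-∈ vu (K.∈-cong (K.+-identityʳ _) (step∈ a d K.0∈))) t∈
      σ : Fin K.q → Fin K.q
      σ d = proj₁ (K.digit a (image∈ d))
      rest∈ : ∀ d → image d K.- π^ a K.* residue (σ d) ∈𝔩 ℤ.suc a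
      rest∈ d = proj₂ (K.digit a (image∈ d))
      σ-injective : ∀ {d e} → σ d ≡ σ e → d ≡ e
      σ-injective {d} {e} eq = K.digit-unique a (K.mem (K.unit-cancel vu (K.≤v (K.∈-cong
        (SK.solve 6 (λ u p d e t s → ((u :* (p :* d) :+ t) :- s) :- ((u :* (p :* e) :+ t) :- s) := u :* (p :* d :- p :* e)) K.refl
          u (π^ a) (residue d) (residue e) t (π^ a K.* residue (σ e)))
        (K.∈-- (≡.subst (λ s → image d K.- π^ a K.* residue s ∈𝔩 ℤ.suc a) eq (rest∈ d)) (rest∈ e))))))

    Σ-translate : ∀ a n {h t} → t ∈𝔩 a → Periodic N (a ℤ.+ + n) h →
      Σ𝔩 a n (λ x → h (x K.+ t)) ~ Σ𝔩 a n h
    Σ-translate a n {h} {t} t∈ per = ~-trans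
      (Σ-~-cong N a n (λ x _ → per _ _ (K.mem (K.≈0⇒≤v
        (SK.solve 2 (λ x t → (x :+ t) :- (con (+ 1) :* x :+ t) := con (+ 0)) K.refl x t)))))
      (Σ-affine a n K.v-1 t∈ per)
      where open SK

    Σ-unit : ∀ a n {h u} → K.v u ≡ [ 0ℚ ] → Periodic N (a ℤ.+ + n) h →
      Σ𝔩 a n (λ x → h (u K.* x)) ~ Σ𝔩 a n h
    Σ-unit a n {h} {u} vu per = ~-trans
      (Σ-~-cong N a n (λ x _ → per _ _ (K.mem (K.≈0⇒≤v
        (SK.solve 2 (λ x u → (u :* x) :- (u :* x :+ con (+ 0)) := con (+ 0)) K.refl x u)))))
      (Σ-affine a n vu K.0∈ per)
      where open SK

    -- One more digit splits every class into q classes, on which h takes the same value modulo N.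
    Σ-refine : ∀ a n {h} → Periodic N (a ℤ.+ + n) h → Σ𝔩 a (suc n) h ~ C.fromℕ K.q C.* Σ𝔩 a n h
    Σ-refine a zero {h} per = ~-trans
      (~-sum {t = λ _ → h K.0#} (λ d → per _ _ (K.∈-cong (SK.solve 1 (λ s → s := s :- con (+ 0)) K.refl (π^ a K.* residue d K.+ K.0#))
        (K.∈-≡ (≡.sym (ℤ.+-identityʳ a)) (step∈ a d K.0∈)))))
      (≈⇒~ (C.trans (Sum.sum-replicate K.q) (C.trans (Mult.×-congʳ C.semiring K.q (C.sym (C.*-identityˡ _))) (C.sym (Mult.×-assoc-* C.semiring K.q C.1# _)))))
      where open SK
    Σ-refine a (suc n) {h} per = ~-trans
      (~-sum {K.q} (λ d → Σ-refine (ℤ.suc a) n (periodic-shift N _ (≡.subst (λ b → Periodic N b h) (suc-shift a n) per))))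
      (≈⇒~ (C.sym (Sum.*-distribˡ-sum {K.q} (C.fromℕ K.q) _)))

    -- Only one leading digit meets the support 𝔩ᵃ⁺¹, namely the one that represents zero. Since
    -- `residue` is an arbitrary system this representative may differ from `0#`, and a translation
    -- within 𝔩ᵃ⁺¹ removes it.
    Σ-coarse : ∀ a n {h} → (∀ x → ¬ (x ∈𝔩 ℤ.suc a) → h x ~ C.0#) → Periodic N (a ℤ.+ + suc n) h →
      Σ𝔩 a (suc n) h ~ Σ𝔩 (ℤ.suc a) n h
    Σ-coarse a n {h} off per = ~-trans
      (sum-single N _ d₀ (λ d d≢d₀ → ~-trans (Σ-~-cong N (ℤ.suc a) n (λ r r∈ → off _ (λ s∈ → d≢d₀ (K.digit-unique a
        (K.∈-cong (SK.solve 3 (λ s r e → (s :+ r :- r) :+ (con (+ 0) :- e) := s :- e) K.refl _ r _)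
          (K.∈-+ (K.∈-- s∈ r∈) rest∈)))))) (≈⇒~ (Σ-0 (ℤ.suc a) n))))
      (~-trans (Σ-~-cong N (ℤ.suc a) n (λ r _ → per _ _ (K.mem (K.≈0⇒≤v
          (SK.solve 2 (λ s r → (s :+ r) :- (r :+ s) := con (+ 0)) K.refl _ r)))))
        (Σ-translate (ℤ.suc a) n lead∈ (≡.subst (λ b → Periodic N b h) (suc-shift a n) per)))
      where
      open SK
      d₀ : Fin K.q
      d₀ = proj₁ (K.digit a K.0∈)
      rest∈ : K.0# K.- π^ a K.* residue d₀ ∈𝔩 ℤ.suc a
      rest∈ = proj₂ (K.digit a K.0∈)
      lead∈ : π^ a K.* residue d₀ ∈𝔩 ℤ.suc a
      lead∈ = K.∈-cong (SK.solve 1 (λ s → :- (con (+ 0) :- s) := s) K.refl _) (K.∈-neg rest∈)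

-- Compactness of the ideals, by finite search.

all-or-some : ∀ n {A B : Fin n → Set} → (∀ i → A i ⊎ B i) → (∀ i → A i) ⊎ (∃[ i ] B i)
all-or-some zero    h = inj₁ λ ()
all-or-some (suc n) h with h fzero | all-or-some n (h ∘ fsuc)
... | inj₂ b | _            = inj₂ (fzero , b)
... | inj₁ _ | inj₂ (i , b) = inj₂ (fsuc i , b)
... | inj₁ a | inj₁ as      = inj₁ λ { fzero → a ; (fsuc i) → as i }

common-bound : ∀ n {P : Fin n → ℕ → Set} → (∀ i {k m} → k ℕ.≤ m → P i k → P i m) →
  (∀ i → ∃[ k ] P i k) → ∃[ m ] ∀ i → P i m
common-bound zero    mono h = 0 , λ ()
common-bound (suc n) mono h with h fzero | common-bound n (mono ∘ fsuc) (h ∘ fsuc)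
... | k , pk | m , pm = k ℕ.⊔ m , λ
  { fzero    → mono fzero (ℕ.m≤m⊔n k m) pk
  ; (fsuc i) → mono (fsuc i) (ℕ.m≤n⊔m k m) (pm i) }

module Compactness {ℓ : ℕ} (L : LocalField ℓ) where
  open LocalField L
  open LocalFieldProperties L
  open IntegerSolver commutativeRing

  private
    suc-shift : ∀ a n → ℤ.suc a ℤ.+ + n ≡ a ℤ.+ + suc n
    suc-shift a n = lemma a (+ n)
      where
      lemma : ∀ a b → + 1 ℤ.+ a ℤ.+ b ≡ a ℤ.+ (+ 1 ℤ.+ b)
      lemma = ℤ-Ring.solve-∀

    shift-close : ∀ a n c {x y} → x - y ∈𝔩 ℤ.suc a ℤ.+ + n → (c + x) - (c + y) ∈𝔩 a ℤ.+ + suc n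
    shift-close a n c {x} {y} h = ∈-≡ (suc-shift a n)
      (∈-cong (solve 3 (λ c x y → x :- y := (c :+ x) :- (c :+ y)) refl c x y) h)

    digit-close : ∀ m s x → (s + (x - s)) - x ∈𝔩 m
    digit-close m s x = ∈-cong (solve 2 (λ s x → con (+ 0) := (s :+ (x :- s)) :- x) refl s x) 0∈

    lead∈ : ∀ a d → π^ a * residue d ∈𝔩 a
    lead∈ a d = ∈-≡ (ℤ.+-identityʳ a) (∈-* (π^∈ a) (integral⇒∈ (residue-int d)))

  -- One representative is tested in each of the finitely many classes of 𝔩ᵃ/𝔩ᵃ⁺ⁿ. Invariance
  -- carries P from the representatives to all points, while Q is asserted at the representative
  -- found.
  search : ∀ a n {P Q : Carrier → Set} →
    (∀ x y → x - y ∈𝔩 a ℤ.+ + n → P x → P y) →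
    (∀ x → x ∈𝔩 a → P x ⊎ Q x) →
    (∀ x → x ∈𝔩 a → P x) ⊎ (∃[ x ] x ∈𝔩 a × Q x)
  search a zero inv decide with decide 0# 0∈
  ... | inj₂ q = inj₂ (0# , 0∈ , q)
  ... | inj₁ p = inj₁ λ x x∈ → inv 0# x (∈-≡ (≡.sym (ℤ.+-identityʳ a)) (∈-- 0∈ x∈)) p
  search a (suc n) {P} {Q} inv decide with all-or-some q (λ d →
    search (ℤ.suc a) n {λ r → P (π^ a * residue d + r)} {λ r → Q (π^ a * residue d + r)}
      (λ x y x-y∈ → inv _ _ (shift-close a n _ x-y∈))
      (λ r r∈ → decide _ (∈-+ (lead∈ a d) (∈-mono (ℤ.i≤suc[i] a) r∈))))
  ... | inj₂ (d , r , r∈ , qr) = inj₂ (_ , ∈-+ (lead∈ a d) (∈-mono (ℤ.i≤suc[i] a) r∈) , qr)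
  ... | inj₁ all = inj₁ λ x x∈ → let d , r∈ = digit a x∈ in
    inv _ x (digit-close (a ℤ.+ + suc n) (π^ a * residue d) x) (all d _ r∈)

  -- The maximum of the bounds at finitely many representatives.
  uniform-bound : ∀ a n {P : Carrier → ℕ → Set} →
    (∀ x {k m} → k ℕ.≤ m → P x k → P x m) →
    (∀ x y k → x - y ∈𝔩 a ℤ.+ + n → P x k → P y k) →
    (∀ x → x ∈𝔩 a → ∃[ k ] P x k) → ∃[ m ] ∀ x → x ∈𝔩 a → P x m
  uniform-bound a zero mono inv bound with bound 0# 0∈
  ... | m , p = m , λ x x∈ → inv 0# x m (∈-≡ (≡.sym (ℤ.+-identityʳ a)) (∈-- 0∈ x∈)) p
  uniform-bound a (suc n) {P} mono inv bound with common-bound q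
      (λ d k≤m h r r∈ → mono _ k≤m (h r r∈))
      (λ d → uniform-bound (ℤ.suc a) n {λ r → P (π^ a * residue d + r)}
        (λ r → mono _)
        (λ x y k x-y∈ → inv _ _ k (shift-close a n _ x-y∈))
        (λ r r∈ → bound _ (∈-+ (lead∈ a d) (∈-mono (ℤ.i≤suc[i] a) r∈))))
  ... | m , h = m , λ x x∈ → let d , r∈ = digit a x∈ in
    inv _ x m (digit-close (a ℤ.+ + suc n) (π^ a * residue d) x) (h d _ r∈)

-- Natural numbers in valued fields, and the absolute values of ℓ, p and q.

module NaturalNumbers (F : ValuedField) where
  open ValuedField F
  open ValuedFieldProperties F
  private
    module × = Mult semiring
    module Sum = SemiringSum semiring

  fromℕ-+ : ∀ m n → fromℕ (m ℕ.+ n) ≈ fromℕ m + fromℕ n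
  fromℕ-+ = ×.×-homo-+ 1#

  fromℕ-* : ∀ m n → fromℕ (m ℕ.* n) ≈ fromℕ m * fromℕ n
  fromℕ-* = ×.×1-homo-*

  fromℕ-1 : fromℕ 1 ≈ 1#
  fromℕ-1 = +-identityʳ 1#

  partialSum-suc : ∀ g n → partialSum g (suc n) ≈ partialSum g n + g n
  partialSum-suc g zero    = +-comm _ _
  partialSum-suc g (suc n) = trans (+-congˡ (partialSum-suc (g ∘ suc) n)) (sym (+-assoc _ _ _))

module Homomorphism {A B : ValuedField} (E : ValuedExtension A B) where
  private
    module A = ValuedField A
    module B = ValuedField B
  open ValuedExtension E
  open RingMorphisms A.rawRing B.rawRing using (module IsRingHomomorphism)
  open IsRingHomomorphism homo public

  ⟦fromℕ⟧ : ∀ n → ⟦ A.fromℕ n ⟧ B.≈ B.fromℕ n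
  ⟦fromℕ⟧ zero    = 0#-homo
  ⟦fromℕ⟧ (suc n) = B.trans (+-homo _ _) (B.+-cong 1#-homo (⟦fromℕ⟧ n))

  v-fromℕ : ∀ n → B.v (B.fromℕ n) ≡ A.v (A.fromℕ n)
  v-fromℕ n = ≡.trans (B.v-cong (B.sym (⟦fromℕ⟧ n))) (v-⟦_⟧ (A.fromℕ n))

module PAdicProperties {r : ℕ} (Q : PAdicNumbers r) where
  open PAdicNumbers Q
  open ValuedFieldProperties valuedField
  open NaturalNumbers valuedField
  open Multiples 1ℚ (ℚ.positive⁻¹ 1ℚ)

  v-fromℕ^ : ∀ t → v (fromℕ (r ℕ.^ t)) ≡ [ (+ t) ℚ./ 1 ]
  v-fromℕ^ zero    = ≡.trans (v-cong fromℕ-1) v-1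
  v-fromℕ^ (suc t) = ≡.trans (v-cong (fromℕ-* r (r ℕ.^ t)))
    (≡.trans (v-*-[] v-r (v-fromℕ^ t)) (≡.cong [_] (≡.sym (/1-+ (+ 1) (+ t)))))

  0<1/ : ∀ t → 0ℚ ℚ.< (+ suc t) ℚ./ 1
  0<1/ t = /1-mono-< {+ 0} {+ suc t} (ℤ.+<+ (ℕ.s≤s ℕ.z≤n))

  positive⇒∣ : ∀ {N} a → 0ℚ ℚ.< N → [ N ] ≤⁺ v (fromℕ a) → r ∣ a
  positive⇒∣ a 0<N N≤ with r ℕ.∣? a
  ... | yes r∣a = r∣a
  ... | no  r∤a with ≡.subst (_ ≤⁺_) (v-coprime a r∤a) N≤
  ...   | [ N≤0 ] = ⊥-elim (ℚ.<-irrefl ≡.refl (ℚ.<-≤-trans 0<N N≤0))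

  -- By `v-coprime` a number of positive value is divisible by r. Dividing by r lowers the value by
  -- 1, and the argument repeats t times.
  ≤v⇒∣ : ∀ t a → [ (+ t) ℚ./ 1 ] ≤⁺ v (fromℕ a) → r ℕ.^ t ∣ a
  ≤v⇒∣ zero    a _ = ℕ.1∣ a
  ≤v⇒∣ (suc t) a h with positive⇒∣ a (0<1/ t) h
  ... | ℕ.divides b ≡.refl = ≡.subst (r ℕ.^ suc t ∣_) (ℕ.*-comm r b) (ℕ.*-monoʳ-∣ r (≤v⇒∣ t b (cancel h)))
    where
    cancel : [ (+ suc t) ℚ./ 1 ] ≤⁺ v (fromℕ (b ℕ.* r)) → [ (+ t) ℚ./ 1 ] ≤⁺ v (fromℕ b)
    cancel h with v (fromℕ b) in eq
    ... | ⊤⁺    = _ ≤⊤⁺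
    ... | [ w ] with ≡.subst (_ ≤⁺_) (≡.trans (v-cong (fromℕ-* b r)) (v-*-[] eq v-r)) h
    ...   | [ le ] = [ ≡.subst₂ ℚ._≤_
              (≡.trans (≡.cong (ℚ._- 1ℚ) (≡.trans (≡.cong (ℚ._/ 1) (ℤ.+-comm (+ 1) (+ t))) (/1-+ (+ t) (+ 1)))) (ℚ-cancel ((+ t) ℚ./ 1) 1ℚ))
              (ℚ-cancel w 1ℚ) (ℚ.+-monoˡ-≤ (ℚ.- 1ℚ) le) ]

module SettingProperties {ℓ p : ℕ} (S : Setting ℓ p) where
  private
    module S = Setting S
  open S public using (q½; q½²≈q; ζ; ζ^; ζ^-spec; ζ-root; ζ-primitive; ζ-compat)
  module K where
    open LocalField S.K public
    open LocalFieldProperties S.K public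
    open NaturalNumbers valuedField public
  module C where
    open ComplexPAdicNumbers S.ℂₚ public
    open ValuedFieldProperties valuedField public
    open NaturalNumbers valuedField public
  module ℚℓ where
    open PAdicNumbers K.ℚℓ public
    open ValuedFieldProperties valuedField public
    open NaturalNumbers valuedField public
    open PAdicProperties K.ℚℓ public
  module ℚₚ = PAdicNumbers C.ℚₚ
  module SK = IntegerSolver K.commutativeRing
  module SC = IntegerSolver C.commutativeRing
  open DigitSums S.K C.valuedField public
  open Compactness S.K public
  module K/ℚℓ = Homomorphism K.extension
  module ℚ̄ₚ/ℚₚ = Homomorphism (AlgebraicClosure.extension C.closure)
  module ℂₚ/ℚ̄ₚ = Homomorphism C.extension

  K-v-ℓ : K.v (K.fromℕ ℓ) ≡ [ 1ℚ ]
  K-v-ℓ = ≡.trans (K/ℚℓ.v-fromℕ ℓ) ℚℓ.v-r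

  C-v-fromℕ : ∀ n → C.v (C.fromℕ n) ≡ ℚₚ.v (ℚₚ.fromℕ n)
  C-v-fromℕ n = ≡.trans (ℂₚ/ℚ̄ₚ.v-fromℕ n) (ℚ̄ₚ/ℚₚ.v-fromℕ n)

  C-v-p : C.v (C.fromℕ p) ≡ [ 1ℚ ]
  C-v-p = ≡.trans (C-v-fromℕ p) ℚₚ.v-r

  p∤ℓ : ¬ (p ∣ ℓ)
  p∤ℓ p∣ℓ with Prime.prime⇒irreducible S.ℓ-prime p∣ℓ
  ... | inj₁ p≡1 = Prime.¬prime[1] (≡.subst Prime p≡1 S.p-prime)
  ... | inj₂ p≡ℓ = S.ℓ≢p (≡.sym p≡ℓ)

  C-v-ℓ : C.v (C.fromℕ ℓ) ≡ [ 0ℚ ]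
  C-v-ℓ = ≡.trans (C-v-fromℕ ℓ) (ℚₚ.v-coprime ℓ p∤ℓ)

  ℓ∈𝔩 : K.fromℕ ℓ K.∈𝔩 + 1
  ℓ∈𝔩 = K.close⇒∈ (K.π-least _ (≡.subst ([ 0ℚ ] <⁺_) (≡.sym K-v-ℓ) [ ℚ.positive⁻¹ 1ℚ ]))

  -- Averaging the indicator of 𝔩 over the translations by all residues keeps
  -- it integral (ℓ is a unit in ℂₚ), keeps its sum over 𝔬/𝔩 equal to 1 and
  -- makes it constant; hence q divides 1.
  C-v-q : C.v (C.fromℕ K.q) ≡ [ 0ℚ ]
  C-v-q = nonneg-sum≡0 (C.integral-fromℕ K.q) (int K.0#) (≡.trans (≡.sym (C.v-* _ _)) (≡.trans (C.v-cong qc≈1) C.v-1))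
    where
    open K using (_∈𝔩_)
    Averaged : (K.Carrier → C.Carrier) → Set
    Averaged h = Periodic ⊤⁺ (+ 1) h × (∀ y → C.Integral (h y)) × Σ𝔩 (+ 0) 1 h C.≈ C.1#

    indicator𝔩 : K.Carrier → C.Carrier
    indicator𝔩 x with x K.∈𝔩? + 1
    ... | yes _ = C.1#
    ... | no  _ = C.0#
    indicator𝔩-yes : ∀ {x} → x ∈𝔩 + 1 → indicator𝔩 x ≡ C.1#
    indicator𝔩-yes {x} x∈ with x K.∈𝔩? + 1
    ... | yes _  = ≡.refl
    ... | no  x∉ = ⊥-elim (x∉ x∈)
    indicator𝔩-no : ∀ {x} → ¬ (x ∈𝔩 + 1) → indicator𝔩 x ≡ C.0#
    indicator𝔩-no {x} x∉ with x K.∈𝔩? + 1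
    ... | yes x∈ = ⊥-elim (x∉ x∈)
    ... | no  _  = ≡.refl

    per₀ : Periodic ⊤⁺ (+ 1) indicator𝔩
    per₀ x y x-y∈ with x K.∈𝔩? + 1
    ... | yes x∈ = ≈⇒~ (C.reflexive (≡.sym (indicator𝔩-yes (K.∈-cong (solve 2 (λ x y → x :- (x :- y) := y) K.refl x y) (K.∈-- x∈ x-y∈)))))
      where open SK
            open C.Approx ⊤⁺
    ... | no  x∉ = ≈⇒~ (C.reflexive (≡.sym (indicator𝔩-no λ y∈ → x∉ (K.∈-cong (solve 2 (λ x y → (x :- y) :+ y := x) K.refl x y) (K.∈-+ x-y∈ y∈)))))
      where open SK
            open C.Approx ⊤⁺

    int₀ : ∀ y → C.Integral (indicator𝔩 y)
    int₀ y with y K.∈𝔩? + 1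
    ... | yes _ = C.integral-1
    ... | no  _ = C.≤v-0

    tot₀ : Σ𝔩 (+ 0) 1 indicator𝔩 C.≈ C.1#
    tot₀ = C.trans (C.~⊤⇒≈ (Σ-coarse ⊤⁺ (+ 0) 0 (λ x x∉ → C.Approx.≈⇒~ ⊤⁺ (C.reflexive (indicator𝔩-no x∉))) per₀))
                   (C.reflexive (indicator𝔩-yes K.0∈))

    ℓ⁻¹ : C.Carrier
    ℓ⁻¹ = C.inv (C.fromℕ ℓ)

    average : K.Carrier → (K.Carrier → C.Carrier) → K.Carrier → C.Carrier
    average x h y = ℓ⁻¹ C.* C.sum {ℓ} (λ c → h (y K.+ K.fromℕ (toℕ c) K.* x))

    ~⇒≈ : ∀ {b h} → Periodic ⊤⁺ b h → ∀ {x y} → x K.- y ∈𝔩 b → h x C.≈ h y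
    ~⇒≈ per d∈ = C.~⊤⇒≈ (per _ _ d∈)

    module Sum = SemiringSum C.semiring

    average-good : ∀ x h → K.Integral x → Averaged h → Averaged (average x h)
    average-good x h x-int (per , int , tot) =
        (λ y z y-z∈ → C.Approx.≈⇒~ ⊤⁺ (C.*-congˡ (Sum.sum-cong-≋ {ℓ} λ c → ~⇒≈ per
          (K.∈-cong (SK.solve 3 (λ y z t → y SK.:- z SK.:= (y SK.:+ t) SK.:- (z SK.:+ t)) K.refl y z (K.fromℕ (toℕ c) K.* x)) y-z∈))))
      , (λ y → C.integral-* (C.unit-integral (C.unit-inv C-v-ℓ)) (C.≤v-sum {n = ℓ} (λ c → int (y K.+ K.fromℕ (toℕ c) K.* x))))
      , C.trans (Σ-* (+ 0) 1 ℓ⁻¹ (λ y → C.sum {ℓ} (λ c → h (y K.+ K.fromℕ (toℕ c) K.* x)))) (C.trans (C.*-congˡ (C.trans (Σ-sum (+ 0) 1 {ℓ} (λ c y → h (y K.+ K.fromℕ (toℕ c) K.* x))) (C.trans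
          (Sum.sum-cong-≋ {ℓ} (λ c → C.trans (C.~⊤⇒≈ (Σ-translate ⊤⁺ (+ 0) 1
            (K.integral⇒∈ (K.integral-* (K.integral-fromℕ (toℕ c)) x-int)) per)) tot))
          (Sum.sum-replicate ℓ)))) (C.inverseˡ (C.v≡[]⇒≉0 C-v-ℓ)))

    average-keeps : ∀ x h z → (∀ y → h (y K.+ z) C.≈ h y) → (∀ {y y'} → y K.≈ y' → h y C.≈ h y') →
      ∀ y → average x h (y K.+ z) C.≈ average x h y
    average-keeps x h z hz h-cong y = C.*-congˡ (Sum.sum-cong-≋ {ℓ} λ c →
      C.trans (h-cong (solve 3 (λ y z t → (y :+ z) :+ t := (y :+ t) :+ z) K.refl y z (K.fromℕ (toℕ c) K.* x))) (hz _))
      where open SK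

    -- Translation by x moves the index c to c + 1, and c = ℓ returns to c = 0 because ℓ x lies in
    -- 𝔩.
    average-gains : ∀ x h → K.Integral x → Periodic ⊤⁺ (+ 1) h → ∀ y → average x h (y K.+ x) C.≈ average x h y
    average-gains x h x-int per y = C.*-congˡ (C.trans (Sum.sum-cong-≋ {ℓ} λ c → ~⇒≈ per
        (K.∈-cong (solve 3 (λ y x n → con (+ 0) := ((y :+ x) :+ n :* x) :- (y :+ (con (+ 1) :+ n) :* x)) K.refl y x (K.fromℕ (toℕ c))) K.0∈))
      (cancelʳ (g 0) _ _ (C.trans (C.+-comm _ _) (C.trans (C.partialSum-suc g ℓ) (C.+-congˡ g-ℓ)))))
      where
      open SK
      g : ℕ → C.Carrier
      g n = h (y K.+ K.fromℕ n K.* x)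
      g-ℓ : g ℓ C.≈ g 0
      g-ℓ = ~⇒≈ per (K.∈-cong (solve 3 (λ y x n → n :* x := (y :+ n :* x) :- (y :+ con (+ 0) :* x)) K.refl y x (K.fromℕ ℓ))
              (K.∈-≡ (ℤ.+-identityʳ (+ 1)) (K.∈-* ℓ∈𝔩 (K.integral⇒∈ x-int))))
      cancelʳ : ∀ c a b → a C.+ c C.≈ b C.+ c → a C.≈ b
      cancelʳ c a b eq = C.trans (SC.solve 2 (λ a c → a SC.:= (a SC.:+ c) SC.:- c) C.refl a c)
        (C.trans (C.+-congʳ eq) (SC.solve 2 (λ b c → (b SC.:+ c) SC.:- c SC.:= b) C.refl b c))

    -- The residues are treated one at a time; since translations commute, the invariances already
    -- gained survive the next average.
    averaged : ∀ n (e : Fin n → K.Carrier) → (∀ i → K.Integral (e i)) →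
      ∃[ h ] Averaged h × (∀ i y → h (y K.+ e i) C.≈ h y)
    averaged zero    e e-int = indicator𝔩 , (per₀ , int₀ , tot₀) , λ ()
    averaged (suc n) e e-int with averaged n (e ∘ fsuc) (e-int ∘ fsuc)
    ... | h , good@(per , _) , inv = average (e fzero) h , average-good _ h (e-int fzero) good , λ
      { fzero    → average-gains _ h (e-int fzero) per
      ; (fsuc i) → average-keeps _ h _ (inv i) (λ y≈y′ → ~⇒≈ per (K.mem (K.≈0⇒≤v (K.trans (K.+-congʳ y≈y′) (K.-‿inverseʳ _))))) }

    result = averaged K.q K.residue K.residue-int
    h = proj₁ result
    per = proj₁ (proj₁ (proj₂ result))
    int = proj₁ (proj₂ (proj₁ (proj₂ result)))
    tot = proj₂ (proj₂ (proj₁ (proj₂ result)))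
    inv = proj₂ (proj₂ result)

    constant : ∀ x → x ∈𝔩 + 0 → h x C.≈ h K.0#
    constant x x∈ with K.residue-surj x (K.∈⇒integral x∈)
    ... | i , close = C.trans (~⇒≈ per (K.∈-cong (solve 2 (λ x r → x :- r := x :- (con (+ 0) :+ r)) K.refl x (K.residue i)) (K.close⇒∈ close)))
                              (inv i K.0#)
      where open SK

    qc≈1 : C.fromℕ K.q C.* h K.0# C.≈ C.1#
    qc≈1 = C.trans (C.sym (C.~⊤⇒≈ (Σ-refine ⊤⁺ (+ 0) 0 {λ _ → h K.0#} (λ _ _ _ → C.Approx.~-refl ⊤⁺))))
             (C.trans (C.sym (Σ-cong (+ 0) 1 constant)) tot)

  v-q½ : C.v (proj₁ q½) ≡ [ 0ℚ ]
  v-q½ with C.val (proj₂ q½)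
  ... | a , v≡a = ≡.trans v≡a (≡.cong [_] (double≡0⇒0 a ([]-injective
    (≡.trans (≡.sym (C.v-*-[] v≡a v≡a)) (≡.trans (C.v-cong q½²≈q) C-v-q)))))

-- Roots of unity, the trace and the additive character.

module RootsOfUnity (F : ValuedField) where
  open ValuedField F
  open ValuedFieldProperties F
  open import Algebra.Properties.CommutativeSemiring.Exp commutativeSemiring using (^-homo-*; ^-assocʳ; ^-congˡ; ^-congʳ)

  private
    v-^-pos : ∀ {x a} → v x ≡ [ a ] → 0ℚ ℚ.< a → ∀ n → ∃[ b ] v (x ^ suc n) ≡ [ b ] × 0ℚ ℚ.< b
    v-^-pos vx 0<a zero    = _ , ≡.trans (v-cong (*-identityʳ _)) vx , 0<a
    v-^-pos vx 0<a (suc n) with v-^-pos vx 0<a n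
    ... | b , vb , 0<b = _ , v-*-[] vx vb , ℚ.+-mono-< 0<a 0<b

    v-^-neg : ∀ {x a} → v x ≡ [ a ] → a ℚ.< 0ℚ → ∀ n → ∃[ b ] v (x ^ suc n) ≡ [ b ] × b ℚ.< 0ℚ
    v-^-neg vx a<0 zero    = _ , ≡.trans (v-cong (*-identityʳ _)) vx , a<0
    v-^-neg vx a<0 (suc n) with v-^-neg vx a<0 n
    ... | b , vb , b<0 = _ , v-*-[] vx vb , ℚ.+-mono-< a<0 b<0

  root-of-unity : ∀ {x} n → 0 ℕ.< n → x ^ n ≈ 1# → v x ≡ [ 0ℚ ]
  root-of-unity {x} (suc n) _ xⁿ≈1 with val x≉0
    where
    x≉0 : x ≉ 0#
    x≉0 x≈0 = 1≉0 (trans (sym xⁿ≈1) (trans (*-congʳ x≈0) (zeroˡ _)))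
  ... | a , vx with ℚ.<-cmp a 0ℚ
  ...   | tri≈ _ a≡0 _ = ≡.trans vx (≡.cong [_] a≡0)
  ...   | tri> _ _ 0<a = let b , vb , 0<b = v-^-pos vx 0<a n in
    ⊥-elim (ℚ.<-irrefl ([]-injective (≡.trans (≡.sym v-1) (≡.trans (v-cong (sym xⁿ≈1)) vb))) 0<b)
  ...   | tri< a<0 _ _ = let b , vb , b<0 = v-^-neg vx a<0 n in
    ⊥-elim (ℚ.<-irrefl ([]-injective (≡.trans (≡.sym vb) (≡.trans (v-cong xⁿ≈1) v-1))) b<0)

  ^-multiple : ∀ {x n} → x ^ n ≈ 1# → ∀ {k} → n ∣ k → x ^ k ≈ 1#
  ^-multiple {x} {n} xⁿ≈1 (ℕ.divides c ≡.refl) =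
    trans (^-congʳ x (ℕ.*-comm c n)) (trans (sym (^-assocʳ x n c)) (trans (^-congˡ c xⁿ≈1) (1^ c)))

  order-∣ : ∀ {x} n .{{_ : ℕ.NonZero n}} → x ^ n ≈ 1# → (∀ k → 0 ℕ.< k → k ℕ.< n → ¬ (x ^ k ≈ 1#)) →
    ∀ m → x ^ m ≈ 1# → n ∣ m
  order-∣ {x} n xⁿ≈1 minimal m xᵐ≈1 with m ℕ.% n in r≡
  ... | zero  = ℕ.m%n≡0⇒n∣m m n r≡
  ... | suc r = ⊥-elim (minimal (suc r) (ℕ.s≤s ℕ.z≤n) (≡.subst (ℕ._< n) r≡ (ℕ.m%n<n m n))
    (trans (sym (trans (^-congʳ x m≡) (trans (^-homo-* x (suc r) _)
      (trans (*-congˡ (^-multiple xⁿ≈1 (ℕ.n∣m*n (m ℕ./ n)))) (*-identityʳ _))))) xᵐ≈1))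
    where
    m≡ : m ≡ suc r ℕ.+ (m ℕ./ n) ℕ.* n
    m≡ = ≡.trans (ℕ.m≡m%n+[m/n]*n m n) (≡.cong (ℕ._+ (m ℕ./ n) ℕ.* n) r≡)

/1-neg : ∀ t → ℤ.- (+ t) ℚ./ 1 ≡ ℚ.- ((+ t) ℚ./ 1)
/1-neg t = ℚG.inverseˡ-unique (ℤ.- (+ t) ℚ./ 1) ((+ t) ℚ./ 1)
  (≡.trans (≡.sym (/1-+ (ℤ.- (+ t)) (+ t))) (≡.cong (ℚ._/ 1) (ℤ.+-inverseˡ (+ t))))

0≤-a+b⇒a≤b : ∀ a b → 0ℚ ℚ.≤ (ℚ.- a) ℚ.+ b → a ℚ.≤ b
0≤-a+b⇒a≤b a b h = ≡.subst₂ ℚ._≤_ (ℚ.+-identityʳ a)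
  (≡.trans (≡.sym (ℚ.+-assoc a (ℚ.- a) b)) (≡.trans (≡.cong (ℚ._+ b) (ℚ.+-inverseʳ a)) (ℚ.+-identityˡ b)))
  (ℚ.+-monoʳ-≤ a h)

module Trace {ℓ : ℕ} (L : LocalField ℓ) where
  open LocalField L
  private
    module A = PAdicNumbers ℚℓ
    module ASum = SemiringSum A.semiring
    module Sum = SemiringSum semiring
  open Homomorphism extension

  coord-cong : ∀ {x y} → x ≈ y → ∀ i → coord x i A.≈ coord y i
  coord-cong {x} {y} x≈y = unique y (coord x) (trans (sym x≈y) (spans x))

  coord-+ : ∀ x y i → coord (x + y) i A.≈ coord x i A.+ coord y i
  coord-+ x y i = A.sym (unique (x + y) (λ i → coord x i A.+ coord y i)
    (trans (+-cong (spans x) (spans y)) (trans (sym (Sum.∑-distrib-+ {degree} _ _))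
      (Sum.sum-cong-≋ {degree} λ i → trans (sym (distribʳ (basis i) _ _)) (*-congʳ (sym (+-homo _ _)))))) i)

  tr-cong : ∀ {x y} → x ≈ y → tr x A.≈ tr y
  tr-cong x≈y = ASum.sum-cong-≋ {degree} λ i → coord-cong (*-congʳ x≈y) i

  tr-+ : ∀ x y → tr (x + y) A.≈ tr x A.+ tr y
  tr-+ x y = A.trans (ASum.sum-cong-≋ {degree} λ i → A.trans (coord-cong (distribʳ (basis i) x y) i) (coord-+ (x * basis i) (y * basis i) i))
                     (ASum.∑-distrib-+ {degree} _ _)

module AdditiveCharacter {ℓ p : ℕ} (S : Setting ℓ p) where
  open SettingProperties S public
  open RootsOfUnity C.valuedField
  open Trace (Setting.K S)
  private
    module Exp where
      open import Algebra.Properties.CommutativeSemiring.Exp C.commutativeSemiring public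

  /1-injective-≤ : ∀ {m n} → (+ m) ℚ./ 1 ℚ.≤ (+ n) ℚ./ 1 → m ℕ.≤ n
  /1-injective-≤ {m} {n} h with m ℕ.≤? n
  ... | yes m≤n = m≤n
  ... | no  m≰n = ⊥-elim (ℚ.<-irrefl ≡.refl (ℚ.<-≤-trans (/1-mono-< {+ n} {+ m} (ℤ.+<+ (ℕ.≰⇒> m≰n))) h))

  1≤ℓ^ : ∀ t → 0 ℕ.< ℓ ℕ.^ t
  1≤ℓ^ t = ℕ.m^n>0 ℓ {{Prime.prime⇒nonZero (Setting.ℓ-prime S)}} t

  -- x ≡ M/ℓᵀ modulo ℤ_ℓ.
  Fraction : ℚℓ.Carrier → ℕ → ℕ → Set
  Fraction x T M = ℚℓ.Close ((+ T) ℚ./ 1) (x ℚℓ.* ℚℓ.fromℕ (ℓ ℕ.^ T)) (ℚℓ.fromℕ M)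

  private module SQ = IntegerSolver ℚℓ.commutativeRing

  fraction-raise : ∀ s {x T M} → Fraction x T M → Fraction x (s ℕ.+ T) (ℓ ℕ.^ s ℕ.* M)
  fraction-raise s {x} {T} {M} close =
    ≡.subst (λ N → [ N ] ≤⁺ ℚℓ.v (x ℚℓ.* ℚℓ.fromℕ (ℓ ℕ.^ (s ℕ.+ T)) ℚℓ.- ℚℓ.fromℕ (ℓ ℕ.^ s ℕ.* M))) (≡.sym (/1-+ (+ s) (+ T)))
      (ℚℓ.≤v-resp eq (ℚℓ.≤v-* (⁺-reflexive (≡.sym (ℚℓ.v-fromℕ^ s))) close))
    where
    open SQ
    eq : ℚℓ.fromℕ (ℓ ℕ.^ s) ℚℓ.* (x ℚℓ.* ℚℓ.fromℕ (ℓ ℕ.^ T) ℚℓ.- ℚℓ.fromℕ M)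
         ℚℓ.≈ x ℚℓ.* ℚℓ.fromℕ (ℓ ℕ.^ (s ℕ.+ T)) ℚℓ.- ℚℓ.fromℕ (ℓ ℕ.^ s ℕ.* M)
    eq = ℚℓ.trans (solve 4 (λ a x b c → a :* (x :* b :- c) := x :* (a :* b) :- a :* c) ℚℓ.refl _ x _ _)
      (ℚℓ.+-cong (ℚℓ.*-congˡ (ℚℓ.trans (ℚℓ.sym (ℚℓ.fromℕ-* (ℓ ℕ.^ s) (ℓ ℕ.^ T)))
          (ℚℓ.reflexive (≡.cong ℚℓ.fromℕ (≡.sym (ℕ.^-distribˡ-+-* ℓ s T))))))
        (ℚℓ.-‿cong (ℚℓ.sym (ℚℓ.fromℕ-* (ℓ ℕ.^ s) M))))

  fraction-integral : ∀ {x T M} → Fraction x T M → ℚℓ.Integral (x ℚℓ.* ℚℓ.fromℕ (ℓ ℕ.^ T))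
  fraction-integral {x} {T} {M} close =
    ℚℓ.≤v-resp (solve 2 (λ a b → (a :- b) :+ b := a) ℚℓ.refl _ (ℚℓ.fromℕ M))
      (ℚℓ.≤v-+ (⁺-trans [ /1-mono-≤ {+ 0} {+ T} (ℤ.+≤+ ℕ.z≤n) ] close) (ℚℓ.integral-fromℕ M))
    where open SQ

  ζ-^-ordered : ∀ T {M M′} → M ℕ.≤ M′ → [ (+ T) ℚ./ 1 ] ≤⁺ ℚℓ.v (ℚℓ.fromℕ M′ ℚℓ.- ℚℓ.fromℕ M) → ζ T C.^ M′ C.≈ ζ T C.^ M
  ζ-^-ordered T {M} {M′} M≤M′ h = C.trans (Exp.^-congʳ (ζ T) (≡.sym (ℕ.m+[n∸m]≡n M≤M′)))
    (C.trans (Exp.^-homo-* (ζ T) M (M′ ℕ.∸ M)) (C.trans (C.*-congˡ (^-multiple (ζ-root T) (ℚℓ.≤v⇒∣ T (M′ ℕ.∸ M)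
      (ℚℓ.≤v-resp (ℚℓ.trans (ℚℓ.+-congʳ (ℚℓ.trans (ℚℓ.reflexive (≡.cong ℚℓ.fromℕ (≡.sym (ℕ.m+[n∸m]≡n M≤M′)))) (ℚℓ.fromℕ-+ M (M′ ℕ.∸ M))))
        (solve 2 (λ a b → (a :+ b) :- a := b) ℚℓ.refl (ℚℓ.fromℕ M) _)) h)))) (C.*-identityʳ _)))
    where open SQ

  ζ-^-cong : ∀ T {M M′} → [ (+ T) ℚ./ 1 ] ≤⁺ ℚℓ.v (ℚℓ.fromℕ M ℚℓ.- ℚℓ.fromℕ M′) → ζ T C.^ M C.≈ ζ T C.^ M′
  ζ-^-cong T {M} {M′} h with ℕ.≤-total M M′
  ... | inj₁ M≤M′ = C.sym (ζ-^-ordered T M≤M′ (ℚℓ.Approx.~-sym _ h))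
  ... | inj₂ M′≤M = ζ-^-ordered T M′≤M h

  ζ-descend : ∀ s t → ζ (s ℕ.+ t) C.^ (ℓ ℕ.^ s) C.≈ ζ t
  ζ-descend zero    t = C.*-identityʳ _
  ζ-descend (suc s) t = C.trans (C.sym (Exp.^-assocʳ (ζ (suc s ℕ.+ t)) ℓ (ℓ ℕ.^ s)))
    (C.trans (Exp.^-congˡ (ℓ ℕ.^ s) (ζ-compat (s ℕ.+ t))) (ζ-descend s t))

  -- `ζ^-spec` speaks only of the exact denominator ℓᵗ of x. Admitting any larger one lets two
  -- arguments share a denominator, which additivity needs; `ζ-descend` compares the roots of unity
  -- at the two levels.
  ζ^-fraction : ∀ {x T M} → Fraction x T M → ζ^ x C.≈ ζ T C.^ M
  ζ^-fraction {x} {T} {M} close with ζ^-spec x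
  ... | inj₁ (x-int , z≈1) = C.trans z≈1 (C.sym (^-multiple (ζ-root T) (ℚℓ.≤v⇒∣ T M
    (ℚℓ.≤v-resp (solve 2 (λ a b → a :- (a :- b) := b) ℚℓ.refl _ (ℚℓ.fromℕ M))
      (ℚℓ.≤v-- (ℚℓ.≤v-scale x-int (⁺-reflexive (≡.sym (ℚℓ.v-fromℕ^ T)))) close)))))
    where open SQ
  ... | inj₂ (t , m , 0<t , vx , close′ , z≈) = C.trans z≈ (C.trans (C.sym
      (C.trans (Exp.^-congʳ (ζ T) (≡.refl {x = ℓ ℕ.^ s ℕ.* m}))
      (C.trans (C.sym (Exp.^-assocʳ (ζ T) (ℓ ℕ.^ s) m)) (Exp.^-congˡ m (≡.subst (λ U → ζ U C.^ (ℓ ℕ.^ s) C.≈ ζ t) s+t≡T (ζ-descend s t))))))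
      (ζ-^-cong T {ℓ ℕ.^ s ℕ.* m} {M} (ℚℓ.≤v-resp (solve 3 (λ a b c → (a :- b) :- (a :- c) := c :- b) ℚℓ.refl (x ℚℓ.* ℚℓ.fromℕ (ℓ ℕ.^ T)) _ _)
        (ℚℓ.≤v-- close (≡.subst (λ U → Fraction x U (ℓ ℕ.^ s ℕ.* m)) s+t≡T (fraction-raise s {x} {t} {m} close′))))))
    where
    open SQ
    t≤T : t ℕ.≤ T
    t≤T with ≡.subst (_ ≤⁺_) (ℚℓ.v-*-[] vx (ℚℓ.v-fromℕ^ T)) (fraction-integral {x} {T} {M} close)
    ... | [ 0≤T-t ] = /1-injective-≤ {t} {T} (0≤-a+b⇒a≤b _ _
      (≡.subst (λ a → 0ℚ ℚ.≤ a ℚ.+ (+ T) ℚ./ 1) (/1-neg t) 0≤T-t))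
    s = T ℕ.∸ t
    s+t≡T : s ℕ.+ t ≡ T
    s+t≡T = ℕ.m∸n+n≡m t≤T

  fraction-exists : ∀ x → ∃[ T ] ∃[ M ] Fraction x T M
  fraction-exists x with ζ^-spec x
  ... | inj₁ (x-int , _) = 0 , 0 , ℚℓ.≤v-- (ℚℓ.integral-* x-int (ℚℓ.integral-fromℕ 1)) ℚℓ.≤v-0
  ... | inj₂ (t , m , _ , _ , close , _) = t , m , close

  ζ^-cong : ∀ {x y} → x ℚℓ.≈ y → ζ^ x C.≈ ζ^ y
  ζ^-cong {x} {y} x≈y with fraction-exists x
  ... | T , M , close = C.trans (ζ^-fraction {x} {T} {M} close) (C.sym (ζ^-fraction {y} {T} {M}
    (ℚℓ.≤v-resp (ℚℓ.+-congʳ (ℚℓ.*-congʳ x≈y)) close)))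

  ζ^-+ : ∀ x y → ζ^ (x ℚℓ.+ y) C.≈ ζ^ x C.* ζ^ y
  ζ^-+ x y with fraction-exists x | fraction-exists y
  ... | T , M , close | T′ , M′ , close′ =
    C.trans (ζ^-fraction {x ℚℓ.+ y} {T′ ℕ.+ T} {A ℕ.+ B}
      (ℚℓ.≤v-resp (ℚℓ.trans (solve 5 (λ x y n a b → (x :* n :- a) :+ (y :* n :- b) := (x :+ y) :* n :- (a :+ b)) ℚℓ.refl
          x y (ℚℓ.fromℕ (ℓ ℕ.^ (T′ ℕ.+ T))) (ℚℓ.fromℕ A) (ℚℓ.fromℕ B))
        (ℚℓ.+-congˡ (ℚℓ.-‿cong (ℚℓ.sym (ℚℓ.fromℕ-+ A B)))))
        (ℚℓ.≤v-+ x∼ y∼)))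
    (C.trans (Exp.^-homo-* (ζ (T′ ℕ.+ T)) A B)
      (C.sym (C.*-cong (ζ^-fraction {x} {T′ ℕ.+ T} {A} x∼) (ζ^-fraction {y} {T′ ℕ.+ T} {B} y∼))))
    where
    open SQ
    A = ℓ ℕ.^ T′ ℕ.* M
    B = ℓ ℕ.^ T ℕ.* M′
    x∼ : Fraction x (T′ ℕ.+ T) A
    x∼ = fraction-raise T′ {x} {T} {M} close
    y∼ : Fraction y (T′ ℕ.+ T) B
    y∼ = ≡.subst (λ U → Fraction y U B) (ℕ.+-comm T T′) (fraction-raise T {y} {T′} {M′} close′)

  ζ^-integral : ∀ {x} → ℚℓ.Integral x → ζ^ x C.≈ C.1#
  ζ^-integral {x} x-int = ζ^-fraction {x} {0} {0} (ℚℓ.≤v-- (ℚℓ.integral-* x-int (ℚℓ.integral-fromℕ 1)) ℚℓ.≤v-0)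

  v-ζ^ : ∀ x → C.v (ζ^ x) ≡ [ 0ℚ ]
  v-ζ^ x with fraction-exists x
  ... | T , M , close = ≡.trans (C.v-cong (ζ^-fraction {x} {T} {M} close))
    (C.unit-^ (root-of-unity (ℓ ℕ.^ T) (1≤ℓ^ T) (ζ-root T)) M)

  -- If x had denominator ℓᵗ with t > 0, primitivity of the root ζ_t would give ℓᵗ ∣ m. Then x ℓᵗ,
  -- being congruent to m modulo ℓᵗ, would have value at least t, whereas its value is 0.
  ζ^≈1⇒integral : ∀ {x} → ζ^ x C.≈ C.1# → ℚℓ.Integral x
  ζ^≈1⇒integral {x} z≈1 with ζ^-spec x
  ... | inj₁ (x-int , _) = x-int
  ... | inj₂ (suc t , m , _ , vx , close , z≈) = ⊥-elim (contra (≡.subst (_ ≤⁺_) v-product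
      (ℚℓ.≤v-resp (solve 2 (λ a b → (a :- b) :+ b := a) ℚℓ.refl (x ℚℓ.* ℚℓ.fromℕ (ℓ ℕ.^ suc t)) (ℚℓ.fromℕ m))
        (ℚℓ.≤v-+ close (vm (order-∣ (ℓ ℕ.^ suc t) {{ℕ.>-nonZero (1≤ℓ^ (suc t))}} (ζ-root (suc t)) (ζ-primitive (suc t)) m
          (C.trans (C.sym z≈) z≈1)))))))
    where
    open SQ
    v-product : ℚℓ.v (x ℚℓ.* ℚℓ.fromℕ (ℓ ℕ.^ suc t)) ≡ [ 0ℚ ]
    v-product = ≡.trans (ℚℓ.v-*-[] vx (ℚℓ.v-fromℕ^ (suc t)))
      (≡.cong [_] (≡.trans (≡.sym (/1-+ (ℤ.- (+ suc t)) (+ suc t))) (≡.cong (ℚ._/ 1) (ℤ.+-inverseˡ (+ suc t)))))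
    vm : ∀ {m} → ℓ ℕ.^ suc t ∣ m → [ (+ suc t) ℚ./ 1 ] ≤⁺ ℚℓ.v (ℚℓ.fromℕ m)
    vm (ℕ.divides c ≡.refl) = ℚℓ.≤v-resp (ℚℓ.sym (ℚℓ.fromℕ-* c (ℓ ℕ.^ suc t)))
      (ℚℓ.≤v-scale (ℚℓ.integral-fromℕ c) (⁺-reflexive (≡.sym (ℚℓ.v-fromℕ^ (suc t)))))
    contra : ¬ ([ (+ suc t) ℚ./ 1 ] ≤⁺ [ 0ℚ ])
    contra [ h ] = ℚ.<-irrefl ≡.refl (ℚ.<-≤-trans (ℚℓ.0<1/ t) h)

  ψ : K.Carrier → C.Carrier
  ψ x = ζ^ (K.tr x)

  ψ-cong : ∀ {x y} → x K.≈ y → ψ x C.≈ ψ y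
  ψ-cong x≈y = ζ^-cong (tr-cong x≈y)

  ψ-+ : ∀ x y → ψ (x K.+ y) C.≈ ψ x C.* ψ y
  ψ-+ x y = C.trans (ζ^-cong (tr-+ x y)) (ζ^-+ (K.tr x) (K.tr y))

  v-ψ : ∀ x → C.v (ψ x) ≡ [ 0ℚ ]
  v-ψ x = v-ζ^ (K.tr x)

  -- The ideal of this exponent is the inverse different, the largest fractional ideal on which `ψ`
  -- is trivial.
  δ⁻ : ℤ
  δ⁻ = ℤ.- (+ K.δ)

  ψ-trivial : ∀ {x} → x K.∈𝔩 δ⁻ → ψ x C.≈ C.1#
  ψ-trivial {x} x∈ = C.trans (ψ-cong (K.sym (K.*-identityʳ x)))
    (ζ^-integral (Equivalence.from (K.different x) (K.≤v x∈) K.1# K.integral-1))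

  ψ-periodic : ∀ {x y} → x K.- y K.∈𝔩 δ⁻ → ψ x C.≈ ψ y
  ψ-periodic {x} {y} d∈ = C.trans (ψ-cong (SK.solve 2 (λ x y → x SK.:= y SK.:+ (x SK.:- y)) K.refl x y))
    (C.trans (ψ-+ y (x K.- y)) (C.trans (C.*-congˡ (ψ-trivial d∈)) (C.*-identityʳ _)))

  -- If ψ(x y) = 1 for all y in 𝔩ᵏ, then x πᵏ lies in the inverse different, contrary to the choice
  -- of x. A finite search turns this contradiction into a witness.
  ψ-nontrivial : ∀ k {x} → ¬ (x K.∈𝔩 δ⁻ ℤ.- k) → ∃[ y ] y K.∈𝔩 k × ¬ (ψ (x K.* y) C.≈ C.1#)
  ψ-nontrivial k {x} x∉ = conclude (search (+ 0) n {Trivial} {λ y → ¬ Trivial y}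
      (λ y z y-z∈ e → C.trans (C.sym (ψ-periodic (close y-z∈))) e)
      (λ y _ → Dec.toSum (_ C.≈? _)))
    where
    Trivial : K.Carrier → Set
    Trivial y = ψ (x K.* (K.π^ k K.* y)) C.≈ C.1#
    m = proj₁ (K.∉⇒shell x∉)
    -- As x has order m, ψ(x πᵏ y) depends only on y modulo 𝔩 to the power δ⁻ - k - m; the absolute
    -- value makes this a natural number.
    n = ℤ.∣ δ⁻ ℤ.- k ℤ.- m ∣
    regroup : ∀ d k m → d ≡ m ℤ.+ (k ℤ.+ (d ℤ.- k ℤ.- m))
    regroup = ℤ-Ring.solve-∀
    close : ∀ {y z} → y K.- z K.∈𝔩 + 0 ℤ.+ + n → x K.* (K.π^ k K.* y) K.- x K.* (K.π^ k K.* z) K.∈𝔩 δ⁻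
    close {y} {z} d∈ = K.∈-mono
      (ℤ.≤-trans (ℤ.≤-reflexive (regroup δ⁻ k m)) (ℤ.+-monoʳ-≤ m (ℤ.+-monoʳ-≤ k (i≤∣i∣ (δ⁻ ℤ.- k ℤ.- m)))))
      (K.∈-cong (SK.solve 4 (λ x p y z → x SK.:* (p SK.:* (y SK.:- z)) SK.:= x SK.:* (p SK.:* y) SK.:- x SK.:* (p SK.:* z)) K.refl x (K.π^ k) y z)
        (K.∈-* (K.shell⇒∈ (proj₂ (proj₂ (K.∉⇒shell x∉)))) (K.∈-* (K.π^∈ k) (K.∈-≡ (ℤ.+-identityˡ (+ n)) d∈))))
    eq : x K.* K.π^ k K.* K.π^ (ℤ.- k) K.≈ x
    eq = K.trans (K.*-assoc x (K.π^ k) _) (K.trans (K.*-congˡ (K.π^-inverse k)) (K.*-identityʳ x))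
    conclude : (∀ y → y K.∈𝔩 + 0 → Trivial y) ⊎ (∃[ y ] y K.∈𝔩 + 0 × ¬ Trivial y) →
      ∃[ y ] y K.∈𝔩 k × ¬ (ψ (x K.* y) C.≈ C.1#)
    conclude (inj₂ (y , y∈ , ψ≉1)) = K.π^ k K.* y , K.∈-≡ (ℤ.+-identityʳ k) (K.∈-* (K.π^∈ k) y∈) , ψ≉1
    conclude (inj₁ all) = ⊥-elim (x∉ (K.∈-cong eq (K.∈-* x′∈ (K.π^∈ (ℤ.- k)))))
      where
      x′∈ : x K.* K.π^ k K.∈𝔩 δ⁻
      x′∈ = K.mem (Equivalence.to (K.different (x K.* K.π^ k)) (λ y y-int →
        ζ^≈1⇒integral (C.trans (ψ-cong (K.*-assoc x (K.π^ k) y)) (all y (K.integral⇒∈ y-int)))))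

-- Integrals as limits of Riemann sums.

module Integration {ℓ p : ℕ} (S : Setting ℓ p) where
  open AdditiveCharacter S public
  open Analysis S public using (Fun; StepFun; indicator; step; dx; ∫_≈_)
  open K using (_∈𝔩_)
  private
    module Sum = SemiringSum C.semiring

  neg : ℕ → ℤ
  neg B = ℤ.- (+ B)

  q′ : C.Carrier
  q′ = C.fromℕ K.q

  -- The volume of 𝔩ⁿ.
  κ : ℤ → C.Carrier
  κ n = proj₁ q½ C.^ℤ (ℤ.- (+ 2 ℤ.* n ℤ.+ + K.δ))

  v-κ : ∀ n → C.v (κ n) ≡ [ 0ℚ ]
  v-κ n = C.unit-^ℤ v-q½ (ℤ.- (+ 2 ℤ.* n ℤ.+ + K.δ))

  κ-suc : ∀ n → κ (ℤ.suc n) C.* q′ C.≈ κ n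
  κ-suc n = C.trans (C.*-congˡ (C.trans (C.sym q½²≈q) (C.*-congˡ (C.sym (C.*-identityʳ _)))))
    (C.trans (C.sym (C.^ℤ-+ (proj₂ q½) (ℤ.- (+ 2 ℤ.* ℤ.suc n ℤ.+ + K.δ)) (+ 2)))
      (C.reflexive (≡.cong (proj₁ q½ C.^ℤ_) (exponent n (+ K.δ)))))
    where
    exponent : ∀ n d → ℤ.- (+ 2 ℤ.* (+ 1 ℤ.+ n) ℤ.+ d) ℤ.+ + 2 ≡ ℤ.- (+ 2 ℤ.* n ℤ.+ d)
    exponent = ℤ-Ring.solve-∀

  κ-^ : ∀ n m → κ (n ℤ.+ + m) C.* q′ C.^ m C.≈ κ n
  κ-^ n zero    = C.trans (C.*-identityʳ _) (C.reflexive (≡.cong κ (ℤ.+-identityʳ n)))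
  κ-^ n (suc m) = C.trans (C.sym (C.*-assoc _ _ _))
    (C.trans (C.*-congʳ (C.trans (C.*-congʳ (C.reflexive (≡.cong κ (shift n (+ m))))) (κ-suc (n ℤ.+ + m)))) (κ-^ n m))
    where
    shift : ∀ n m → n ℤ.+ (+ 1 ℤ.+ m) ≡ + 1 ℤ.+ (n ℤ.+ m)
    shift = ℤ-Ring.solve-∀

  -- Modulo N, the function F lives on 𝔩⁻ᴮ/𝔩ᴮ.
  record Resolved (N : ℚ ⁺) (B : ℕ) (F : Fun) : Set where
    constructor resolved
    field
      small    : ∀ x → ¬ (x ∈𝔩 neg B) → N ≤⁺ C.v (F x)
      periodic : Periodic N (+ B) F
  open Resolved public

  neg-mono : ∀ {B B′} → B ℕ.≤ B′ → neg B′ ℤ.≤ neg B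
  neg-mono B≤B′ = ℤ.neg-mono-≤ (ℤ.+≤+ B≤B′)

  neg≤ : ∀ B → neg B ℤ.≤ + B
  neg≤ B = ℤ.≤-trans (neg-mono {0} {B} ℕ.z≤n) (ℤ.+≤+ ℕ.z≤n)

  resolved-mono : ∀ {N B B′ F} → B ℕ.≤ B′ → Resolved N B F → Resolved N B′ F
  resolved-mono B≤B′ (resolved sm per) = resolved
    (λ x x∉ → sm x (λ x∈ → x∉ (K.∈-mono (neg-mono B≤B′) x∈)))
    (λ x y d∈ → per x y (K.∈-mono (ℤ.+≤+ B≤B′) d∈))

  riemann : ℕ → Fun → C.Carrier
  riemann B F = κ (+ B) C.* Σ𝔩 (neg B) (B ℕ.+ B) F

  -B+2B : ∀ B → neg B ℤ.+ + (B ℕ.+ B) ≡ + B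
  -B+2B B = lemma (+ B)
    where
    lemma : ∀ b → ℤ.- b ℤ.+ (b ℤ.+ b) ≡ b
    lemma = ℤ-Ring.solve-∀

  periodic-≡ : ∀ {N a b h} → a ≡ b → Periodic N a h → Periodic N b h
  periodic-≡ ≡.refl per = per

  module _ {N : ℚ ⁺} where
    open C.Approx N

    resolved-periodic : ∀ {B F} → Resolved N B F → Periodic N (neg B ℤ.+ + (B ℕ.+ B)) F
    resolved-periodic {B} lev = periodic-≡ (≡.sym (-B+2B B)) (periodic lev)

    -- Enlarging the ball adds only values that vanish modulo N. Refining the classes multiplies the
    -- sum by q, and the smaller volume of a class divides by q again.
    riemann-suc : ∀ B {F} → Resolved N B F → riemann (suc B) F ~ riemann B F
    riemann-suc B {F} lev = ~-trans (~-scale (C.unit-integral (v-κ (+ suc B))) sums)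
      (≈⇒~ (C.trans (C.sym (C.*-assoc _ _ _)) (C.*-congʳ (κ-suc (+ B)))))
      where
      suc-neg : ∀ b → + 1 ℤ.+ ℤ.- (+ 1 ℤ.+ b) ≡ ℤ.- b
      suc-neg = ℤ-Ring.solve-∀
      coarse-exp : ∀ b → b ℤ.+ + 1 ≡ ℤ.- (+ 1 ℤ.+ b) ℤ.+ (+ 1 ℤ.+ (b ℤ.+ (+ 1 ℤ.+ b)))
      coarse-exp = ℤ-Ring.solve-∀
      sums : Σ𝔩 (neg (suc B)) (suc B ℕ.+ suc B) F ~ q′ C.* Σ𝔩 (neg B) (B ℕ.+ B) F
      sums = ~-trans
        (Σ-coarse N (neg (suc B)) (B ℕ.+ suc B)
          (λ x x∉ → ⇒~0 (small lev x (λ x∈ → x∉ (K.∈-≡ (≡.sym (suc-neg (+ B))) x∈))))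
          (λ x y d∈ → periodic lev x y (K.∈-mono
            (ℤ.≤-trans (ℤ.i≤i+j (+ B) (+ 1)) (ℤ.≤-reflexive (coarse-exp (+ B)))) d∈)))
        (≡.subst₂ (λ a n → Σ𝔩 a n F ~ q′ C.* Σ𝔩 (neg B) (B ℕ.+ B) F)
          (≡.sym (suc-neg (+ B))) (≡.sym (ℕ.+-suc B B))
          (Σ-refine N (neg B) (B ℕ.+ B) (resolved-periodic lev)))

    riemann-+ℕ : ∀ k B {F} → Resolved N B F → riemann (k ℕ.+ B) F ~ riemann B F
    riemann-+ℕ zero    B lev = ~-refl
    riemann-+ℕ (suc k) B lev = ~-trans (riemann-suc (k ℕ.+ B) (resolved-mono (ℕ.m≤n+m B k) lev)) (riemann-+ℕ k B lev)

    -- Both sums agree with the one at B + B′.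
    riemann-stable : ∀ {B B′ F} → Resolved N B F → Resolved N B′ F → riemann B F ~ riemann B′ F
    riemann-stable {B} {B′} {F} lev lev′ = ~-trans (~-sym (riemann-+ℕ B′ B lev))
      (≡.subst (λ k → riemann k F ~ riemann B′ F) (ℕ.+-comm B B′) (riemann-+ℕ B B′ lev′))

    riemann-~ : ∀ B {F G} → (∀ x → x ∈𝔩 neg B → F x ~ G x) → riemann B F ~ riemann B G
    riemann-~ B F~G = ~-scale (C.unit-integral (v-κ (+ B))) (Σ-~-cong N (neg B) (B ℕ.+ B) F~G)

    riemann-≤v : ∀ B {F} → (∀ x → x ∈𝔩 neg B → N ≤⁺ C.v (F x)) → N ≤⁺ C.v (riemann B F)
    riemann-≤v B h = C.≤v-scale (C.unit-integral (v-κ (+ B))) (Σ-≤v (neg B) (B ℕ.+ B) h)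

    resolved-+ : ∀ {B F G} → Resolved N B F → Resolved N B G → Resolved N B (λ x → F x C.+ G x)
    resolved-+ (resolved s p) (resolved s′ p′) = resolved
      (λ x x∉ → C.≤v-+ (s x x∉) (s′ x x∉)) (λ x y d∈ → ~-+ (p x y d∈) (p′ x y d∈))

    resolved-* : ∀ {B c F} → C.Integral c → Resolved N B F → Resolved N B (λ x → c C.* F x)
    resolved-* 0≤c (resolved s p) = resolved (λ x x∉ → C.≤v-scale 0≤c (s x x∉)) (λ x y d∈ → ~-scale 0≤c (p x y d∈))

    resolved-0 : ∀ {B} → Resolved N B (λ _ → C.0#)
    resolved-0 = resolved (λ _ _ → C.≤v-0) (λ _ _ _ → ~-refl)

    resolved-~ : ∀ {B F G} → (∀ x → F x ~ G x) → Resolved N B F → Resolved N B G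
    resolved-~ {F = F} {G} F~G (resolved s p) = resolved
      (λ x x∉ → ~0⇒ (~-trans (~-sym (F~G x)) (⇒~0 (s x x∉))))
      (λ x y d∈ → ~-trans (~-sym (F~G x)) (~-trans (p x y d∈) (F~G y)))

  riemann-cong : ∀ B {F G} → (∀ x → x ∈𝔩 neg B → F x C.≈ G x) → riemann B F C.≈ riemann B G
  riemann-cong B F≈G = C.*-congˡ (Σ-cong (neg B) (B ℕ.+ B) F≈G)

  riemann-+ : ∀ B F G → riemann B (λ x → F x C.+ G x) C.≈ riemann B F C.+ riemann B G
  riemann-+ B F G = C.trans (C.*-congˡ (Σ-+ (neg B) (B ℕ.+ B) F G)) (C.distribˡ _ _ _)

  riemann-* : ∀ B c F → riemann B (λ x → c C.* F x) C.≈ c C.* riemann B F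
  riemann-* B c F = C.trans (C.*-congˡ (Σ-* (neg B) (B ℕ.+ B) c F))
    (solve 3 (λ k c s → k :* (c :* s) := c :* (k :* s)) C.refl (κ (+ B)) c _)
    where open SC

  riemann-0 : ∀ B → riemann B (λ _ → C.0#) C.≈ C.0#
  riemann-0 B = C.trans (C.*-congˡ (Σ-0 (neg B) (B ℕ.+ B))) (C.zeroʳ _)

  riemann-sum : ∀ B {m} (F : Fin m → Fun) → riemann B (λ x → C.sum (λ i → F i x)) C.≈ C.sum (λ i → riemann B (F i))
  riemann-sum B {m} F = C.trans (C.*-congˡ (Σ-sum (neg B) (B ℕ.+ B) F)) (Sum.*-distribˡ-sum {m} _ _)

  riemann-swap : ∀ B B′ (F : K.Carrier → K.Carrier → C.Carrier) →
    riemann B (λ x → riemann B′ (F x)) C.≈ riemann B′ (λ y → riemann B (λ x → F x y))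
  riemann-swap B B′ F = C.trans (C.*-congˡ (Σ-* (neg B) (B ℕ.+ B) (κ (+ B′)) _))
    (C.trans (C.*-congˡ (C.*-congˡ (Σ-swap (neg B) (B ℕ.+ B) (neg B′) (B′ ℕ.+ B′) F)))
    (C.trans (solve 3 (λ a b s → a :* (b :* s) := b :* (a :* s)) C.refl (κ (+ B)) (κ (+ B′)) _)
      (C.*-congˡ (C.sym (Σ-* (neg B′) (B′ ℕ.+ B′) (κ (+ B)) _)))))
    where open SC

  indicator-∈ : ∀ {a n x} → x K.- a ∈𝔩 n → indicator a n x C.≈ C.1#
  indicator-∈ {a} {n} {x} d∈ with ≤⁺-dec ℚ._≤?_ [ K.ordπ n ] (K.v (x K.- a))
  ... | yes _  = C.refl
  ... | no  d∉ = ⊥-elim (d∉ (K.≤v d∈))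

  indicator-∉ : ∀ {a n x} → ¬ (x K.- a ∈𝔩 n) → indicator a n x C.≈ C.0#
  indicator-∉ {a} {n} {x} d∉ with ≤⁺-dec ℚ._≤?_ [ K.ordπ n ] (K.v (x K.- a))
  ... | yes d∈ = ⊥-elim (d∉ (K.mem d∈))
  ... | no  _  = C.refl

  indicator-≈ : ∀ {a a′ n x x′} → (x K.- a) K.- (x′ K.- a′) ∈𝔩 n → indicator a n x C.≈ indicator a′ n x′
  indicator-≈ {a} {a′} {n} {x} {x′} e∈ = by (x K.- a K.∈𝔩? n)
    where
    open SK
    by : Dec (x K.- a ∈𝔩 n) → indicator a n x C.≈ indicator a′ n x′
    by (yes d∈) = C.trans (indicator-∈ d∈) (C.sym (indicator-∈
      (K.∈-cong (solve 2 (λ d e → d :- (d :- e) := e) K.refl (x K.- a) (x′ K.- a′)) (K.∈-- d∈ e∈))))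
    by (no d∉) = C.trans (indicator-∉ d∉) (C.sym (indicator-∉ λ d∈ → d∉
      (K.∈-cong (solve 2 (λ d e → (d :- e) :+ e := d) K.refl (x K.- a) (x′ K.- a′)) (K.∈-+ e∈ d∈))))

  indicator-periodic : ∀ N a n → Periodic N n (indicator a n)
  indicator-periodic N a n x y d∈ = C.Approx.≈⇒~ N (indicator-≈ {a} {a} {n}
    (K.∈-cong (solve 3 (λ x y a → x :- y := (x :- a) :- (y :- a)) K.refl x y a) d∈))
    where open SK

  indicator-sym : ∀ a n x → indicator a n x C.≈ indicator x n a
  indicator-sym a n x = by (x K.- a K.∈𝔩? n)
    where
    open SK
    flip : ∀ x a → x K.- a ∈𝔩 n → a K.- x ∈𝔩 n
    flip x a d∈ = K.∈-cong (solve 2 (λ x a → :- (x :- a) := a :- x) K.refl x a) (K.∈-neg d∈)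
    by : Dec (x K.- a ∈𝔩 n) → indicator a n x C.≈ indicator x n a
    by (yes d∈) = C.trans (indicator-∈ d∈) (C.sym (indicator-∈ (flip x a d∈)))
    by (no d∉)  = C.trans (indicator-∉ d∉) (C.sym (indicator-∉ λ d∈ → d∉ (flip a x d∈)))

  indicator-integral : ∀ a n x → C.Integral (indicator a n x)
  indicator-integral a n x = by (x K.- a K.∈𝔩? n)
    where
    by : Dec (x K.- a ∈𝔩 n) → C.Integral (indicator a n x)
    by (yes d∈) = C.≤v-resp (C.sym (indicator-∈ d∈)) C.integral-1
    by (no d∉)  = C.≈0⇒≤v (indicator-∉ d∉)

  Σ-1 : ∀ a m → Σ𝔩 a m (λ _ → C.1#) C.≈ q′ C.^ m
  Σ-1 a zero    = C.refl
  Σ-1 a (suc m) = C.trans (C.~⊤⇒≈ (Σ-refine ⊤⁺ a m (λ _ _ _ → C.Approx.~-refl ⊤⁺))) (C.*-congˡ (Σ-1 a m))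

  Σ-indicator₀ : ∀ a k m → Σ𝔩 a (k ℕ.+ m) (indicator K.0# (a ℤ.+ + k)) C.≈ q′ C.^ m
  Σ-indicator₀ a zero m = C.trans (Σ-cong a m (λ x x∈ → indicator-∈
      (K.∈-≡ (≡.sym (ℤ.+-identityʳ a)) (K.∈--0 x∈))))
    (Σ-1 a m)
  Σ-indicator₀ a (suc k) m = C.trans (C.~⊤⇒≈ (Σ-coarse ⊤⁺ a (k ℕ.+ m)
      (λ x x∉ → C.Approx.≈⇒~ ⊤⁺ (indicator-∉ λ x∈ → x∉ (K.∈-mono (a+1≤ a k)
        (K.∈--0⁻¹ x∈))))
      (λ x y d∈ → indicator-periodic ⊤⁺ K.0# (a ℤ.+ + suc k) x y (K.∈-mono
        (ℤ.+-monoʳ-≤ a (ℤ.+≤+ (ℕ.m≤m+n (suc k) m))) d∈))))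
    (≡.subst (λ b → Σ𝔩 (ℤ.suc a) (k ℕ.+ m) (indicator K.0# b) C.≈ q′ C.^ m) (≡.sym (suc-shift a k)) (Σ-indicator₀ (ℤ.suc a) k m))
    where
    a+1≤ : ∀ a k → ℤ.suc a ℤ.≤ a ℤ.+ + suc k
    a+1≤ a k = ℤ.≤-trans (ℤ.≤-reflexive (ℤ.+-comm (+ 1) a)) (ℤ.+-monoʳ-≤ a (ℤ.+≤+ (ℕ.s≤s ℕ.z≤n)))

  Σ-indicator : ∀ a k m {c} → c ∈𝔩 a → Σ𝔩 a (k ℕ.+ m) (indicator c (a ℤ.+ + k)) C.≈ q′ C.^ m
  Σ-indicator a k m {c} c∈ = C.trans (C.sym (C.~⊤⇒≈ (Σ-translate ⊤⁺ a (k ℕ.+ m) c∈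
      (λ x y d∈ → indicator-periodic ⊤⁺ c (a ℤ.+ + k) x y (K.∈-mono (ℤ.+-monoʳ-≤ a (ℤ.+≤+ (ℕ.m≤m+n k m))) d∈)))))
    (C.trans (Σ-cong a (k ℕ.+ m) (λ x _ → indicator-≈ {c} {K.0#} {a ℤ.+ + k} {x K.+ c} {x}
        (K.∈-cong (solve 2 (λ x c → con (+ 0) := ((x :+ c) :- c) :- (x :- con (+ 0))) K.refl x c) K.0∈)))
      (Σ-indicator₀ a k m))
    where open SK

  module _ {B : ℕ} {c : K.Carrier} {n : ℤ} (c∈ : c ∈𝔩 neg B) (-B≤n : neg B ℤ.≤ n) (n≤B : n ℤ.≤ + B) where

    indicator-resolved : ∀ N → Resolved N B (indicator c n)
    indicator-resolved N = resolved
      (λ x x∉ → C.≈0⇒≤v (indicator-∉ λ d∈ → x∉ (K.∈-cong (SK.solve 2 (λ x c → (x SK.:- c) SK.:+ c SK.:= x) K.refl x c)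
        (K.∈-+ (K.∈-mono -B≤n d∈) c∈))))
      (λ x y d∈ → indicator-periodic N c n x y (K.∈-mono n≤B d∈))

    riemann-indicator : riemann B (indicator c n) C.≈ κ n
    riemann-indicator = C.trans (C.*-congˡ (C.trans
        (C.reflexive (≡.cong₂ (λ l b → Σ𝔩 (neg B) l (indicator c b)) k+m≡2B n≡))
        (Σ-indicator (neg B) k m c∈)))
      (C.trans (C.*-congʳ (C.reflexive (≡.cong κ B≡))) (κ-^ n m))
      where
      -- Here n = -B + k and B = n + m: the first k digits single out the ball, and the other m
      -- digits run through its q^m classes modulo 𝔩ᴮ.
      k = ℤ.∣ n ℤ.+ + B ∣
      m = ℤ.∣ + B ℤ.- n ∣
      +k : + k ≡ n ℤ.+ + B
      +k = ℤ.0≤i⇒+∣i∣≡i (ℤ.≤-trans (ℤ.≤-reflexive (≡.sym (ℤ.+-inverseˡ (+ B)))) (ℤ.+-monoˡ-≤ (+ B) -B≤n))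
      +m : + m ≡ + B ℤ.- n
      +m = ℤ.0≤i⇒+∣i∣≡i (ℤ.i≤j⇒0≤j-i n≤B)
      n≡ : n ≡ neg B ℤ.+ + k
      n≡ = ≡.trans (lemma n (+ B)) (≡.cong (λ j → neg B ℤ.+ j) (≡.sym +k))
        where
        lemma : ∀ n b → n ≡ ℤ.- b ℤ.+ (n ℤ.+ b)
        lemma = ℤ-Ring.solve-∀
      B≡ : + B ≡ n ℤ.+ + m
      B≡ = ≡.trans (lemma n (+ B)) (≡.cong (λ j → n ℤ.+ j) (≡.sym +m))
        where
        lemma : ∀ n b → b ≡ n ℤ.+ (b ℤ.- n)
        lemma = ℤ-Ring.solve-∀
      k+m≡2B : B ℕ.+ B ≡ k ℕ.+ m
      k+m≡2B = ℤ.+-injective (≡.trans (lemma n (+ B)) (≡.cong₂ ℤ._+_ (≡.sym +k) (≡.sym +m)))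
        where
        lemma : ∀ n b → b ℤ.+ b ≡ (n ℤ.+ b) ℤ.+ (b ℤ.- n)
        lemma = ℤ-Ring.solve-∀

  ∈-eventually : ∀ c → ∃[ B ] ∀ B′ → B ℕ.≤ B′ → c ∈𝔩 neg B′
  ∈-eventually c = by (c C≟0)
    where
    _C≟0 = K._≈0?
    by : Dec (c K.≈ K.0#) → ∃[ B ] ∀ B′ → B ℕ.≤ B′ → c ∈𝔩 neg B′
    by (yes c≈0) = 0 , λ B′ _ → K.mem (K.≈0⇒≤v c≈0)
    by (no c≉0)  = let m , sh = K.shell-exists c≉0 in
      ℤ.∣ m ∣ , λ B′ m≤B′ → K.∈-mono (ℤ.≤-trans (neg-mono m≤B′) (-∣i∣≤i m)) (K.shell⇒∈ sh)

  ∣n∣-bounds : ∀ {n B} → ℤ.∣ n ∣ ℕ.≤ B → neg B ℤ.≤ n × n ℤ.≤ + B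
  ∣n∣-bounds {+ n}      h = ℤ.≤-trans (neg-mono {0} ℕ.z≤n) (ℤ.+≤+ ℕ.z≤n) , ℤ.+≤+ h
  ∣n∣-bounds { -[1+ n ]} h = neg-mono h , ℤ.-≤+

  -- Stated for all sufficiently large B, so that the terms of the list can be given a common one. A
  -- step function is exactly periodic, so its Riemann sums are exact as well.
  step-riemann : ∀ φ → ∃[ B ] ∀ B′ → B ℕ.≤ B′ → Resolved ⊤⁺ B′ (step φ) × riemann B′ (step φ) C.≈ dx φ
  step-riemann [] = 0 , λ B′ _ → resolved-0 , riemann-0 B′
  step-riemann ((c , a , n) ∷ φ) =
    let B₁ , a∈ = ∈-eventually a
        B₂ , ih = step-riemann φ
    in B₁ ℕ.+ ℤ.∣ n ∣ ℕ.+ B₂ , λ B′ B≤B′ →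
      let B₁≤ = ℕ.≤-trans (ℕ.≤-trans (ℕ.m≤m+n B₁ _) (ℕ.m≤m+n _ B₂)) B≤B′
          n≤  = ∣n∣-bounds {n} (ℕ.≤-trans (ℕ.≤-trans (ℕ.m≤n+m _ B₁) (ℕ.m≤m+n _ B₂)) B≤B′)
          lev , eq = ih B′ (ℕ.≤-trans (ℕ.m≤n+m B₂ _) B≤B′)
          lev₁ = indicator-resolved (a∈ B′ B₁≤) (proj₁ n≤) (proj₂ n≤) ⊤⁺
      in resolved
           (λ x x∉ → C.≈0⇒≤v (C.trans (C.+-cong (C.trans (C.*-congˡ (≈0 (small lev₁ x x∉))) (C.zeroʳ c)) (≈0 (small lev x x∉))) (C.+-identityˡ _)))
           (λ x y d∈ → C.Approx.≈⇒~ ⊤⁺ (C.+-cong (C.*-congˡ (C.~⊤⇒≈ (periodic lev₁ x y d∈))) (C.~⊤⇒≈ (periodic lev x y d∈))))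
       , C.trans (riemann-+ B′ (λ x → c C.* indicator a n x) (step φ))
           (C.+-cong (C.trans (riemann-* B′ c (indicator a n)) (C.*-congˡ (riemann-indicator (a∈ B′ B₁≤) (proj₁ n≤) (proj₂ n≤)))) eq)
    where
    ≈0 : ∀ {x} → ⊤⁺ ≤⁺ C.v x → x C.≈ C.0#
    ≈0 h = C.~⊤⇒≈ (C.Approx.⇒~0 ⊤⁺ h)

  -- Uniform continuity and vanishing at infinity, expressed by a single B.
  Uniform : Fun → Set
  Uniform F = ∀ (N : ℚ) → ∃[ B ] Resolved [ N ] B F

  -- F is congruent modulo N to a step function and inherits its period, its support and its Riemann
  -- sum.
  integral⇒riemann : ∀ {F I} → ∫ F ≈ I → ∀ (N : ℚ) → ∃[ B ] Resolved [ N ] B F × C.Approx._~_ [ N ] (riemann B F) I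
  integral⇒riemann {F} {I} int N =
    let φ , F~φ , I~φ = int N
        B , h = step-riemann φ
        lev , eq = h B ℕ.≤-refl
        open C.Approx [ N ]
    in B , resolved-~ (λ x → ~-sym (F~φ x)) (resolved (λ x x∉ → ⁺-trans (_ ≤⊤⁺) (small lev x x∉)) (λ x y d∈ → ⁺-trans (_ ≤⊤⁺) (periodic lev x y d∈)))
     , ~-trans (riemann-~ B (λ x _ → F~φ x)) (~-trans (≈⇒~ eq) (~-sym I~φ))

  integral-uniform : ∀ {F I} → ∫ F ≈ I → Uniform F
  integral-uniform int N = let B , lev , _ = integral⇒riemann int N in B , lev

  integral-riemann : ∀ {F I} → ∫ F ≈ I → ∀ {N B} → Resolved [ N ] B F → C.Approx._~_ [ N ] (riemann B F) I
  integral-riemann int {N} lev = let B′ , lev′ , eq = integral⇒riemann int N in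
    C.Approx.~-trans [ N ] (riemann-stable lev lev′) eq

  private
    _++_ : StepFun → StepFun → StepFun
    []      ++ ψ = ψ
    (t ∷ φ) ++ ψ = t ∷ (φ ++ ψ)

    concat : ∀ {m} → (Fin m → StepFun) → StepFun
    concat {zero}  φ = []
    concat {suc m} φ = φ fzero ++ concat (φ ∘ fsuc)

    step-++ : ∀ φ ψ x → step (φ ++ ψ) x C.≈ step φ x C.+ step ψ x
    step-++ []      ψ x = C.sym (C.+-identityˡ _)
    step-++ (t ∷ φ) ψ x = C.trans (C.+-congˡ (step-++ φ ψ x)) (C.sym (C.+-assoc _ _ _))

    dx-++ : ∀ φ ψ → dx (φ ++ ψ) C.≈ dx φ C.+ dx ψ
    dx-++ []      ψ = C.sym (C.+-identityˡ _)
    dx-++ (t ∷ φ) ψ = C.trans (C.+-congˡ (dx-++ φ ψ)) (C.sym (C.+-assoc _ _ _))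

    step-concat : ∀ {m} (φ : Fin m → StepFun) x → step (concat φ) x C.≈ C.sum (λ i → step (φ i) x)
    step-concat {zero}  φ x = C.refl
    step-concat {suc m} φ x = C.trans (step-++ (φ fzero) _ x) (C.+-congˡ (step-concat (φ ∘ fsuc) x))

    dx-concat : ∀ {m} (φ : Fin m → StepFun) → dx (concat φ) C.≈ C.sum (λ i → dx (φ i))
    dx-concat {zero}  φ = C.refl
    dx-concat {suc m} φ = C.trans (dx-++ (φ fzero) _) (C.+-congˡ (dx-concat (φ ∘ fsuc)))

  -- The argument `g` accumulates the digits already chosen by the recursion. The outcome takes the
  -- values of F at the representatives of 𝔩ᵃ/𝔩ᵃ⁺ⁿ, each spread over a ball of order b.
  sample : Fun → ℤ → ℤ → ℕ → (K.Carrier → K.Carrier) → StepFun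
  sample F b a zero    g = (F (g K.0#) , g K.0# , b) ∷ []
  sample F b a (suc n) g = concat (λ d → sample F b (ℤ.suc a) n (λ r → g (K.π^ a K.* K.residue d K.+ r)))

  step-sample : ∀ F b a n g x → step (sample F b a n g) x C.≈ Σ𝔩 a n (λ r → F (g r) C.* indicator (g r) b x)
  step-sample F b a zero    g x = C.+-identityʳ _
  step-sample F b a (suc n) g x = C.trans (step-concat {K.q} _ x)
    (Sum.sum-cong-≋ {K.q} (λ d → step-sample F b (ℤ.suc a) n _ x))

  dx-sample : ∀ F b a n g → dx (sample F b a n g) C.≈ κ b C.* Σ𝔩 a n (λ r → F (g r))
  dx-sample F b a zero    g = C.trans (C.+-identityʳ _) (C.*-comm _ _)
  dx-sample F b a (suc n) g = C.trans (dx-concat {K.q} _) (C.trans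
    (Sum.sum-cong-≋ {K.q} (λ d → dx-sample F b (ℤ.suc a) n _)) (C.sym (Sum.*-distribˡ-sum {K.q} _ _)))

  -- The balls of order B around the representatives partition 𝔩⁻ᴮ. So at a point x of 𝔩⁻ᴮ the
  -- sampled step function takes the value of F in the one ball containing x, and elsewhere both
  -- vanish modulo N.
  integral-intro : ∀ {F I} → (∀ (N : ℚ) → ∃[ B ] Resolved [ N ] B F × C.Approx._~_ [ N ] (riemann B F) I) → ∫ F ≈ I
  integral-intro {F} {I} h N = sample F (+ B) (neg B) (B ℕ.+ B) (λ r → r)
    , (λ x → ~-sym (~-trans (≈⇒~ (step-sample F (+ B) (neg B) (B ℕ.+ B) _ x)) (approximates x (x K.∈𝔩? neg B))))
    , ~-trans (~-sym (proj₂ (proj₂ (h N)))) (≈⇒~ (C.sym (dx-sample F (+ B) (neg B) (B ℕ.+ B) _)))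
    where
    open C.Approx [ N ]
    B = proj₁ (h N)
    lev = proj₁ (proj₂ (h N))
    approximates : ∀ x → Dec (x ∈𝔩 neg B) → Σ𝔩 (neg B) (B ℕ.+ B) (λ r → F r C.* indicator r (+ B) x) ~ F x
    approximates x (no x∉) = ~-trans (Σ-~-cong [ N ] (neg B) (B ℕ.+ B) (λ r r∈ → ≈⇒~ (C.trans (C.*-congˡ (indicator-∉ λ d∈ →
        x∉ (K.∈-cong (SK.solve 2 (λ x r → (x SK.:- r) SK.:+ r SK.:= x) K.refl x r) (K.∈-+ (K.∈-mono (neg≤ B) d∈) r∈)))) (C.zeroʳ _))))
      (~-trans (≈⇒~ (Σ-0 (neg B) (B ℕ.+ B))) (~-sym (⇒~0 (small lev x x∉))))
    approximates x (yes x∈) = ~-trans (Σ-~-cong [ N ] (neg B) (B ℕ.+ B) (λ r _ → pointwise r (r K.- x K.∈𝔩? + B)))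
      (≈⇒~ (C.trans (Σ-* (neg B) (B ℕ.+ B) (F x) (indicator x (+ B)))
        (C.trans (C.*-congˡ total) (C.*-identityʳ _))))
      where
      total : Σ𝔩 (neg B) (B ℕ.+ B) (indicator x (+ B)) C.≈ C.1#
      total = C.trans (C.reflexive (≡.cong₂ (λ l b → Σ𝔩 (neg B) l (indicator x b)) (≡.sym (ℕ.+-identityʳ (B ℕ.+ B))) (≡.sym (-B+2B B))))
        (Σ-indicator (neg B) (B ℕ.+ B) 0 x∈)
      pointwise : ∀ r → Dec (r K.- x ∈𝔩 + B) → F r C.* indicator r (+ B) x ~ F x C.* indicator x (+ B) r
      pointwise r (yes d∈) = ~-trans (≈⇒~ (C.trans (C.*-congˡ (C.trans (indicator-sym r (+ B) x) (indicator-∈ d∈))) (C.*-identityʳ _)))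
        (~-trans (periodic lev r x d∈) (≈⇒~ (C.sym (C.trans (C.*-congˡ (indicator-∈ d∈)) (C.*-identityʳ _)))))
      pointwise r (no d∉) = ≈⇒~ (C.trans (C.*-congˡ (C.trans (indicator-sym r (+ B) x) (indicator-∉ d∉))) (C.trans (C.zeroʳ _)
        (C.sym (C.trans (C.*-congˡ (indicator-∉ d∉)) (C.zeroʳ _)))))

  riemann-limit : ∀ {F} → Uniform F → ∃[ I ] C.Converges (λ B → riemann B F) I
  riemann-limit {F} unif = C.complete (λ B → riemann B F) λ N → let B , lev = unif N in
    B , λ m n B≤m B≤n → riemann-stable (resolved-mono B≤m lev) (resolved-mono B≤n lev)

  abstract
    integral-exists : ∀ {F} → Uniform F → ∃[ I ] ∫ F ≈ I
    integral-exists {F} unif = let I , I-lim = riemann-limit unif in I , integral-intro (λ N →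
      let B , lev = unif N
          n₀ , conv = I-lim N
          open C.Approx [ N ]
      in B , lev , ~-trans (riemann-stable lev (resolved-mono (ℕ.m≤n+m B n₀) lev)) (conv (n₀ ℕ.+ B) (ℕ.m≤m+n n₀ B)))

-- Powers of elements near 1 and the values of characters.

module GeometricSums (F : ValuedField) where
  open ValuedField F
  open ValuedFieldProperties F
  open NaturalNumbers F
  open IntegerSolver commutativeRing

  geometric : Carrier → ℕ → Carrier
  geometric x zero    = 0#
  geometric x (suc n) = 1# + x * geometric x n

  ^-1-factor : ∀ x n → x ^ n - 1# ≈ (x - 1#) * geometric x n
  ^-1-factor x zero    = trans (-‿inverseʳ 1#) (sym (zeroʳ _))
  ^-1-factor x (suc n) = trans (solve 2 (λ x y → x :* y :- con (+ 1) := x :* (y :- con (+ 1)) :+ (x :- con (+ 1))) refl x (x ^ n))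
    (trans (+-congʳ (*-congˡ (^-1-factor x n)))
      (solve 2 (λ x g → x :* ((x :- con (+ 1)) :* g) :+ (x :- con (+ 1)) := (x :- con (+ 1)) :* (con (+ 1) :+ x :* g)) refl x (geometric x n)))

  module _ {N : ℚ ⁺} where
    open Approx N

    geometric-~ : ∀ {x} → Integral x → x ~ 1# → ∀ n → geometric x n ~ fromℕ n
    geometric-~ 0≤x x~1 zero    = ~-refl
    geometric-~ {x} 0≤x x~1 (suc n) = ~-+ ~-refl (~-trans (~-scale 0≤x (geometric-~ 0≤x x~1 n))
      (~-trans (≈⇒~ (*-comm _ _)) (~-trans (~-scale (integral-fromℕ n) x~1) (≈⇒~ (*-identityʳ _)))))

  integral-near-1 : ∀ {ε x} → 0ℚ ℚ.≤ ε → [ ε ] ≤⁺ v (x - 1#) → Integral x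
  integral-near-1 {x = x} 0≤ε h = ≤v-resp (solve 1 (λ x → (x :- con (+ 1)) :+ con (+ 1) := x) refl x)
    (≤v-+ (⁺-trans [ 0≤ε ] h) integral-1)

  -- w ≡ 1 modulo the maximal ideal makes (wⁿ - 1)/(w - 1) ≡ n.
  v-^-1 : ∀ {ε w n} → 0ℚ ℚ.< ε → [ ε ] ≤⁺ v (w - 1#) → v (fromℕ n) ≡ [ 0ℚ ] → v (w ^ n - 1#) ≡ v (w - 1#)
  v-^-1 {ε} {w} {n} 0<ε h vn = ≡.trans (v-cong (^-1-factor w n)) (≡.trans (v-* _ _)
    (≡.trans (≡.cong (v (w - 1#) +⁺_) (v-unit-perturb vn 0<ε (geometric-~ (integral-near-1 (ℚ.<⇒≤ 0<ε) h) h n))) (+⁺-identityʳ _)))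

  -- If v w were negative, the values n v w of the powers would be unbounded below.
  bounded-powers : ∀ {w b} → w ≉ 0# → (∀ n → [ ℚ.- b ] ≤⁺ v (w ^ n)) → Integral w
  bounded-powers {w} {b} w≉0 bounded = conclude (val w≉0)
    where
    open import Algebra.Properties.CommutativeSemiring.Exp commutativeSemiring using (^-distrib-*; ^-congˡ)
    conclude : ∃[ a ] v w ≡ [ a ] → Integral w
    conclude (a , vw) = ⁺-trans [ ℚ.≮⇒≥ a≮0 ] (⁺-reflexive (≡.sym vw))
      where
      a≮0 : ¬ (a ℚ.< 0ℚ)
      a≮0 a<0 = ℚ.<-irrefl ≡.refl (ℚ.<-≤-trans b<b+1 (ℚ.≤-trans (proj₁ (proj₂ arch)) (neg-cancel (≡.subst ([ ℚ.- b ] ≤⁺_) (v-w^ B) (bounded B)))))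
        where
        0<-a : 0ℚ ℚ.< ℚ.- a
        0<-a = ℚ.neg-antimono-< a<0
        open Multiples (ℚ.- a) 0<-a
        arch = archimedean (b ℚ.+ 1ℚ)
        B = proj₁ arch
        b<b+1 : b ℚ.< b ℚ.+ 1ℚ
        b<b+1 = ≡.subst (ℚ._< b ℚ.+ 1ℚ) (ℚ.+-identityʳ b) (ℚ.+-monoʳ-< b (ℚ.positive⁻¹ 1ℚ))
        v-inv^ : ∀ n → v (inv w ^ n) ≡ [ mul (+ n) ]
        v-inv^ zero    = ≡.trans v-1 (≡.cong [_] (≡.sym mul-0))
        v-inv^ (suc n) = ≡.trans (v-*-[] (v-inv vw) (v-inv^ n)) (≡.cong [_] (≡.sym (mul-suc (+ n))))
        v-w^ : ∀ n → v (w ^ n) ≡ [ ℚ.- mul (+ n) ]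
        v-w^ n = ≡.trans (v-cong (trans (inv-unique (trans (sym (^-distrib-* (inv w) w n)) (trans (^-congˡ n (inverseˡ w≉0)) (1^ n)))) refl)) (v-inv (v-inv^ n))
        neg-cancel : ∀ {x y} → [ ℚ.- x ] ≤⁺ [ ℚ.- y ] → y ℚ.≤ x
        neg-cancel {x} {y} [ h ] = ≡.subst₂ ℚ._≤_ (ℚG.⁻¹-involutive y) (ℚG.⁻¹-involutive x) (ℚ.neg-antimono-≤ h)

module Characters {ℓ p : ℕ} (S : Setting ℓ p) where
  open Integration S public
  open SC public using (solve; con; _:=_; _:+_; _:*_; _:-_; :-_)
  open Analysis S public using (Character; Fun×; χ; Unramified)
  open K using (_∈𝔩_; Shell)
  private
    module GK = GeometricSums K.valuedField
    module GC = GeometricSums C.valuedField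
    module KExp where
      open import Algebra.Properties.CommutativeSemiring.Exp K.commutativeSemiring public
    module CExp where
      open import Algebra.Properties.CommutativeSemiring.Exp C.commutativeSemiring public

  extend : Fun× → Fun
  extend φ x with x K.≈0?
  ... | yes _   = C.0#
  ... | no  x≉0 = proj₁ (φ (x , x≉0))

  record Multiplicative (θ : Fun) : Set where
    field
      θ-cong : ∀ {x y} → x K.≈ y → θ x C.≈ θ y
      θ-*    : ∀ {x y} → x K.≉ K.0# → y K.≉ K.0# → θ (x K.* y) C.≈ θ x C.* θ y
      θ-≉0   : ∀ {x} → x K.≉ K.0# → θ x C.≉ C.0#

    θ-1 : θ K.1# C.≈ C.1#
    θ-1 = C.*-cancelˡ (θ-≉0 K.1≉0) (C.trans (C.sym (θ-* K.1≉0 K.1≉0))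
      (C.trans (θ-cong (K.*-identityˡ K.1#)) (C.sym (C.*-identityʳ _))))

    θ-^ : ∀ {x} → x K.≉ K.0# → ∀ n → θ (x K.^ n) C.≈ θ x C.^ n
    θ-^ x≉0 zero    = θ-1
    θ-^ x≉0 (suc n) = C.trans (θ-* x≉0 (K.^ℤ-≉0 x≉0 (+ n))) (C.*-congˡ (θ-^ x≉0 n))

    θ-inv : ∀ {x} → x K.≉ K.0# → θ (K.inv x) C.≈ C.inv (θ x)
    θ-inv {x} x≉0 = C.inv-unique (C.trans (C.sym (θ-* x≉0 (K.inv-≉0 x≉0))) (C.trans (θ-cong (K.inverse x x≉0)) θ-1))

    θ-^ℤ : ∀ {x} → x K.≉ K.0# → ∀ n → θ (x K.^ℤ n) C.≈ θ x C.^ℤ n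
    θ-^ℤ x≉0 (+ n)    = θ-^ x≉0 n
    θ-^ℤ x≉0 -[1+ n ] = C.trans (θ-^ (K.inv-≉0 x≉0) (suc n)) (CExp.^-congˡ (suc n) (θ-inv x≉0))

  open Multiplicative public

  extend-at : ∀ (ψ : Character) x → extend (χ ψ) (proj₁ x) C.≈ proj₁ (χ ψ x)
  extend-at ψ (x , x≉0) with x K.≈0?
  ... | yes x≈0  = ⊥-elim (x≉0 x≈0)
  ... | no  x≉0′ = Character.cong ψ (x , x≉0′) (x , x≉0) K.refl

  extend-0 : ∀ (ψ : Character) {x} → x K.≈ K.0# → extend (χ ψ) x C.≈ C.0#
  extend-0 ψ {x} x≈0 with x K.≈0?
  ... | yes _   = C.refl
  ... | no  x≉0 = ⊥-elim (x≉0 x≈0)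

  extend-multiplicative : ∀ (ψ : Character) → Multiplicative (extend (χ ψ))
  extend-multiplicative ψ = record
    { θ-cong = λ {x} {y} x≈y → cong′ x≈y (x K.≈0?)
    ; θ-*    = λ {x} {y} x≉0 y≉0 → C.trans (extend-at ψ (x K.* y , K.*-≉0 x≉0 y≉0))
        (C.trans (Character.homo ψ (x , x≉0) (y , y≉0)) (C.sym (C.*-cong (extend-at ψ (x , x≉0)) (extend-at ψ (y , y≉0)))))
    ; θ-≉0   = λ {x} x≉0 θ≈0 → proj₂ (χ ψ (x , x≉0)) (C.trans (C.sym (extend-at ψ (x , x≉0))) θ≈0)
    }
    where
    cong′ : ∀ {x y} → x K.≈ y → Dec (x K.≈ K.0#) → extend (χ ψ) x C.≈ extend (χ ψ) y
    cong′ x≈y (yes x≈0) = C.trans (extend-0 ψ x≈0) (C.sym (extend-0 ψ (K.trans (K.sym x≈y) x≈0)))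
    cong′ {x} {y} x≈y (no x≉0) = C.trans (extend-at ψ (x , x≉0)) (C.trans
      (Character.cong ψ (x , x≉0) (y , K.≉0-resp x≈y x≉0) x≈y) (C.sym (extend-at ψ (y , K.≉0-resp x≈y x≉0))))

  1+𝔩-≉0 : ∀ m {u} → u K.- K.1# ∈𝔩 + suc m → u K.≉ K.0#
  1+𝔩-≉0 m {u} d∈ = K.shell⇒≉0 (K.shell-perturb (K.unit⇒shell K.v-1) (ℤ.+<+ (ℕ.s≤s ℕ.z≤n)) d∈)

  -- The quotient of u^ℓ - 1 by u - 1 is 1 + u + ... + u^(ℓ-1), which is congruent to ℓ and hence to
  -- 0 modulo 𝔩.
  ℓ-power-closer : ∀ n {u} → u K.- K.1# ∈𝔩 + suc n → u K.^ ℓ K.- K.1# ∈𝔩 + suc (suc n)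
  ℓ-power-closer n {u} d∈ = K.∈-≡ (ℤ.+-comm (+ suc n) (+ 1)) (K.∈-cong (K.sym (GK.^-1-factor u ℓ)) (K.∈-* d∈ geo∈))
    where
    d∈1 : u K.- K.1# ∈𝔩 + 1
    d∈1 = K.∈-mono (ℤ.+≤+ (ℕ.s≤s ℕ.z≤n)) d∈
    geo∈ : GK.geometric u ℓ ∈𝔩 + 1
    geo∈ = K.∈-cong (SK.solve 2 (λ g n → (g SK.:- n) SK.:+ n SK.:= g) K.refl (GK.geometric u ℓ) (K.fromℕ ℓ))
      (K.∈-+ (K.mem (GK.geometric-~ (GK.integral-near-1 (ℚ.<⇒≤ K.ϖ>0) (K.∈⇒close d∈1)) (K.≤v d∈1) ℓ)) ℓ∈𝔩)

  ℓ^k-power-closer : ∀ k n {u} → u K.- K.1# ∈𝔩 + suc n → u K.^ (ℓ ℕ.^ k) K.- K.1# ∈𝔩 + suc (k ℕ.+ n)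
  ℓ^k-power-closer zero    n {u} d∈ = K.∈-cong (K.+-congʳ (K.sym (K.*-identityʳ u))) d∈
  ℓ^k-power-closer (suc k) n {u} d∈ = K.∈-≡ (≡.cong (λ j → + suc j) (ℕ.+-suc k n))
    (K.∈-cong (K.+-congʳ (KExp.^-assocʳ u ℓ (ℓ ℕ.^ k))) (ℓ^k-power-closer k (suc n) (ℓ-power-closer n d∈)))

  -- In ℂₚ the number ℓ is a unit, so by `v-^-1` raising to the power ℓ keeps the distance to 1, in
  -- contrast to what happens in K.
  v-ℓ^k-power : ∀ k {w} → [ 1ℚ ] ≤⁺ C.v (w C.- C.1#) → C.v (w C.^ (ℓ ℕ.^ k) C.- C.1#) ≡ C.v (w C.- C.1#)
  v-ℓ^k-power zero    {w} _ = C.v-cong (C.+-congʳ (C.*-identityʳ w))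
  v-ℓ^k-power (suc k) {w} h = ≡.trans (C.v-cong (C.+-congʳ (C.sym (CExp.^-assocʳ w ℓ (ℓ ℕ.^ k)))))
    (≡.trans (v-ℓ^k-power k (≡.subst ([ 1ℚ ] ≤⁺_) (≡.sym once) h)) once)
    where
    once : C.v (w C.^ ℓ C.- C.1#) ≡ C.v (w C.- C.1#)
    once = GC.v-^-1 {n = ℓ} (ℚ.positive⁻¹ 1ℚ) h C-v-ℓ

  -- A pro-ℓ group has no nontrivial small image in ℂₚ^×: the powers u^(ℓᵏ)
  -- tend to 1, but |w^(ℓᵏ) - 1| = |w - 1| for w = χ u near 1.
  locally-constant : ∀ (ψ : Character) → ∃[ m ] ∀ u → u K.- K.1# ∈𝔩 + suc m → extend (χ ψ) u C.≈ C.1#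
  locally-constant ψ = m , trivial
    where
    θ = extend (χ ψ)
    mult = extend-multiplicative ψ
    1ᵘ : K.Units
    1ᵘ = K.1# , K.1≉0
    θ-close : ∀ N → ∃[ M ] ∀ y → y K.≉ K.0# → K.Close M y K.1# → C.Close N (θ y) C.1#
    θ-close N = let M , h = Character.continuous ψ 1ᵘ N in M , λ y y≉0 close →
      C.≤v-resp (C.+-cong (C.sym (extend-at ψ (y , y≉0))) (C.-‿cong (C.trans (C.sym (extend-at ψ 1ᵘ)) (θ-1 mult)))) (h (y , y≉0) close)
    M₁ = proj₁ (θ-close 1ℚ)
    arch₁ = K.archimedean M₁
    m = proj₁ arch₁
    near : ∀ {j} → m ℕ.≤ j → ∀ {u} → u K.- K.1# ∈𝔩 + suc j → C.Close 1ℚ (θ u) C.1#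
    near {j} m≤j {u} d∈ = proj₂ (θ-close 1ℚ) u (1+𝔩-≉0 j d∈)
      (⁺-trans [ proj₁ (proj₂ arch₁) ] (K.≤v (K.∈-mono (ℤ.+≤+ (ℕ.m≤n⇒m≤1+n m≤j)) d∈)))
    trivial : ∀ u → u K.- K.1# ∈𝔩 + suc m → θ u C.≈ C.1#
    -- The exponent k N brings u^(ℓᵏ) so near to 1 that its image is within N of 1; the image of u
    -- itself is then equally near.
    trivial u d∈ = C.close⇒≈ λ N → ≡.subst ([ N ] ≤⁺_) (v-ℓ^k-power (k N) (near ℕ.≤-refl d∈))
      (C.≤v-resp (C.+-congʳ (θ-^ mult u≉0 (ℓ ℕ.^ k N))) (proj₂ (θ-close N) (u K.^ (ℓ ℕ.^ k N)) (K.^ℤ-≉0 u≉0 (+ (ℓ ℕ.^ k N)))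
        (⁺-trans [ proj₁ (proj₂ (K.archimedean (proj₁ (θ-close N)))) ]
          (K.≤v (K.∈-mono (ℤ.+≤+ (ℕ.m≤n⇒m≤1+n (ℕ.m≤m+n (k N) m))) (ℓ^k-power-closer (k N) m d∈))))))
      where
      u≉0 = 1+𝔩-≉0 m d∈
      k : ℚ → ℕ
      k N = proj₁ (K.archimedean (proj₁ (θ-close N)))

  -- A character with χ(π) = 1, extended by zero.
  record Tame (θ : Fun) : Set where
    field
      multiplicative : Multiplicative θ
      level          : ℕ
      θ-1+𝔩          : ∀ u → u K.- K.1# ∈𝔩 + suc level → θ u C.≈ C.1#
      θ-π            : θ (proj₁ K.π) C.≈ C.1#
      v-θ            : ∀ {x} → x K.≉ K.0# → C.v (θ x) ≡ [ 0ℚ ]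

  quotient-close : ∀ {n m x y} → Shell n y → x K.- y ∈𝔩 n ℤ.+ m → x K.* K.inv y K.- K.1# ∈𝔩 m
  quotient-close {n} {m} {x} {y} sy d∈ = K.∈-≡ (lemma n m)
    (K.∈-cong (K.trans (SK.solve 3 (λ x y i → (x SK.:- y) SK.:* i SK.:= x SK.:* i SK.:- y SK.:* i) K.refl x y (K.inv y))
        (K.+-congˡ (K.-‿cong (K.inverse y (K.shell⇒≉0 sy)))))
      (K.∈-* d∈ (K.shell⇒∈ (K.shell-inv sy))))
    where
    lemma : ∀ n m → n ℤ.+ m ℤ.+ ℤ.- n ≡ m
    lemma = ℤ-Ring.solve-∀

  -- The quotient x / y lies in 1 + 𝔩ᵐ.
  locally-constant⇒ : ∀ {θ} → Multiplicative θ → ∀ {m} → (∀ u → u K.- K.1# ∈𝔩 m → θ u C.≈ C.1#) →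
    ∀ {n x y} → x K.≉ K.0# → Shell n y → x K.- y ∈𝔩 n ℤ.+ m → θ x C.≈ θ y
  locally-constant⇒ {θ} mult triv {x = x} {y} x≉0 sy d∈ = C.trans
    (θ-cong mult (K.trans (K.sym (K.*-identityʳ x)) (K.trans (K.*-congˡ (K.sym (K.inverseˡ y≉0))) (K.sym (K.*-assoc x (K.inv y) y)))))
    (C.trans (θ-* mult (K.*-≉0 x≉0 (K.inv-≉0 y≉0)) y≉0) (C.trans (C.*-congʳ (triv _ (quotient-close sy d∈))) (C.*-identityˡ _)))
    where
    y≉0 = K.shell⇒≉0 sy


  unit-part : ∀ {n x} → Shell n x → Shell (+ 0) (x K.* K.π^ (ℤ.- n))
  unit-part {n} sx = K.shell-≡ (ℤ.+-inverseʳ n) (K.shell-* sx (K.shell-π^ (ℤ.- n)))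

  unit-factor : ∀ {θ} → Multiplicative θ → ∀ {n x} → Shell n x → θ x C.≈ θ (x K.* K.π^ (ℤ.- n)) C.* θ (proj₁ K.π) C.^ℤ n
  unit-factor {θ} mult {n} {x} sx = C.trans
    (θ-cong mult (K.trans (K.sym (K.*-identityʳ x)) (K.trans (K.*-congˡ (K.trans (K.sym (K.π^-inverse n)) (K.*-comm _ _))) (K.sym (K.*-assoc x _ _)))))
    (C.trans (θ-* mult (K.shell⇒≉0 (unit-part sx)) (K.π^-≉0 n)) (C.*-congˡ (θ-^ℤ mult (proj₂ K.π) n)))

  1^ℤ : ∀ n → C.1# C.^ℤ n C.≈ C.1#
  1^ℤ (+ n)    = C.1^ n
  1^ℤ -[1+ n ] = C.trans (CExp.^-congˡ (suc n) (C.sym (C.inv-unique (C.*-identityˡ C.1#)))) (C.1^ (suc n))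

  private
    -- The substance is |θ(x)| = 1. On the units θ is locally constant, hence bounded by
    -- compactness. The units form a group, so all powers of θ(u) obey the same bound; therefore
    -- θ(u) is integral, and so is its inverse.
    tame′ : ∀ (ψ : Character) → proj₁ (χ ψ K.π) C.≈ C.1# → Tame (extend (χ ψ))
    tame′ ψ ψπ≈1 = record
      { multiplicative = mult
      ; level          = m
      ; θ-1+𝔩          = triv
      ; θ-π            = θπ
      ; v-θ            = λ x≉0 → let n , sx = K.shell-exists x≉0 in
          ≡.trans (C.v-cong (C.trans (unit-factor mult sx) (C.trans (C.*-congˡ (C.trans (C.^ℤ-cong θπ n) (1^ℤ n))) (C.*-identityʳ _))))
            (v-unit (unit-part sx))
      }
      where
      θ = extend (χ ψ)
      mult = extend-multiplicative ψ
      m = proj₁ (locally-constant ψ)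
      triv = proj₂ (locally-constant ψ)
      θπ = C.trans (extend-at ψ K.π) ψπ≈1
      Bound : K.Carrier → ℕ → Set
      Bound x k = Shell (+ 0) x → [ ℚ.- K.mul (+ k) ] ≤⁺ C.v (θ x)
      bound : ∃[ k ] ∀ x → x ∈𝔩 + 0 → Bound x k
      bound = uniform-bound (+ 0) (suc m) {Bound}
        (λ x k≤m b sx → ⁺-trans [ ℚ.neg-antimono-≤ (K.mul-mono-≤ (ℤ.+≤+ k≤m)) ] (b sx))
        (λ x y k d∈ b sy → C.≤v-resp
          (locally-constant⇒ mult triv (K.shell⇒≉0 (sx′ sy d∈)) sy d∈) (b (sx′ sy d∈)))
        (λ x x∈ → exists x (K.shell? (+ 0) x))
        where
        sx′ : ∀ {x y} → Shell (+ 0) y → x K.- y ∈𝔩 + 0 ℤ.+ + suc m → Shell (+ 0) x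
        sx′ sy d∈ = K.shell-perturb sy (ℤ.+<+ (ℕ.s≤s ℕ.z≤n)) (K.∈-≡ (ℤ.+-identityˡ (+ suc m)) d∈)
        exists : ∀ x → Dec (Shell (+ 0) x) → ∃[ k ] Bound x k
        exists x (no ¬sx) = 0 , λ sx → ⊥-elim (¬sx sx)
        exists x (yes sx) = let a , va = C.val (θ-≉0 mult (K.shell⇒≉0 sx))
                                k , _ , -k≤a = K.archimedean a
                            in k , λ _ → ⁺-trans [ ≡.subst (ℚ._≤ a) (K.mul-neg (+ k)) -k≤a ] (⁺-reflexive (≡.sym va))
      unit-^-shell : ∀ {u} → Shell (+ 0) u → ∀ n → Shell (+ 0) (u K.^ n)
      unit-^-shell su n = K.unit⇒shell (K.unit-^ (K.shell⇒unit su) n)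
      θ-integral : ∀ {u} → Shell (+ 0) u → C.Integral (θ u)
      θ-integral {u} su = GC.bounded-powers (θ-≉0 mult (K.shell⇒≉0 su)) λ n →
        C.≤v-resp (θ-^ mult (K.shell⇒≉0 su) n) (proj₂ bound _ (K.shell⇒∈ (unit-^-shell su n)) (unit-^-shell su n))
      v-unit : ∀ {u} → Shell (+ 0) u → C.v (θ u) ≡ [ 0ℚ ]
      v-unit {u} su = nonneg-sum≡0 (θ-integral su) (θ-integral (K.shell-inv su))
        (≡.trans (≡.sym (C.v-* _ _)) (≡.trans (C.v-cong (C.trans (C.sym (θ-* mult u≉0 (K.inv-≉0 u≉0)))
          (C.trans (θ-cong mult (K.inverse u u≉0)) (θ-1 mult)))) C.v-1))
        where
        u≉0 = K.shell⇒≉0 su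

  abstract
    tame : ∀ (ψ : Character) → proj₁ (χ ψ K.π) C.≈ C.1# → Tame (extend (χ ψ))
    tame = tame′

  -- Extended by zero like θ; inv 0# is a junk value.
  invert : Fun → Fun
  invert θ x with x K.≈0?
  ... | yes _ = C.0#
  ... | no  _ = C.inv (θ x)

  invert-at : ∀ θ {x} → x K.≉ K.0# → invert θ x C.≈ C.inv (θ x)
  invert-at θ {x} x≉0 with x K.≈0?
  ... | yes x≈0 = ⊥-elim (x≉0 x≈0)
  ... | no  _   = C.refl

  invert-0 : ∀ θ {x} → x K.≈ K.0# → invert θ x C.≈ C.0#
  invert-0 θ {x} x≈0 with x K.≈0?
  ... | yes _   = C.refl
  ... | no  x≉0 = ⊥-elim (x≉0 x≈0)

  tame-invert : ∀ {θ} → Tame θ → Tame (invert θ)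
  tame-invert {θ} t = record
    { multiplicative = record
        { θ-cong = λ {x} {y} x≈y → cong′ x≈y (x K.≈0?)
        ; θ-*    = λ {x} {y} x≉0 y≉0 → C.trans (invert-at θ (K.*-≉0 x≉0 y≉0)) (C.trans (C.inv-cong (θ-* mult x≉0 y≉0))
            (C.trans (C.inv-* (θ-≉0 mult x≉0) (θ-≉0 mult y≉0)) (C.sym (C.*-cong (invert-at θ x≉0) (invert-at θ y≉0)))))
        ; θ-≉0   = λ x≉0 e → C.inv-≉0 (θ-≉0 mult x≉0) (C.trans (C.sym (invert-at θ x≉0)) e)
        }
    ; level = T.level
    ; θ-1+𝔩 = λ u d∈ → C.trans (invert-at θ (1+𝔩-≉0 T.level d∈)) (inv≈1 (T.θ-1+𝔩 u d∈))
    ; θ-π   = C.trans (invert-at θ (proj₂ K.π)) (inv≈1 T.θ-π)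
    ; v-θ   = λ x≉0 → ≡.trans (C.v-cong (invert-at θ x≉0)) (C.unit-inv (T.v-θ x≉0))
    }
    where
    module T = Tame t
    mult = T.multiplicative
    inv≈1 : ∀ {w} → w C.≈ C.1# → C.inv w C.≈ C.1#
    inv≈1 w≈1 = C.sym (C.inv-unique (C.trans (C.*-identityʳ _) w≈1))
    cong′ : ∀ {x y} → x K.≈ y → Dec (x K.≈ K.0#) → invert θ x C.≈ invert θ y
    cong′ x≈y (yes x≈0) = C.trans (invert-0 θ x≈0) (C.sym (invert-0 θ (K.trans (K.sym x≈y) x≈0)))
    cong′ x≈y (no x≉0)  = C.trans (invert-at θ x≉0) (C.trans (C.inv-cong (θ-cong mult x≈y)) (C.sym (invert-at θ (K.≉0-resp x≈y x≉0))))

-- Two-sided series over ℤ.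

module TwoSidedSums (F : ValuedField) where
  open ValuedField F
  open ValuedFieldProperties F
  open NaturalNumbers F
  open IntegerSolver commutativeRing
  private
    module Sum = SemiringSum semiring

  -- Σ_{-B ≤ n < B} tₙ
  window : ℕ → (ℤ → Carrier) → Carrier
  window B t = partialSum (λ n → t (+ n)) B + partialSum (λ n → t -[1+ n ]) B

  HasSum : (ℤ → Carrier) → Carrier → Set
  HasSum t s = ∀ N → ∃[ B ] ∀ B′ → B ℕ.≤ B′ → Close N (window B′ t) s

  Decays : (ℤ → Carrier) → Set
  Decays t = ∀ (N : ℚ) → ∃[ B ] ∀ n → B ℕ.≤ ℤ.∣ n ∣ → [ N ] ≤⁺ v (t n)

  partialSum-cong : ∀ {a b} → (∀ n → a n ≈ b n) → ∀ B → partialSum a B ≈ partialSum b B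
  partialSum-cong a≈b B = Sum.sum-cong-≋ {B} (λ i → a≈b (toℕ i))

  window-cong : ∀ {t u} → (∀ n → t n ≈ u n) → ∀ B → window B t ≈ window B u
  window-cong t≈u B = +-cong (partialSum-cong (λ n → t≈u (+ n)) B) (partialSum-cong (λ n → t≈u -[1+ n ]) B)

  window-+ : ∀ B t u → window B (λ n → t n + u n) ≈ window B t + window B u
  window-+ B t u = trans (+-cong (Sum.∑-distrib-+ {B} _ _) (Sum.∑-distrib-+ {B} _ _))
    (solve 4 (λ a b c d → (a :+ b) :+ (c :+ d) := (a :+ c) :+ (b :+ d)) refl _ _ _ _)

  window-* : ∀ B c t → window B (λ n → c * t n) ≈ c * window B t
  window-* B c t = trans (+-cong (sym (Sum.*-distribˡ-sum {B} c _)) (sym (Sum.*-distribˡ-sum {B} c _))) (sym (distribˡ c _ _))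

  module _ {N : ℚ ⁺} where
    open Approx N

    window-≤v : ∀ B {t} → (∀ n → N ≤⁺ v (t n)) → N ≤⁺ v (window B t)
    window-≤v B h = ≤v-+ (≤v-sum {n = B} (λ i → h (+ toℕ i))) (≤v-sum {n = B} (λ i → h -[1+ toℕ i ]))

  hasSum-unique : ∀ {t s s′} → HasSum t s → HasSum t s′ → s ≈ s′
  hasSum-unique h h′ = close⇒≈ λ N → let B , c = h N ; B′ , c′ = h′ N in
    Approx.~-trans [ N ] (Approx.~-sym [ N ] (c (B ℕ.+ B′) (ℕ.m≤m+n B B′))) (c′ (B ℕ.+ B′) (ℕ.m≤n+m B′ B))

  hasSum-cong : ∀ {t u s s′} → (∀ n → t n ≈ u n) → s ≈ s′ → HasSum t s → HasSum u s′
  hasSum-cong t≈u s≈s′ h N = let B , c = h N in B , λ B′ B≤B′ →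
    ≤v-resp (+-cong (window-cong t≈u B′) (-‿cong s≈s′)) (c B′ B≤B′)

  hasSum-+ : ∀ {t u s r} → HasSum t s → HasSum u r → HasSum (λ n → t n + u n) (s + r)
  hasSum-+ {t} {u} h h′ N =
    let B , c = h N
        B′ , c′ = h′ N
        open Approx [ N ]
    in
    B ℕ.+ B′ , λ k le → ~-trans (≈⇒~ (window-+ k t u))
      (~-+ (c k (ℕ.≤-trans (ℕ.m≤m+n B B′) le)) (c′ k (ℕ.≤-trans (ℕ.m≤n+m B′ B) le)))

  -- Since c may fail to be integral, the precision demanded of x is shifted by v c.
  scale-precision : ∀ c (N : ℚ) → ∃[ M ] ∀ x → [ M ] ≤⁺ v x → [ N ] ≤⁺ v (c * x)
  scale-precision c N = by (v c) ≡.refl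
    where
    by : ∀ a → v c ≡ a → ∃[ M ] ∀ x → [ M ] ≤⁺ v x → [ N ] ≤⁺ v (c * x)
    by ⊤⁺    vc = 0ℚ , λ x _ → ≈0⇒≤v (trans (*-congʳ (v-⊤⇒0 c vc)) (zeroˡ x))
    by [ a ] vc = N ℚ.- a , λ x M≤ → ≡.subst (λ K → [ K ] ≤⁺ v (c * x)) (y+[x-y]≡x N a)
      (≤v-* (⁺-reflexive (≡.sym vc)) M≤)

  decays-* : ∀ {t} c → Decays t → Decays (λ n → c * t n)
  decays-* c d N = let M , h = scale-precision c N ; B , g = d M in B , λ n B≤ → h _ (g n B≤)

  decays-+ : ∀ {t u} → Decays t → Decays u → Decays (λ n → t n + u n)
  decays-+ d e N = let B , g = d N ; B′ , g′ = e N in B ℕ.+ B′ , λ n le →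
    ≤v-+ (g n (ℕ.≤-trans (ℕ.m≤m+n B B′) le)) (g′ n (ℕ.≤-trans (ℕ.m≤n+m B′ B) le))

  hasSum-* : ∀ {t s} c → HasSum t s → HasSum (λ n → c * t n) (c * s)
  hasSum-* {t} {s} c h N = let M , h′ = scale-precision c N ; B , g = h M in B , λ B′ B≤B′ →
    ≤v-resp (trans (solve 3 (λ c w s → c :* (w :- s) := c :* w :- c :* s) refl c (window B′ t) s) (+-congʳ (sym (window-* B′ c t))))
      (h′ _ (g B′ B≤B′))

  decays-neg : ∀ {t} → Decays t → Decays (λ n → t (ℤ.- n))
  decays-neg d N = let B , g = d N in B , λ n B≤ → g (ℤ.- n) (ℕ.≤-trans B≤ (ℕ.≤-reflexive (≡.sym (ℤ.∣-i∣≡∣i∣ n))))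

  decays-suc : ∀ {t} → Decays t → Decays (λ n → t (ℤ.suc n))
  decays-suc d N = let B , g = d N in suc B , λ n B≤ → g (ℤ.suc n) (bound n B≤)
    where
    bound : ∀ {B} n → suc B ℕ.≤ ℤ.∣ n ∣ → B ℕ.≤ ℤ.∣ ℤ.suc n ∣
    bound (+ n)          h = ℕ.m≤n⇒m≤1+n (ℕ.≤-trans (ℕ.n≤1+n _) h)
    bound -[1+ zero ]    (ℕ.s≤s h) = h
    bound -[1+ suc n ]   (ℕ.s≤s h) = h

  private
    -- Both n ↦ n + 1 and n ↦ -n carry the window -B-1 ≤ n ≤ B onto -B ≤ n ≤ B+1. Either map
    -- therefore only exchanges the term at -B-1 for the one at B+1, and both of these tend to 0.
    boundary : ∀ {t u} → (∀ B → window (suc B) u ≈ window (suc B) t + (t (+ suc B) - t -[1+ B ])) →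
      ∀ {s} → Decays t → HasSum t s → HasSum u s
    boundary {t} {u} eq {s} d h N =
      let B , g = d N
          B′ , c = h N
          open Approx [ N ]
      in
      suc (B ℕ.+ B′) , λ { (suc k) (ℕ.s≤s le) → ~-trans (≈⇒~ (eq k)) (~-trans
        (~-+ (c (suc k) (ℕ.m≤n⇒m≤1+n (ℕ.≤-trans (ℕ.m≤n+m B′ B) le)))
          (⇒~0 (≤v-- (g (+ suc k) (ℕ.m≤n⇒m≤1+n (ℕ.≤-trans (ℕ.m≤m+n B B′) le)))
                     (g -[1+ k ] (ℕ.m≤n⇒m≤1+n (ℕ.≤-trans (ℕ.m≤m+n B B′) le))))))
        (≈⇒~ (+-identityʳ s))) }

    rotate : ∀ t B {p m} → p ≈ partialSum (λ n → t (+ suc n)) (suc B) → m ≈ t (+ 0) + partialSum (λ n → t -[1+ n ]) B →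
      p + m ≈ window (suc B) t + (t (+ suc B) - t -[1+ B ])
    rotate t B {p} {m} p≈ m≈ = trans (+-cong p≈ m≈)
      (trans (solve 3 (λ P z M → P :+ (z :+ M) := (z :+ P) :+ M) refl (partialSum (λ n → t (+ suc n)) (suc B)) (t (+ 0)) (partialSum (λ n → t -[1+ n ]) B))
      (trans (+-congʳ (partialSum-suc (λ n → t (+ n)) (suc B)))
      (trans (solve 4 (λ P T M X → (P :+ T) :+ M := (P :+ (M :+ X)) :+ (T :- X)) refl
        (partialSum (λ n → t (+ n)) (suc B)) (t (+ suc B)) (partialSum (λ n → t -[1+ n ]) B) (t -[1+ B ]))
        (+-congʳ (+-congˡ (sym (partialSum-suc (λ n → t -[1+ n ]) B)))))))

  hasSum-suc : ∀ {t s} → Decays t → HasSum t s → HasSum (λ n → t (ℤ.suc n)) s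
  hasSum-suc {t} = boundary {t} {λ n → t (ℤ.suc n)} (λ B → rotate t B refl refl)

  hasSum-neg : ∀ {t s} → Decays t → HasSum t s → HasSum (λ n → t (ℤ.- n)) s
  hasSum-neg {t} = boundary {t} {λ n → t (ℤ.- n)} (λ B → trans (+-comm _ _) (rotate t B refl refl))

  Shiftable : (ℤ → Carrier) → Carrier → Set
  Shiftable t s = Decays t × HasSum t s

  shiftable-cong : ∀ {t u s} → (∀ n → t n ≈ u n) → Shiftable t s → Shiftable u s
  shiftable-cong t≈u (d , h) = (λ N → let B , g = d N in B , λ n B≤ → ≤v-resp (t≈u n) (g n B≤)) , hasSum-cong t≈u refl h

  shiftable-neg : ∀ {t s} → Shiftable t s → Shiftable (λ n → t (ℤ.- n)) s
  shiftable-neg {t} (d , h) = decays-neg {t} d , hasSum-neg {t} d h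

  shiftable-+ℕ : ∀ k {t s} → Shiftable t s → Shiftable (λ n → t (+ k ℤ.+ n)) s
  shiftable-+ℕ zero    {t} sh = shiftable-cong (λ n → reflexive (≡.cong t (≡.sym (ℤ.+-identityˡ n)))) sh
  shiftable-+ℕ (suc k) {t} sh = let d , h = shiftable-+ℕ k {t} sh in
    shiftable-cong (λ n → reflexive (≡.cong t (assoc (+ k) n)))
      (decays-suc {λ n → t (+ k ℤ.+ n)} d , hasSum-suc {λ n → t (+ k ℤ.+ n)} d h)
    where
    assoc : ∀ k n → k ℤ.+ (+ 1 ℤ.+ n) ≡ + 1 ℤ.+ k ℤ.+ n
    assoc = ℤ-Ring.solve-∀

  -- A negative shift is a positive one conjugated by the reflection n ↦ -n.
  shiftable-shift : ∀ k {t s} → Shiftable t s → Shiftable (λ n → t (k ℤ.+ n)) s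
  shiftable-shift (+ k)    {t} sh = shiftable-+ℕ k {t} sh
  shiftable-shift -[1+ k ] {t} sh = shiftable-cong (λ n → reflexive (≡.cong t (flip (+ suc k) n)))
    (shiftable-neg (shiftable-+ℕ (suc k) {λ n → t (ℤ.- n)} (shiftable-neg {t} sh)))
    where
    flip : ∀ k n → ℤ.- (k ℤ.+ ℤ.- n) ≡ ℤ.- k ℤ.+ n
    flip = ℤ-Ring.solve-∀

  convergent⇒hasSum : ∀ {t s₊ s₋} → Converges (partialSum (λ n → t (+ n))) s₊ → Converges (partialSum (λ n → t -[1+ n ])) s₋ →
    HasSum t (s₊ + s₋)
  convergent⇒hasSum c₊ c₋ N = let B , g = c₊ N ; B′ , g′ = c₋ N in B ℕ.+ B′ , λ k le →
    Approx.~-+ [ N ] (g k (ℕ.≤-trans (ℕ.m≤m+n B B′) le)) (g′ k (ℕ.≤-trans (ℕ.m≤n+m B′ B) le))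

  convergent⇒terms : ∀ {a s} → Converges (partialSum a) s → ∀ (N : ℚ) → ∃[ B ] ∀ n → B ℕ.≤ n → [ N ] ≤⁺ v (a n)
  convergent⇒terms {a} {s} c N = let B , g = c N in B , λ n B≤n →
    ≤v-resp (trans (+-congʳ (partialSum-suc a n)) (solve 2 (λ p x → (p :+ x) :- p := x) refl (partialSum a n) (a n)))
      (Approx.~-trans [ N ] (g (suc n) (ℕ.m≤n⇒m≤1+n B≤n)) (Approx.~-sym [ N ] (g n B≤n)))

  convergent⇒decays : ∀ {t s₊ s₋} → Converges (partialSum (λ n → t (+ n))) s₊ → Converges (partialSum (λ n → t -[1+ n ])) s₋ → Decays t
  convergent⇒decays {t} c₊ c₋ N = let B , g = convergent⇒terms c₊ N ; B′ , g′ = convergent⇒terms c₋ N in suc (B ℕ.+ B′) , λ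
    { (+ n)    le → g n (ℕ.≤-trans (ℕ.≤-trans (ℕ.m≤m+n B B′) (ℕ.n≤1+n _)) le)
    ; -[1+ n ] (ℕ.s≤s le) → g′ n (ℕ.≤-trans (ℕ.m≤n+m B′ B) le) }

  -- In an ultrametric field two partial sums differ by no more than the largest term between them.
  terms⇒cauchy : ∀ {a} → (∀ (N : ℚ) → ∃[ B ] ∀ n → B ℕ.≤ n → [ N ] ≤⁺ v (a n)) → Cauchy (partialSum a)
  terms⇒cauchy {a} h N = B , λ m n B≤m B≤n → ~-trans (base m B≤m) (~-sym (base n B≤n))
    where
    open Approx [ N ]
    B = proj₁ (h N)
    g = proj₂ (h N)
    extend : ∀ k m → B ℕ.≤ m → partialSum a (k ℕ.+ m) ~ partialSum a m
    extend zero    m B≤m = ~-refl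
    extend (suc k) m B≤m = ~-trans (≈⇒~ (partialSum-suc a (k ℕ.+ m)))
      (~-trans (~-+ (extend k m B≤m) (⇒~0 (g (k ℕ.+ m) (ℕ.≤-trans B≤m (ℕ.m≤n+m m k))))) (≈⇒~ (+-identityʳ _)))
    base : ∀ m → B ℕ.≤ m → partialSum a m ~ partialSum a B
    base m B≤m = ≡.subst (λ k → partialSum a k ~ partialSum a B) (ℕ.m∸n+n≡m B≤m) (extend (m ℕ.∸ B) B ℕ.≤-refl)

  abstract
    decays⇒convergent : Complete → ∀ {t} → Decays t →
      ∃[ s₊ ] ∃[ s₋ ] Converges (partialSum (λ n → t (+ n))) s₊ × Converges (partialSum (λ n → t -[1+ n ])) s₋
    decays⇒convergent complete {t} d =
      let s₊ , c₊ = complete (partialSum (λ n → t (+ n))) (terms⇒cauchy λ N → let B , g = d N in B , λ n → g (+ n))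
          s₋ , c₋ = complete (partialSum (λ n → t -[1+ n ])) (terms⇒cauchy λ N → let B , g = d N in B , λ n le → g -[1+ n ] (ℕ.m≤n⇒m≤1+n le))
      in s₊ , s₋ , c₊ , c₋

  -- From some B on the terms are integral, and finitely many remain.
  decays-bounded : ∀ {t} → Decays t → ∃[ M ] ∀ n → [ M ] ≤⁺ v (t n)
  decays-bounded {t} d = let B , g = d 0ℚ
                             M , h = lower-bound B
                         in 0ℚ ℚ.⊓ M , λ n → by B g M h n (B ℕ.≤? ℤ.∣ n ∣)
    where
    finite : ∀ x → ∃[ M ] [ M ] ≤⁺ v x
    finite x = at (v x) ≡.refl
      where
      at : ∀ a → v x ≡ a → ∃[ M ] [ M ] ≤⁺ v x
      at [ a ] eq = a , ⁺-reflexive (≡.sym eq)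
      at ⊤⁺    eq = 0ℚ , ⁺-trans (_ ≤⊤⁺) (⁺-reflexive (≡.sym eq))
    lower-bound : ∀ B → ∃[ M ] ∀ n → ℤ.∣ n ∣ ℕ.< B → [ M ] ≤⁺ v (t n)
    lower-bound zero    = 0ℚ , λ n ()
    lower-bound (suc B) =
      let M , h = lower-bound B
          M₊ , h₊ = finite (t (+ B))
          M₋ , h₋ = finite (t (ℤ.- (+ B)))
          M′ = (M₊ ℚ.⊓ M₋) ℚ.⊓ M
      in M′ , λ n n<B → extend n B n<B h (⁺-trans [ ℚ.≤-trans (ℚ.p⊓q≤p (M₊ ℚ.⊓ M₋) M) (ℚ.p⊓q≤p M₊ M₋) ] h₊)
                          (⁺-trans [ ℚ.≤-trans (ℚ.p⊓q≤p (M₊ ℚ.⊓ M₋) M) (ℚ.p⊓q≤q M₊ M₋) ] h₋) [ ℚ.p⊓q≤q (M₊ ℚ.⊓ M₋) M ]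
      where
      extend : ∀ n B {M M′} → ℤ.∣ n ∣ ℕ.< suc B → (∀ n → ℤ.∣ n ∣ ℕ.< B → [ M ] ≤⁺ v (t n)) →
        [ M′ ] ≤⁺ v (t (+ B)) → [ M′ ] ≤⁺ v (t (ℤ.- (+ B))) → [ M′ ] ≤⁺ [ M ] → [ M′ ] ≤⁺ v (t n)
      extend n B (ℕ.s≤s n≤B) h h₊ h₋ M′≤M with ℕ.m≤n⇒m<n∨m≡n n≤B
      ... | inj₁ n<B = ⁺-trans M′≤M (h n n<B)
      extend (+ n) B (ℕ.s≤s n≤B) h h₊ h₋ M′≤M | inj₂ ≡.refl = h₊
      extend -[1+ n ] B (ℕ.s≤s n≤B) h h₊ h₋ M′≤M | inj₂ ≡.refl = h₋
    by : ∀ B (g : ∀ n → B ℕ.≤ ℤ.∣ n ∣ → [ 0ℚ ] ≤⁺ v (t n)) M (h : ∀ n → ℤ.∣ n ∣ ℕ.< B → [ M ] ≤⁺ v (t n)) n →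
      Dec (B ℕ.≤ ℤ.∣ n ∣) → [ 0ℚ ℚ.⊓ M ] ≤⁺ v (t n)
    by B g M h n (yes B≤n) = ⁺-trans [ ℚ.p⊓q≤p 0ℚ M ] (g n B≤n)
    by B g M h n (no B≰n)  = ⁺-trans [ ℚ.p⊓q≤q 0ℚ M ] (h n (ℕ.≰⇒> B≰n))

-- Zeta integrals as Laurent series.

module ZetaIntegrals {ℓ p : ℕ} (S : Setting ℓ p) where
  open Characters S public
  open TwoSidedSums C.valuedField public
  open K using (_∈𝔩_; Shell)
  private
    module Sum = SemiringSum C.semiring

  onShell : Fun → ℤ → Fun
  onShell θ n x with K.shell? n x
  ... | yes _ = θ x
  ... | no  _ = C.0#

  onShell-in : ∀ θ {n x} → Shell n x → onShell θ n x C.≈ θ x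
  onShell-in θ {n} {x} sx with K.shell? n x
  ... | yes _   = C.refl
  ... | no  ¬sx = ⊥-elim (¬sx sx)

  onShell-out : ∀ θ {n x} → ¬ Shell n x → onShell θ n x C.≈ C.0#
  onShell-out θ {n} {x} ¬sx with K.shell? n x
  ... | yes sx = ⊥-elim (¬sx sx)
  ... | no  _  = C.refl

  onShell-cases : ∀ θ n x → (Shell n x × onShell θ n x C.≈ θ x) ⊎ (¬ Shell n x × onShell θ n x C.≈ C.0#)
  onShell-cases θ n x with K.shell? n x
  ... | yes sx  = inj₁ (sx , C.refl)
  ... | no  ¬sx = inj₂ (¬sx , C.refl)

  module _ {θ : Fun} (t : Tame θ) where
    open Tame t

    onShell-integral : ∀ n x → C.Integral (onShell θ n x)
    onShell-integral n x = by (onShell-cases θ n x)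
      where
      by : _ → C.Integral (onShell θ n x)
      by (inj₁ (sx , eq)) = C.≤v-resp (C.sym eq) (C.unit-integral (v-θ (K.shell⇒≉0 sx)))
      by (inj₂ (_ , eq))  = C.≈0⇒≤v eq

    -- At order n a difference in 𝔩^(n + level + 1) preserves the order and amounts to a quotient in
    -- 1 + 𝔩^(level + 1), on which θ is trivial.
    onShell-periodic : ∀ n {b} → n ℤ.+ + suc level ℤ.≤ b → Periodic ⊤⁺ b (onShell θ n)
    onShell-periodic n {b} le x y d∈ = C.Approx.≈⇒~ ⊤⁺ (by (onShell-cases θ n x) (onShell-cases θ n y))
      where
      d∈′ = K.∈-mono le d∈
      flip : y K.- x ∈𝔩 n ℤ.+ + suc level
      flip = K.∈-cong (SK.solve 2 (λ x y → SK.:- (x SK.:- y) SK.:= y SK.:- x) K.refl x y) (K.∈-neg d∈′)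
      by : _ → _ → onShell θ n x C.≈ onShell θ n y
      by (inj₁ (sx , ex))  (inj₁ (sy , ey))  = C.trans ex (C.trans (locally-constant⇒ multiplicative θ-1+𝔩 (K.shell⇒≉0 sx) sy d∈′) (C.sym ey))
      by (inj₁ (sx , _))   (inj₂ (¬sy , _))  = ⊥-elim (¬sy (K.shell-perturb sx (i<i+suc[n] n level) flip))
      by (inj₂ (¬sx , _))  (inj₁ (sy , _))   = ⊥-elim (¬sx (K.shell-perturb sy (i<i+suc[n] n level) d∈′))
      by (inj₂ (_ , ex))   (inj₂ (_ , ey))   = C.trans ex (C.sym ey)

    shell-precision : ℤ → ℕ
    shell-precision n = ℤ.∣ n ∣ ℕ.+ suc level

    shell-precision-≤ : ∀ n {B} → shell-precision n ℕ.≤ B → n ℤ.+ + suc level ℤ.≤ + B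
    shell-precision-≤ n le = ℤ.≤-trans (ℤ.+-monoˡ-≤ (+ suc level) (proj₂ (∣n∣-bounds {n} ℕ.≤-refl))) (ℤ.+≤+ le)

  resolved-product : ∀ {N B f h} → Resolved N B f → (∀ x → C.Integral (h x)) → Periodic ⊤⁺ (+ B) h →
    Resolved N B (λ x → f x C.* h x)
  resolved-product {N} {B} {f} {h} (resolved sm per) h-int h-per = resolved
    (λ x x∉ → C.≤v-resp (C.*-comm _ _) (C.≤v-scale (h-int x) (sm x x∉)))
    (λ x y d∈ → ~-trans (≈⇒~ (C.trans (C.*-comm _ _) (C.*-congʳ (C.~⊤⇒≈ (h-per x y d∈)))))
      (~-trans (~-scale (h-int y) (per x y d∈)) (≈⇒~ (C.*-comm _ _))))
    where open C.Approx N

  resolved-onShell : ∀ {N B f θ} (t : Tame θ) → Resolved N B f → ∀ n → shell-precision t n ℕ.≤ B →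
    Resolved N B (λ x → f x C.* onShell θ n x)
  resolved-onShell t res n le = resolved-product res (onShell-integral t n) (onShell-periodic t n (shell-precision-≤ t n le))

  uniform-onShell : ∀ {f θ} (t : Tame θ) → Uniform f → ∀ n → Uniform (λ x → f x C.* onShell θ n x)
  uniform-onShell t uf n N = let B , res = uf N in
    B ℕ.+ shell-precision t n , resolved-onShell t (resolved-mono (ℕ.m≤m+n B _) res) n (ℕ.m≤n+m _ B)

  resolved-sum : ∀ {N B m} {F : Fin m → Fun} → (∀ i → Resolved N B (F i)) → Resolved N B (λ x → C.sum (λ i → F i x))
  resolved-sum {N} {m = m} h = resolved (λ x x∉ → C.≤v-sum {n = m} (λ i → small (h i) x x∉))
    (λ x y d∈ → C.Approx.~-sum N {m} (λ i → periodic (h i) x y d∈))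

  partialSum-single : ∀ B a {i} → i ℕ.< B → (∀ j → ¬ (j ≡ i) → a j C.≈ C.0#) → C.partialSum a B C.≈ a i
  partialSum-single B a {i} i<B off = C.trans
    (C.~⊤⇒≈ (sum-single ⊤⁺ {B} (a ∘ toℕ) (fromℕ< i<B) (λ j j≢ → C.Approx.≈⇒~ ⊤⁺ (off (toℕ j) (λ eq → j≢
      (Fin.toℕ-injective (≡.trans eq (≡.sym (Fin.toℕ-fromℕ< i<B)))))))))
    (C.reflexive (≡.cong a (Fin.toℕ-fromℕ< i<B)))

  partialSum-0 : ∀ B a → (∀ j → a j C.≈ C.0#) → C.partialSum a B C.≈ C.0#
  partialSum-0 B a h = C.trans (Sum.sum-cong-≋ {B} (λ j → h (toℕ j))) (Sum.sum-replicate-zero B)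

  -1+n<-n : ∀ n → -[1+ n ] ℤ.< neg n
  -1+n<-n zero    = ℤ.-<+
  -1+n<-n (suc n) = ℤ.-<- ℕ.≤-refl

  -- For an index within the window, `inside` records the consequence to be used: a family supported
  -- at k has its value there as window sum. In the other two cases an element of order k is close
  -- to 0 or to infinity.
  data Position (B : ℕ) : ℤ → Set where
    inside   : ∀ {k} → (∀ t → (∀ n → ¬ (n ≡ k) → t n C.≈ C.0#) → window B t C.≈ t k) → Position B k
    near-0   : ∀ {k} → + B ℤ.≤ k → Position B k
    near-∞   : ∀ {k} → k ℤ.< neg B → Position B k

  position : ∀ B k → Position B k
  position B (+ i) with i ℕ.<? B
  ... | yes i<B = inside λ t off → C.trans (C.+-cong
          (partialSum-single B (λ n → t (+ n)) i<B (λ j j≢i → off (+ j) (λ eq → j≢i (ℤ.+-injective eq))))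
          (partialSum-0 B (λ n → t -[1+ n ]) (λ j → off -[1+ j ] (λ ()))))
        (C.+-identityʳ _)
  ... | no  i≮B = near-0 (ℤ.+≤+ (ℕ.≮⇒≥ i≮B))
  position B -[1+ i ] with i ℕ.<? B
  ... | yes i<B = inside λ t off → C.trans (C.+-cong
          (partialSum-0 B (λ n → t (+ n)) (λ j → off (+ j) (λ ())))
          (partialSum-single B (λ n → t -[1+ n ]) i<B (λ j j≢i → off -[1+ j ] (λ eq → j≢i (ℤ.-[1+-injective eq)))))
        (C.+-identityˡ _)
  ... | no  i≮B = near-∞ (ℤ.<-≤-trans (-1+n<-n i) (neg-mono (ℕ.≮⇒≥ i≮B)))

  module Coefficients {f : Fun} (uf : Uniform f) (f0 : f K.0# C.≈ C.0#) {θ : Fun} (t : Tame θ) where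
    open Tame t

    abstract
      coef-exists : ∀ n → ∃[ I ] ∫ (λ x → f x C.* onShell θ n x) ≈ I
      coef-exists n = integral-exists (uniform-onShell t uf n)

    coef : ℤ → C.Carrier
    coef n = proj₁ (coef-exists n)

    coef-integral : ∀ n → ∫ (λ x → f x C.* onShell θ n x) ≈ coef n
    coef-integral n = proj₂ (coef-exists n)

    coef-≤v : ∀ {N : ℚ} n → (∀ {x} → Shell n x → [ N ] ≤⁺ C.v (f x)) → [ N ] ≤⁺ C.v (coef n)
    coef-≤v {N} n h =
      let B , res = uniform-onShell t uf n N
          open C.Approx [ N ]
      in
      ~0⇒ (~-trans (~-sym (integral-riemann (coef-integral n) res)) (⇒~0 (riemann-≤v B (λ x _ → bound x (onShell-cases θ n x)))))
      where
      bound : ∀ x → _ → [ N ] ≤⁺ C.v (f x C.* onShell θ n x)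
      bound x (inj₁ (sx , _))  = C.≤v-resp (C.*-comm _ _) (C.≤v-scale (onShell-integral t n x) (h sx))
      bound x (inj₂ (_ , eq)) = C.≈0⇒≤v (C.trans (C.*-congˡ eq) (C.zeroʳ _))

    -- The place where f(0) = 0 enters.
    small-near-0 : ∀ {N B} → Resolved [ N ] B f → ∀ {x} → x ∈𝔩 + B → [ N ] ≤⁺ C.v (f x)
    small-near-0 {N} res {x} x∈ = ~0⇒ (~-trans (periodic res x K.0# (K.∈--0 x∈)) (≈⇒~ f0))
      where open C.Approx [ N ]

    small-outside : ∀ {N B} → Resolved [ N ] B f → ∀ {k} → + B ℤ.≤ k ⊎ k ℤ.< neg B → ∀ {x} → Shell k x → [ N ] ≤⁺ C.v (f x)
    small-outside res (inj₁ B≤k) sx  = small-near-0 res (K.∈-mono B≤k (K.shell⇒∈ sx))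
    small-outside res (inj₂ k<-B) sx = small res _ (K.shell⇒∉ sx k<-B)

    coef-decays : Decays coef
    coef-decays N = let B , res = uf N in suc B , λ n le → coef-≤v n (λ sx → small-outside res (outside n le) sx)
      where
      outside : ∀ {B} n → suc B ℕ.≤ ℤ.∣ n ∣ → + B ℤ.≤ n ⊎ n ℤ.< neg B
      outside (+ n)    le = inj₁ (ℤ.+≤+ (ℕ.≤-trans (ℕ.n≤1+n _) le))
      outside -[1+ n ] (ℕ.s≤s le) = inj₂ (ℤ.<-≤-trans (-1+n<-n n) (neg-mono le))

    -- Modulo N, F is the sum of its parts on the shells of order -B ≤ n < B, because f is small on
    -- all the others. Integrating this finite sum gives a window of the series.
    zeta-integral : ∀ {w} → C.v w ≡ [ 0ℚ ] → ∀ {s} → HasSum (λ n → coef n C.* w C.^ℤ n) s →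
      ∀ {F} → (∀ {n x} → Shell n x → F x C.≈ f x C.* (θ x C.* w C.^ℤ n)) → (∀ {x} → x K.≈ K.0# → F x C.≈ C.0#) →
      ∫ F ≈ s
    zeta-integral {w} vw {s} hs {F} F-shell F-0 = integral-intro λ N →
      let B₁ , res = uf N
          B₂ , conv = hs N
      in at N (B₁ ℕ.+ B₂) (resolved-mono (ℕ.m≤m+n B₁ B₂) res) (conv (B₁ ℕ.+ B₂) (ℕ.m≤n+m B₂ B₁))
      where
      term : ℤ → Fun
      term n x = w C.^ℤ n C.* (f x C.* onShell θ n x)
      at : ∀ N B → Resolved [ N ] B f → C.Close N (window B (λ n → coef n C.* w C.^ℤ n)) s →
        ∃[ B ] Resolved [ N ] B F × C.Approx._~_ [ N ] (riemann B F) s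
      at N B res conv = B′ , resolved-~ (λ x → ~-sym (F~ x (x K.≈0?))) res-window , ~-trans (riemann-~ B′ (λ x _ → F~ x (x K.≈0?)))
        (~-trans (≈⇒~ (C.trans (riemann-+ B′ _ _) (C.+-cong (riemann-sum B′ {B} _) (riemann-sum B′ {B} _))))
        (~-trans (~-+ (~-sum {B} (λ i → term-integral (+ toℕ i) (precise₊ i))) (~-sum {B} (λ i → term-integral -[1+ toℕ i ] (precise₋ i)))) conv))
        where
        open C.Approx [ N ]
        B′ = B ℕ.+ B ℕ.+ suc level
        res′ : Resolved [ N ] B′ f
        res′ = resolved-mono (ℕ.≤-trans (ℕ.m≤m+n B B) (ℕ.m≤m+n _ _)) res
        precise : ∀ {k} → k ℕ.≤ B → k ℕ.+ suc level ℕ.≤ B′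
        precise k≤B = ℕ.+-monoˡ-≤ (suc level) (ℕ.≤-trans k≤B (ℕ.m≤m+n B B))
        precise₊ : ∀ (i : Fin B) → shell-precision t (+ toℕ i) ℕ.≤ B′
        precise₊ i = precise (ℕ.<⇒≤ (Fin.toℕ<n i))
        precise₋ : ∀ (i : Fin B) → shell-precision t -[1+ toℕ i ] ℕ.≤ B′
        precise₋ i = precise (Fin.toℕ<n i)
        w^-int : ∀ n → C.Integral (w C.^ℤ n)
        w^-int n = C.unit-integral (C.unit-^ℤ vw n)
        term-resolved : ∀ n → shell-precision t n ℕ.≤ B′ → Resolved [ N ] B′ (term n)
        term-resolved n le = resolved-* (w^-int n) (resolved-onShell t res′ n le)
        res-window : Resolved [ N ] B′ (λ x → window B (λ n → term n x))
        res-window = resolved-+ (resolved-sum {m = B} (λ i → term-resolved (+ toℕ i) (precise₊ i)))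
                             (resolved-sum {m = B} (λ i → term-resolved -[1+ toℕ i ] (precise₋ i)))
        term-integral : ∀ n → shell-precision t n ℕ.≤ B′ → riemann B′ (term n) ~ coef n C.* w C.^ℤ n
        term-integral n le = ~-trans (≈⇒~ (riemann-* B′ (w C.^ℤ n) _))
          (~-trans (~-scale (w^-int n) (integral-riemann (coef-integral n) (resolved-onShell t res′ n le))) (≈⇒~ (C.*-comm _ _)))
        term-out : ∀ n {x} → ¬ Shell n x → term n x C.≈ C.0#
        term-out n ¬sx = C.trans (C.*-congˡ (C.trans (C.*-congˡ (onShell-out θ ¬sx)) (C.zeroʳ _))) (C.zeroʳ _)
        F≤v : ∀ {k x} → Shell k x → [ N ] ≤⁺ C.v (f x) → [ N ] ≤⁺ C.v (F x)
        F≤v {k} sx h = C.≤v-resp (C.trans (C.*-comm _ _) (C.sym (F-shell sx)))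
          (C.≤v-scale (C.integral-* (C.unit-integral (v-θ (K.shell⇒≉0 sx))) (w^-int k)) h)
        term≤v : ∀ n {x} → [ N ] ≤⁺ C.v (f x) → [ N ] ≤⁺ C.v (term n x)
        term≤v n {x} h = C.≤v-scale (w^-int n) (C.≤v-resp (C.*-comm _ _) (C.≤v-scale (onShell-integral t n x) h))
        F~ : ∀ x → Dec (x K.≈ K.0#) → F x ~ window B (λ n → term n x)
        F~ x (yes x≈0) = ≈⇒~ (C.trans (F-0 x≈0) (C.sym (C.trans (C.+-cong
            (partialSum-0 B (λ n → term (+ n) x) (λ n → term-out (+ n) (λ sx → K.shell⇒≉0 sx x≈0)))
            (partialSum-0 B (λ n → term -[1+ n ] x) (λ n → term-out -[1+ n ] (λ sx → K.shell⇒≉0 sx x≈0)))) (C.+-identityˡ _))))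
        F~ x (no x≉0) = by (proj₁ (K.shell-exists x≉0)) (proj₂ (K.shell-exists x≉0)) (position B _)
          where
          outside : ∀ {k} → Shell k x → + B ℤ.≤ k ⊎ k ℤ.< neg B → F x ~ window B (λ n → term n x)
          outside sx out = ~-trans (⇒~0 (F≤v sx f≤)) (~-sym (⇒~0 (window-≤v B (λ n → term≤v n f≤))))
            where f≤ = small-outside res out sx
          by : ∀ k → Shell k x → Position B k → F x ~ window B (λ n → term n x)
          by k sx (inside single) = ≈⇒~ (C.trans (F-shell sx) (C.sym (C.trans
            (single (λ n → term n x) (λ n n≢k → term-out n (λ sx′ → n≢k (K.shell-unique sx′ sx))))
            (C.trans (C.*-congˡ (C.*-congˡ (onShell-in θ sx)))
              (solve 3 (λ w f θ → w :* (f :* θ) := f :* (θ :* w)) C.refl (w C.^ℤ k) (f x) (θ x))))))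
          by k sx (near-0 B≤k)  = outside sx (inj₁ B≤k)
          by k sx (near-∞ k<-B) = outside sx (inj₂ k<-B)

-- Fourier transforms of characters on shells.

module GaussSums {ℓ p : ℕ} (S : Setting ℓ p) where
  open ZetaIntegrals S public
  open K using (_∈𝔩_; Shell)

  -- In the ramified case the conductor is 𝔩^(m+1).
  data Conductor (θ : Fun) : Set where
    unramified : (∀ u → Shell (+ 0) u → θ u C.≈ C.1#) → Conductor θ
    ramified   : ∀ m → (∀ u → u K.- K.1# ∈𝔩 + suc m → θ u C.≈ C.1#) →
                 ∀ u₀ → Shell (+ 0) u₀ → u₀ K.- K.1# ∈𝔩 + m → ¬ (θ u₀ C.≈ C.1#) → Conductor θ

  private
    -- A search over 1 + 𝔩ᴸ modulo 𝔩ᴸ⁺¹ either finds a nontrivial value, which settles the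
    -- conductor, or allows L to be lowered.
    find-conductor : ∀ {θ} → Multiplicative θ → ∀ L → (∀ u → u K.- K.1# ∈𝔩 + suc L → θ u C.≈ C.1#) → Conductor θ
    find-conductor {θ} mult L triv = conclude L triv (search (+ L) 1 {Trivial} {Nontrivial} invariant decide)
      where
      Trivial Nontrivial : K.Carrier → Set
      -- For L = 0 the element 1 + y may fail to be a unit, hence the shell condition.
      Trivial y    = Shell (+ 0) (K.1# K.+ y) → θ (K.1# K.+ y) C.≈ C.1#
      Nontrivial y = Shell (+ 0) (K.1# K.+ y) × ¬ (θ (K.1# K.+ y) C.≈ C.1#)
      decide : ∀ y → y ∈𝔩 + L → Trivial y ⊎ Nontrivial y
      decide y _ = by (K.shell? (+ 0) (K.1# K.+ y)) (θ (K.1# K.+ y) C.≈? C.1#)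
        where
        by : Dec (Shell (+ 0) (K.1# K.+ y)) → Dec (θ (K.1# K.+ y) C.≈ C.1#) → Trivial y ⊎ Nontrivial y
        by (no ¬sh) _        = inj₁ λ sh → ⊥-elim (¬sh sh)
        by (yes _)  (yes eq) = inj₁ λ _ → eq
        by (yes sh) (no ¬eq) = inj₂ (sh , ¬eq)
      invariant : ∀ y z → y K.- z ∈𝔩 + L ℤ.+ + 1 → Trivial y → Trivial z
      invariant y z d∈ ty sz = C.trans (C.sym (locally-constant⇒ mult triv (K.shell⇒≉0 sy) sz (K.∈-≡ (≡.sym (ℤ.+-identityˡ (+ suc L))) close))) (ty sy)
        where
        close : (K.1# K.+ y) K.- (K.1# K.+ z) ∈𝔩 + suc L
        close = K.∈-≡ (ℤ.+-comm (+ L) (+ 1)) (K.∈-cong (SK.solve 2 (λ y z → y SK.:- z SK.:= (SK.con (+ 1) SK.:+ y) SK.:- (SK.con (+ 1) SK.:+ z)) K.refl y z) d∈)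
        sy : Shell (+ 0) (K.1# K.+ y)
        sy = K.shell-perturb sz (ℤ.+<+ (ℕ.s≤s ℕ.z≤n)) close
      1+[u-1] : ∀ u → K.1# K.+ (u K.- K.1#) K.≈ u
      1+[u-1] u = SK.solve 1 (λ u → SK.con (+ 1) SK.:+ (u SK.:- SK.con (+ 1)) SK.:= u) K.refl u
      conclude : ∀ L → (∀ u → u K.- K.1# ∈𝔩 + suc L → θ u C.≈ C.1#) →
        (∀ y → y ∈𝔩 + L → Trivial y) ⊎ (∃[ y ] y ∈𝔩 + L × Nontrivial y) → Conductor θ
      conclude L triv (inj₂ (y , y∈ , sh , ≉1)) = ramified L triv (K.1# K.+ y) sh
        (K.∈-cong (SK.solve 1 (λ y → y SK.:= (SK.con (+ 1) SK.:+ y) SK.:- SK.con (+ 1)) K.refl y) y∈) ≉1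
      conclude zero triv (inj₁ all) = unramified λ u su → C.trans (C.sym (θ-cong mult (1+[u-1] u)))
        (all (u K.- K.1#) (K.∈-- (K.shell⇒∈ su) (K.shell⇒∈ (K.unit⇒shell K.v-1))) (K.shell-cong (K.sym (1+[u-1] u)) su))
      conclude (suc L) triv (inj₁ all) = find-conductor mult L λ u d∈ → C.trans (C.sym (θ-cong mult (1+[u-1] u)))
        (all (u K.- K.1#) d∈ (K.shell-cong (K.sym (1+[u-1] u)) (K.shell-perturb (K.unit⇒shell K.v-1) (ℤ.+<+ (ℕ.s≤s ℕ.z≤n)) d∈)))

  abstract
    conductor : ∀ {θ} → Tame θ → Conductor θ
    conductor t = find-conductor (Tame.multiplicative t) (Tame.level t) (Tame.θ-1+𝔩 t)

  δ⁻≤0 : δ⁻ ℤ.≤ + 0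
  δ⁻≤0 = neg-mono {0} {K.δ} ℕ.z≤n

  ψ-periodic-* : ∀ {B ξ} → ξ ∈𝔩 neg B → Periodic ⊤⁺ (+ B) (λ x → ψ (x K.* ξ))
  ψ-periodic-* {B} {ξ} ξ∈ x y d∈ = C.Approx.≈⇒~ ⊤⁺ (ψ-periodic (K.∈-mono δ⁻≤0 (K.∈-≡ (ℤ.+-inverseʳ (+ B))
    (K.∈-cong (SK.solve 3 (λ x y ξ → (x SK.:- y) SK.:* ξ SK.:= x SK.:* ξ SK.:- y SK.:* ξ) K.refl x y ξ) (K.∈-* d∈ ξ∈)))))

  ψ-integral : ∀ x → C.Integral (ψ x)
  ψ-integral x = C.unit-integral (v-ψ x)

  ≈⇒periodic : ∀ {b h g} → (∀ x → h x C.≈ g x) → Periodic ⊤⁺ b h → Periodic ⊤⁺ b g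
  ≈⇒periodic h≈g per x y d∈ = C.Approx.≈⇒~ ⊤⁺ (C.trans (C.sym (h≈g x)) (C.trans (C.~⊤⇒≈ (per x y d∈)) (h≈g y)))

  -- Translation by τ permutes the classes and so preserves the sum, yet it multiplies the sum by z.
  riemann-vanishes : ∀ {B h τ z} → Resolved ⊤⁺ B h → τ ∈𝔩 neg B → ¬ (z C.≈ C.1#) →
    (∀ ξ → h (ξ K.+ τ) C.≈ z C.* h ξ) → riemann B h C.≈ C.0#
  riemann-vanishes {B} {h} {τ} {z} res τ∈ z≉1 shift = C.*-≈0 z-1≉0 (C.trans
    (solve 2 (λ z r → (z :- con (+ 1)) :* r := z :* r :- r) C.refl z (riemann B h))
    (C.trans (C.+-congʳ (C.trans (C.sym (riemann-* B z h)) (C.trans (riemann-cong B (λ ξ _ → C.sym (shift ξ)))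
      (C.*-congˡ (C.~⊤⇒≈ (Σ-translate ⊤⁺ (neg B) (B ℕ.+ B) τ∈ (resolved-periodic res))))))) (C.-‿inverseʳ _)))
    where
    z-1≉0 : z C.- C.1# C.≉ C.0#
    z-1≉0 eq = z≉1 (C.trans (solve 1 (λ z → z := (z :- con (+ 1)) :+ con (+ 1)) C.refl z) (C.trans (C.+-congʳ eq) (C.+-identityˡ _)))

  riemann-exact : ∀ {B F I} → ∫ F ≈ I → Resolved ⊤⁺ B F → riemann B F C.≈ I
  riemann-exact int res = C.close⇒≈ λ N → integral-riemann int (weaken res)
    where
    weaken : ∀ {N B F} → Resolved ⊤⁺ B F → Resolved N B F
    weaken (resolved s p) = resolved (λ x x∉ → ⁺-trans (_ ≤⊤⁺) (s x x∉)) (λ x y d∈ → ⁺-trans (_ ≤⊤⁺) (p x y d∈))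

  resolved-weaken : ∀ {N B F} → Resolved ⊤⁺ B F → Resolved N B F
  resolved-weaken (resolved s p) = resolved (λ x x∉ → ⁺-trans (_ ≤⊤⁺) (s x x∉)) (λ x y d∈ → ⁺-trans (_ ≤⊤⁺) (p x y d∈))

  module _ {B : ℕ} {k : ℤ} {x : K.Carrier} (|k|≤B : ℤ.∣ k ∣ ℕ.≤ B) (x∈ : x ∈𝔩 neg B) where
    private
      bounds = ∣n∣-bounds {k} |k|≤B
      h : Fun
      h ξ = indicator K.0# k ξ C.* ψ (x K.* ξ)
      res-ind : Resolved ⊤⁺ B (indicator K.0# k)
      res-ind = indicator-resolved K.0∈ (proj₁ bounds) (proj₂ bounds) ⊤⁺

    ball-resolved : Resolved ⊤⁺ B h
    ball-resolved = resolved-product res-ind (λ ξ → ψ-integral (x K.* ξ))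
      (≈⇒periodic (λ ξ → ψ-cong (K.*-comm ξ x)) (ψ-periodic-* x∈))

    ball-trivial : x ∈𝔩 δ⁻ ℤ.- k → riemann B h C.≈ κ k
    ball-trivial x∈δ = C.trans (riemann-cong B (λ ξ _ → by ξ (ξ K.- K.0# K.∈𝔩? k)))
      (riemann-indicator K.0∈ (proj₁ bounds) (proj₂ bounds))
      where
      cancel : ∀ d k → d ℤ.- k ℤ.+ k ≡ d
      cancel = ℤ-Ring.solve-∀
      by : ∀ ξ → Dec (ξ K.- K.0# ∈𝔩 k) → h ξ C.≈ indicator K.0# k ξ
      by ξ (no ξ∉)  = C.trans (C.*-congʳ (indicator-∉ ξ∉)) (C.trans (C.zeroˡ _) (C.sym (indicator-∉ ξ∉)))
      by ξ (yes ξ∈) = C.trans (C.*-congˡ (ψ-trivial (K.∈-≡ (cancel δ⁻ k) (K.∈-* x∈δ (K.∈--0⁻¹ ξ∈))))) (C.*-identityʳ _)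

    ball-vanishes : ¬ (x ∈𝔩 δ⁻ ℤ.- k) → riemann B h C.≈ C.0#
    ball-vanishes x∉ = let τ , τ∈ , ψ≉1 = ψ-nontrivial k x∉ in
      riemann-vanishes ball-resolved (K.∈-mono (proj₁ bounds) τ∈) ψ≉1 λ ξ → C.trans
        (C.*-cong (indicator-≈ {K.0#} {K.0#} {k} (K.∈-cong (SK.solve 2 (λ ξ τ → τ SK.:= ((ξ SK.:+ τ) SK.:- SK.con (+ 0)) SK.:- (ξ SK.:- SK.con (+ 0))) K.refl ξ τ) τ∈))
          (C.trans (ψ-cong (K.distribˡ x ξ τ)) (ψ-+ (x K.* ξ) (x K.* τ))))
        (solve 3 (λ i a b → i :* (a :* b) := b :* (i :* a)) C.refl (indicator K.0# k ξ) (ψ (x K.* ξ)) (ψ (x K.* τ)))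

    -- Orthogonality: ξ ↦ ψ(x ξ) is trivial on 𝔩ᵏ exactly when x lies in the dual ideal, whose
    -- exponent is δ⁻ - k.
    ball : riemann B h C.≈ κ k C.* indicator K.0# (δ⁻ ℤ.- k) x
    ball = by (x K.- K.0# K.∈𝔩? δ⁻ ℤ.- k)
      where
      by : Dec (x K.- K.0# ∈𝔩 δ⁻ ℤ.- k) → riemann B h C.≈ κ k C.* indicator K.0# (δ⁻ ℤ.- k) x
      by (yes x∈δ) = C.trans (ball-trivial (K.∈--0⁻¹ x∈δ)) (C.sym (C.trans (C.*-congˡ (indicator-∈ x∈δ)) (C.*-identityʳ _)))
      by (no x∉)   = C.trans (ball-vanishes (λ x∈δ → x∉ (K.∈--0 x∈δ))) (C.sym (C.trans (C.*-congˡ (indicator-∉ x∉)) (C.zeroʳ _)))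

  module Gauss {θ : Fun} (t : Tame θ) where
    open Tame t

    twist : ℤ → K.Carrier → Fun
    twist n x ξ = onShell θ n ξ C.* ψ (x K.* ξ)

    resolved-onShell⊤ : ∀ n {B} → shell-precision t n ℕ.≤ B → Resolved ⊤⁺ B (onShell θ n)
    resolved-onShell⊤ n le = resolved
      (λ ξ ξ∉ → C.≈0⇒≤v (onShell-out θ (λ sξ → ξ∉ (K.∈-mono (proj₁ (∣n∣-bounds {n} (ℕ.≤-trans (ℕ.m≤m+n _ _) le))) (K.shell⇒∈ sξ)))))
      (onShell-periodic t n (shell-precision-≤ t n le))

    twist-resolved : ∀ n {x B} → shell-precision t n ℕ.≤ B → x ∈𝔩 neg B → Resolved ⊤⁺ B (twist n x)
    twist-resolved n {x} le x∈ = resolved-product (resolved-onShell⊤ n le) (λ ξ → ψ-integral (x K.* ξ))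
      (≈⇒periodic (λ ξ → ψ-cong (K.*-comm ξ x)) (ψ-periodic-* x∈))

    abstract
      precision : ∀ n x → ∃[ B ] shell-precision t n ℕ.≤ B × x ∈𝔩 neg B
      precision n x = let B , h = ∈-eventually x in
        shell-precision t n ℕ.+ B , ℕ.m≤m+n _ B , h _ (ℕ.m≤n+m B _)

    abstract
      Γ-exists : ∀ n x → ∃[ I ] ∫ twist n x ≈ I
      Γ-exists n x = integral-exists λ N → let B , le , x∈ = precision n x in B , resolved-weaken (twist-resolved n le x∈)

    -- The Fourier transform of θ restricted to πⁿ𝔬^×, whose values in the ramified case are Gauss
    -- sums.
    Γ : ℤ → K.Carrier → C.Carrier
    Γ n x = proj₁ (Γ-exists n x)

    Γ-riemann : ∀ n {x B} → shell-precision t n ℕ.≤ B → x ∈𝔩 neg B → riemann B (twist n x) C.≈ Γ n x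
    Γ-riemann n {x} le x∈ = riemann-exact (proj₂ (Γ-exists n x)) (twist-resolved n le x∈)

    Γ-cong : ∀ n {x y} → x K.≈ y → Γ n x C.≈ Γ n y
    Γ-cong n {x} {y} x≈y = let B , le , x∈ = precision n x in C.trans (C.sym (Γ-riemann n le x∈))
      (C.trans (riemann-cong B (λ ξ _ → C.*-congˡ (ψ-cong (K.*-congʳ x≈y)))) (Γ-riemann n le (K.∈-cong x≈y x∈)))

    onShell-unit : ∀ {n u} → Shell (+ 0) u → ∀ ξ → onShell θ n (u K.* ξ) C.≈ θ u C.* onShell θ n ξ
    onShell-unit {n} {u} su ξ = by (onShell-cases θ n ξ)
      where
      back : Shell n (u K.* ξ) → Shell n ξ
      back s = K.shell-cong (K.trans (K.sym (K.*-assoc _ _ _)) (K.trans (K.*-congʳ (K.inverseˡ (K.shell⇒≉0 su))) (K.*-identityˡ ξ)))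
        (K.shell-≡ (ℤ.+-identityˡ n) (K.shell-* (K.shell-inv su) s))
      by : _ → onShell θ n (u K.* ξ) C.≈ θ u C.* onShell θ n ξ
      by (inj₁ (sξ , eq))  = C.trans (onShell-in θ (K.shell-≡ (ℤ.+-identityˡ n) (K.shell-* su sξ)))
        (C.trans (θ-* multiplicative (K.shell⇒≉0 su) (K.shell⇒≉0 sξ)) (C.*-congˡ (C.sym eq)))
      by (inj₂ (¬sξ , eq)) = C.trans (onShell-out θ (λ s → ¬sξ (back s))) (C.sym (C.trans (C.*-congˡ eq) (C.zeroʳ _)))

    -- The substitution ξ ↦ u ξ preserves the shell and the measure.
    Γ-unit : ∀ n {u} → Shell (+ 0) u → ∀ x → θ u C.* Γ n (u K.* x) C.≈ Γ n x
    Γ-unit n {u} su x = at (precision n x)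
     where
     open import Relation.Binary.Reasoning.Setoid C.setoid
     vu = K.shell⇒unit su
     at : (∃[ B ] shell-precision t n ℕ.≤ B × x ∈𝔩 neg B) → θ u C.* Γ n (u K.* x) C.≈ Γ n x
     at (B , le , x∈) = begin
      θ u C.* Γ n (u K.* x)                              ≈⟨ C.*-congˡ (Γ-riemann n {u K.* x} {B} le (K.unit-∈ vu x∈)) ⟨
      θ u C.* riemann B (twist n (u K.* x))              ≈⟨ riemann-* B (θ u) _ ⟨
      riemann B (λ ξ → θ u C.* twist n (u K.* x) ξ)      ≈⟨ riemann-cong B (λ ξ _ → C.trans (C.sym (C.*-assoc _ _ _))
                                                              (C.*-cong (C.sym (onShell-unit su ξ)) (ψ-cong (SK.solve 3 (λ u x ξ → (u SK.:* x) SK.:* ξ SK.:= x SK.:* (u SK.:* ξ)) K.refl u x ξ)))) ⟩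
      riemann B (λ ξ → twist n x (u K.* ξ))              ≈⟨ C.*-congˡ (C.~⊤⇒≈ (Σ-unit ⊤⁺ (neg B) (B ℕ.+ B) {twist n x} {u} vu (resolved-periodic (twist-resolved n le x∈)))) ⟩
      riemann B (twist n x)                              ≈⟨ Γ-riemann n {x} {B} le x∈ ⟩
      Γ n x                                              ∎

    onShell-π : ∀ n ξ → onShell θ (ℤ.suc n) (proj₁ K.π K.* ξ) C.≈ onShell θ n ξ
    onShell-π n ξ = by (onShell-cases θ n ξ)
      where
      cancel : ∀ n → ℤ.- (+ 1) ℤ.+ (+ 1 ℤ.+ n) ≡ n
      cancel = ℤ-Ring.solve-∀
      back : Shell (ℤ.suc n) (proj₁ K.π K.* ξ) → Shell n ξ
      back s = K.shell-cong (K.trans (K.sym (K.*-assoc _ _ _)) (K.trans (K.*-congʳ (K.inverseˡ (proj₂ K.π))) (K.*-identityˡ ξ)))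
        (K.shell-≡ (cancel n) (K.shell-* (K.shell-inv K.shell-π) s))
      by : _ → onShell θ (ℤ.suc n) (proj₁ K.π K.* ξ) C.≈ onShell θ n ξ
      by (inj₁ (sξ , eq))  = C.trans (onShell-in θ (K.shell-* K.shell-π sξ))
        (C.trans (θ-* multiplicative (proj₂ K.π) (K.shell⇒≉0 sξ)) (C.trans (C.*-congʳ θ-π) (C.trans (C.*-identityˡ _) (C.sym eq))))
      by (inj₂ (¬sξ , eq)) = C.trans (onShell-out θ (λ s → ¬sξ (back s))) (C.sym eq)

    -- Multiplication by π carries 𝔩^(-B-1)/𝔩^(B+1) to 𝔩^(-B)/𝔩^(B+2). This is two levels finer than
    -- h requires, which gives a factor q², and the volume of a class absorbs one q.
    riemann-π : ∀ B {h} → Resolved ⊤⁺ B h → riemann (suc B) (λ ξ → h (proj₁ K.π K.* ξ)) C.≈ q′ C.* riemann B h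
    riemann-π B {h} res = begin
      κ (+ suc B) C.* Σ𝔩 (neg (suc B)) (suc B ℕ.+ suc B) (λ ξ → h (proj₁ K.π K.* ξ))
        ≈⟨ C.*-congˡ (Σ-cong (neg (suc B)) (suc B ℕ.+ suc B) (λ ξ _ → h-cong {proj₁ K.π K.* ξ} {K.π^ (+ 1) K.* ξ} (K.*-congʳ (K.sym (K.*-identityʳ (proj₁ K.π)))))) ⟩
      κ (+ suc B) C.* Σ𝔩 (neg (suc B)) (suc B ℕ.+ suc B) (λ ξ → h (K.π^ (+ 1) K.* ξ))
        ≈⟨ C.*-congˡ (Σ-π (+ 1) (neg (suc B)) (suc B ℕ.+ suc B) h-cong) ⟨
      κ (+ suc B) C.* Σ𝔩 (+ 1 ℤ.+ neg (suc B)) (suc B ℕ.+ suc B) h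
        ≡⟨ ≡.cong₂ (λ a n → κ (+ suc B) C.* Σ𝔩 a n h) (1-suc (+ B)) (≡.cong suc (ℕ.+-suc B B)) ⟩
      κ (+ suc B) C.* Σ𝔩 (neg B) (suc (suc (B ℕ.+ B))) h
        ≈⟨ C.*-congˡ (C.trans (C.~⊤⇒≈ (Σ-refine ⊤⁺ (neg B) (suc (B ℕ.+ B)) (λ x y d∈ → per x y (K.∈-mono (ℤ.+-monoʳ-≤ (neg B) (ℤ.+≤+ (ℕ.n≤1+n _))) d∈))))
             (C.*-congˡ (C.~⊤⇒≈ (Σ-refine ⊤⁺ (neg B) (B ℕ.+ B) per)))) ⟩
      κ (+ suc B) C.* (q′ C.* (q′ C.* Σ𝔩 (neg B) (B ℕ.+ B) h))
        ≈⟨ solve 3 (λ k q s → k :* (q :* (q :* s)) := q :* ((k :* q) :* s)) C.refl (κ (+ suc B)) q′ _ ⟩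
      q′ C.* (κ (+ suc B) C.* q′ C.* Σ𝔩 (neg B) (B ℕ.+ B) h)
        ≈⟨ C.*-congˡ (C.*-congʳ (κ-suc (+ B))) ⟩
      q′ C.* riemann B h ∎
      where
      open import Relation.Binary.Reasoning.Setoid C.setoid
      per = resolved-periodic res
      h-cong : ∀ {x y} → x K.≈ y → h x C.≈ h y
      h-cong x≈y = C.~⊤⇒≈ (per _ _ (K.mem (K.≈0⇒≤v (K.trans (K.+-congʳ x≈y) (K.-‿inverseʳ _)))))
      1-suc : ∀ b → + 1 ℤ.+ ℤ.- (+ 1 ℤ.+ b) ≡ ℤ.- b
      1-suc = ℤ-Ring.solve-∀

    -- The substitution ξ ↦ π ξ raises the order of the shell by one, rescales the measure by q and
    -- leaves θ alone because θ(π) = 1.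
    Γ-π : ∀ n x → Γ n (proj₁ K.π K.* x) C.≈ q′ C.* Γ (ℤ.suc n) x
    Γ-π n x = begin
      Γ n (proj₁ K.π K.* x)                                    ≈⟨ Γ-riemann n (ℕ.≤-trans (proj₁ (proj₂ P)) (ℕ.≤-trans (ℕ.m≤m+n B₁ B₂) (ℕ.n≤1+n _)))
                                                                   (K.∈-mono (neg-mono {B₁} {suc B} (ℕ.≤-trans (ℕ.m≤m+n B₁ B₂) (ℕ.n≤1+n _))) (proj₂ (proj₂ P))) ⟨
      riemann (suc B) (twist n (proj₁ K.π K.* x))              ≈⟨ riemann-cong (suc B) (λ ξ _ → C.*-cong (C.sym (onShell-π n ξ))
                                                                   (ψ-cong (SK.solve 3 (λ u x ξ → (u SK.:* x) SK.:* ξ SK.:= x SK.:* (u SK.:* ξ)) K.refl (proj₁ K.π) x ξ))) ⟩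
      riemann (suc B) (λ ξ → twist (ℤ.suc n) x (proj₁ K.π K.* ξ)) ≈⟨ riemann-π B (twist-resolved (ℤ.suc n) le′ x∈′) ⟩
      q′ C.* riemann B (twist (ℤ.suc n) x)                     ≈⟨ C.*-congˡ (Γ-riemann (ℤ.suc n) le′ x∈′) ⟩
      q′ C.* Γ (ℤ.suc n) x                                     ∎
      where
      open import Relation.Binary.Reasoning.Setoid C.setoid
      P = precision n (proj₁ K.π K.* x)
      P′ = precision (ℤ.suc n) x
      B₁ = proj₁ P
      B₂ = proj₁ P′
      B = B₁ ℕ.+ B₂
      le′ : shell-precision t (ℤ.suc n) ℕ.≤ B
      le′ = ℕ.≤-trans (proj₁ (proj₂ P′)) (ℕ.m≤n+m B₂ B₁)
      x∈′ : x ∈𝔩 neg B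
      x∈′ = K.∈-mono (neg-mono (ℕ.m≤n+m B₂ B₁)) (proj₂ (proj₂ P′))

    -- For θ of conductor 𝔩^(m+1), Γ n is supported on the shell of order
    -- -(n + m + 1 + δ).
    module Ramified (m : ℕ) (triv : ∀ u → u K.- K.1# ∈𝔩 + suc m → θ u C.≈ C.1#)
                    (u₀ : K.Carrier) (su₀ : Shell (+ 0) u₀) (u₀∈ : u₀ K.- K.1# ∈𝔩 + m) (θu₀≉1 : ¬ (θ u₀ C.≈ C.1#)) where

      order : ℤ → ℤ
      order n = δ⁻ ℤ.- (n ℤ.+ + suc m)

      -- For such x, replacing x by u₀ x changes x ξ by an element of the inverse different, so Γ
      -- takes the same value at u₀ x as at x. By `Γ-unit` the two values differ by the factor
      -- θ(u₀), which is not 1.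
      Γ-near-0 : ∀ n {x} → x ∈𝔩 ℤ.suc (order n) → Γ n x C.≈ C.0#
      Γ-near-0 n {x} x∈ = C.*-≈0 θ-1≉0 (C.trans
        (solve 2 (λ z r → (z :- con (+ 1)) :* r := z :* r :- r) C.refl (θ u₀) (Γ n x))
        (C.trans (C.+-congʳ (C.trans (C.*-congˡ (C.sym same)) (Γ-unit n su₀ x))) (C.-‿inverseʳ _)))
        where
        θ-1≉0 : θ u₀ C.- C.1# C.≉ C.0#
        θ-1≉0 eq = θu₀≉1 (C.trans (solve 1 (λ z → z := (z :- con (+ 1)) :+ con (+ 1)) C.refl (θ u₀)) (C.trans (C.+-congʳ eq) (C.+-identityˡ _)))
        P = precision n x
        exponent : ∀ d n m → + 1 ℤ.+ (d ℤ.- (n ℤ.+ (+ 1 ℤ.+ m))) ℤ.+ (m ℤ.+ n) ≡ d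
        exponent = ℤ-Ring.solve-∀
        same-twist : ∀ ξ → twist n (u₀ K.* x) ξ C.≈ twist n x ξ
        same-twist ξ = by (onShell-cases θ n ξ)
          where
          by : _ → twist n (u₀ K.* x) ξ C.≈ twist n x ξ
          by (inj₁ (sξ , _)) = C.*-congˡ (ψ-periodic (K.∈-≡ (exponent δ⁻ n (+ m))
            (K.∈-cong (SK.solve 3 (λ x u ξ → x SK.:* ((u SK.:- SK.con (+ 1)) SK.:* ξ) SK.:= (u SK.:* x) SK.:* ξ SK.:- x SK.:* ξ) K.refl x u₀ ξ)
              (K.∈-* x∈ (K.∈-* u₀∈ (K.shell⇒∈ sξ))))))
          by (inj₂ (_ , eq)) = C.trans (C.trans (C.*-congʳ eq) (C.zeroˡ _)) (C.sym (C.trans (C.*-congʳ eq) (C.zeroˡ _)))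
        same : Γ n (u₀ K.* x) C.≈ Γ n x
        same = C.trans (C.sym (Γ-riemann n (proj₁ (proj₂ P)) (K.unit-∈ (K.shell⇒unit su₀) (proj₂ (proj₂ P)))))
          (C.trans (riemann-cong (proj₁ P) (λ ξ _ → same-twist ξ)) (Γ-riemann n (proj₁ (proj₂ P)) (proj₂ (proj₂ P))))

      onShell-translate : ∀ n {τ} → τ ∈𝔩 n ℤ.+ + suc m → ∀ ξ → onShell θ n (ξ K.+ τ) C.≈ onShell θ n ξ
      onShell-translate n {τ} τ∈ ξ = by (onShell-cases θ n (ξ K.+ τ)) (onShell-cases θ n ξ)
        where
        d∈ : (ξ K.+ τ) K.- ξ ∈𝔩 n ℤ.+ + suc m
        d∈ = K.∈-cong (SK.solve 2 (λ ξ τ → τ SK.:= (ξ SK.:+ τ) SK.:- ξ) K.refl ξ τ) τ∈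
        flip : ξ K.- (ξ K.+ τ) ∈𝔩 n ℤ.+ + suc m
        flip = K.∈-cong (SK.solve 2 (λ ξ τ → SK.:- τ SK.:= ξ SK.:- (ξ SK.:+ τ)) K.refl ξ τ) (K.∈-neg τ∈)
        by : _ → _ → onShell θ n (ξ K.+ τ) C.≈ onShell θ n ξ
        by (inj₁ (sx , ex))  (inj₁ (sy , ey))  = C.trans ex (C.trans (locally-constant⇒ multiplicative triv (K.shell⇒≉0 sx) sy d∈) (C.sym ey))
        by (inj₁ (sx , _))   (inj₂ (¬sy , _))  = ⊥-elim (¬sy (K.shell-perturb sx (i<i+suc[n] n m) flip))
        by (inj₂ (¬sx , _))  (inj₁ (sy , _))   = ⊥-elim (¬sx (K.shell-perturb sy (i<i+suc[n] n m) d∈))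
        by (inj₂ (_ , ex))   (inj₂ (_ , ey))   = C.trans ex (C.sym ey)

      -- Translating ξ by some τ of order at least n + m + 1 leaves θ on the shell unchanged and
      -- multiplies ψ(x ξ) by ψ(x τ), and τ can be chosen with ψ(x τ) different from 1.
      Γ-near-∞ : ∀ n {x} → ¬ (x ∈𝔩 order n) → Γ n x C.≈ C.0#
      Γ-near-∞ n {x} x∉ =
        let τ , τ∈ , ψ≉1 = ψ-nontrivial (n ℤ.+ + suc m) x∉
            B₁ , le , x∈ = precision n x
            B₂ , τ∈′ = ∈-eventually τ
            B = B₁ ℕ.+ B₂
            le′ = ℕ.≤-trans le (ℕ.m≤m+n B₁ B₂)
            x∈′ = K.∈-mono (neg-mono (ℕ.m≤m+n B₁ B₂)) x∈
        in C.trans (C.sym (Γ-riemann n le′ x∈′)) (riemann-vanishes (twist-resolved n le′ x∈′) (τ∈′ B (ℕ.m≤n+m B₂ B₁)) ψ≉1 λ ξ →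
          C.trans (C.*-cong (onShell-translate n τ∈ ξ) (C.trans (ψ-cong (K.distribˡ x ξ τ)) (ψ-+ (x K.* ξ) (x K.* τ))))
            (solve 3 (λ i a b → i :* (a :* b) := b :* (i :* a)) C.refl (onShell θ n ξ) (ψ (x K.* ξ)) (ψ (x K.* τ))))

      -- The Gauss sum of θ at level n: by `Γ-shell` it is the value of the product θ Γ on the whole
      -- supporting shell.
      constant : ℤ → C.Carrier
      constant n = Γ n (K.π^ (order n))

      Γ-shell : ∀ n {x} → Shell (order n) x → θ x C.* Γ n x C.≈ constant n
      Γ-shell n {x} sx = C.trans (C.*-cong θx≈ (Γ-cong n x≈)) (Γ-unit n su (K.π^ (order n)))
        where
        u = x K.* K.π^ (ℤ.- order n)
        su = unit-part sx
        x≈ : x K.≈ u K.* K.π^ (order n)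
        x≈ = K.sym (K.trans (K.*-assoc x _ _) (K.trans (K.*-congˡ (K.trans (K.*-comm _ _) (K.π^-inverse (order n)))) (K.*-identityʳ x)))
        θx≈ : θ x C.≈ θ u
        θx≈ = C.trans (unit-factor multiplicative sx) (C.trans (C.*-congˡ (C.trans (C.^ℤ-cong θ-π (order n)) (1^ℤ (order n)))) (C.*-identityʳ _))

      Γ-cases : ∀ n x → Γ n x C.≈ constant n C.* onShell (invert θ) (order n) x
      Γ-cases n x = by (onShell-cases (invert θ) (order n) x)
        where
        outside : ¬ Shell (order n) x → Dec (x ∈𝔩 order n) → Dec (x ∈𝔩 ℤ.suc (order n)) → Γ n x C.≈ C.0#
        outside ¬s (no x∉)  _         = Γ-near-∞ n x∉
        outside ¬s (yes x∈) (yes x∈′) = Γ-near-0 n x∈′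
        outside ¬s (yes x∈) (no x∉′)  = ⊥-elim (¬s (K.∈∧∉⇒shell x∈ x∉′))
        by : _ → Γ n x C.≈ constant n C.* onShell (invert θ) (order n) x
        by (inj₁ (sx , eq))  = C.*-cancelˡ (θ-≉0 multiplicative x≉0) (C.trans (Γ-shell n sx) (C.sym (C.trans
          (solve 3 (λ a c i → a :* (c :* i) := c :* (a :* i)) C.refl (θ x) (constant n) _)
          (C.trans (C.*-congˡ (C.trans (C.*-congˡ (C.trans eq (invert-at θ x≉0))) (C.inverse _ (θ-≉0 multiplicative x≉0)))) (C.*-identityʳ _)))))
          where x≉0 = K.shell⇒≉0 sx
        by (inj₂ (¬sx , eq)) = C.trans (outside ¬sx (x K.∈𝔩? order n) (x K.∈𝔩? ℤ.suc (order n))) (C.sym (C.trans (C.*-congˡ eq) (C.zeroʳ _)))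

      constant-suc : ∀ n → constant n C.≈ q′ C.* constant (ℤ.suc n)
      constant-suc n = C.trans (C.reflexive (≡.cong (λ k → Γ n (K.π^ k)) (order-suc δ⁻ n (+ suc m))))
        (C.trans (Γ-cong n (K.^ℤ-suc (proj₂ K.π) (order (ℤ.suc n)))) (Γ-π n (K.π^ (order (ℤ.suc n)))))
        where
        order-suc : ∀ d n m → d ℤ.- (n ℤ.+ m) ≡ + 1 ℤ.+ (d ℤ.- (+ 1 ℤ.+ n ℤ.+ m))
        order-suc = ℤ-Ring.solve-∀

      -- This accounts for the power of q in eₙ: once it is included, the Gauss sum no longer
      -- depends on the shell.
      constant-^ : ∀ n → constant n C.* q′ C.^ℤ n C.≈ constant (+ 0)
      constant-^ (+ zero)       = C.*-identityʳ _
      constant-^ (+ suc n)      = C.trans (solve 3 (λ c q x → c :* (q :* x) := (q :* c) :* x) C.refl (constant (+ suc n)) q′ (q′ C.^ n))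
        (C.trans (C.*-congʳ (C.sym (constant-suc (+ n)))) (constant-^ (+ n)))
      constant-^ -[1+ n ]       = C.trans (C.*-cong (constant-suc -[1+ n ]) C.refl) (C.trans
        (solve 4 (λ q c i x → (q :* c) :* (i :* x) := (q :* i) :* (c :* x)) C.refl q′ (constant (ℤ.suc -[1+ n ])) (C.inv q′) (C.inv q′ C.^ n))
        (C.trans (C.*-cong (C.inverse q′ (C.v≡[]⇒≉0 C-v-q)) (C.*-congˡ (inv-power n))) (C.trans (C.*-identityˡ _) (rest n))))
        where
        inv-power : ∀ n → C.inv q′ C.^ n C.≈ q′ C.^ℤ (ℤ.suc -[1+ n ])
        inv-power zero    = C.refl
        inv-power (suc n) = C.refl
        rest : ∀ n → constant (ℤ.suc -[1+ n ]) C.* q′ C.^ℤ (ℤ.suc -[1+ n ]) C.≈ constant (+ 0)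
        rest zero    = constant-^ (+ 0)
        rest (suc n) = constant-^ -[1+ n ]

      constant-integral : ∀ n → C.Integral (constant n)
      constant-integral n = let B , le , x∈ = precision n (K.π^ (order n)) in
        C.≤v-resp (Γ-riemann n le x∈) (riemann-≤v B (λ ξ _ → C.integral-* (onShell-integral t n ξ) (ψ-integral (K.π^ (order n) K.* ξ))))

      -- If the Gauss sum vanished, so would every value of the Fourier
      -- transform Γ 0 of θ · 1_{𝔬^×}, contradicting Fourier inversion at 1.
      constant≉0 : constant (+ 0) C.≉ C.0#
      constant≉0 c≈0 = at (shell-precision t (+ 0) ℕ.+ ℤ.∣ k ∣ ℕ.+ suc m)
       (ℕ.≤-trans (ℕ.m≤m+n (shell-precision t (+ 0)) ℤ.∣ k ∣) (ℕ.m≤m+n _ (suc m)))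
       (ℕ.≤-trans (ℕ.m≤n+m ℤ.∣ k ∣ (shell-precision t (+ 0))) (ℕ.m≤m+n _ (suc m)))
       (ℕ.m≤n+m (suc m) (shell-precision t (+ 0) ℕ.+ ℤ.∣ k ∣))
       where
       -- With this k the transform of the indicator of 𝔩ᵏ is κ(k) times the indicator of 𝔩^(m+1).
       -- Evaluated at ξ - 1 it detects 1 + 𝔩^(m+1), where θ = 1, so θ on the unit shell may be
       -- inserted; interchanging the integrals then makes the inner one a multiple of Γ 0 x.
       k = δ⁻ ℤ.- + suc m
       at : ∀ B → shell-precision t (+ 0) ℕ.≤ B → ℤ.∣ k ∣ ℕ.≤ B → suc m ℕ.≤ B → ⊥
       at B le k≤B m≤B = C.*-≉0 (C.v≡[]⇒≉0 (v-κ k)) (C.v≡[]⇒≉0 (v-κ (+ suc m))) (begin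
        κ k C.* κ (+ suc m)
          ≈⟨ C.*-congˡ (riemann-indicator 1∈ (proj₁ m-bounds) (proj₂ m-bounds)) ⟨
        κ k C.* riemann B (indicator K.1# (+ suc m))
          ≈⟨ riemann-* B (κ k) _ ⟨
        riemann B (λ ξ → κ k C.* indicator K.1# (+ suc m) ξ)
          ≈⟨ riemann-cong B (λ ξ ξ∈ → inner ξ ξ∈) ⟩
        riemann B (λ ξ → riemann B (λ x → onShell θ (+ 0) ξ C.* (indicator K.0# k x C.* ψ ((ξ K.- K.1#) K.* x))))
          ≈⟨ riemann-swap B B _ ⟩
        riemann B (λ x → riemann B (λ ξ → onShell θ (+ 0) ξ C.* (indicator K.0# k x C.* ψ ((ξ K.- K.1#) K.* x))))
          ≈⟨ riemann-cong B (λ x x∈ → outer x x∈) ⟩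
        riemann B (λ _ → C.0#)
          ≈⟨ riemann-0 B ⟩
        C.0# ∎)
        where
        open import Relation.Binary.Reasoning.Setoid C.setoid
        m-bounds = ∣n∣-bounds {+ suc m} {B} m≤B
        1∈ : K.1# ∈𝔩 neg B
        1∈ = K.∈-mono (neg-mono {0} {B} ℕ.z≤n) (K.shell⇒∈ (K.unit⇒shell K.v-1))
        δ⁻-k : ∀ d m → d ℤ.- (d ℤ.- m) ≡ m
        δ⁻-k = ℤ-Ring.solve-∀
        on-1+𝔩 : ∀ ξ → Dec (ξ K.- K.1# ∈𝔩 + suc m) → indicator K.1# (+ suc m) ξ C.≈ onShell θ (+ 0) ξ C.* indicator K.1# (+ suc m) ξ
        on-1+𝔩 ξ (no ξ∉)  = C.trans (indicator-∉ ξ∉) (C.sym (C.trans (C.*-congˡ (indicator-∉ ξ∉)) (C.zeroʳ _)))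
        on-1+𝔩 ξ (yes ξ∈) = C.sym (C.trans (C.*-congʳ (C.trans (onShell-in θ (K.shell-perturb (K.unit⇒shell K.v-1) (ℤ.+<+ (ℕ.s≤s ℕ.z≤n)) ξ∈)) (triv ξ ξ∈))) (C.*-identityˡ _))
        inner : ∀ ξ → ξ ∈𝔩 neg B → κ k C.* indicator K.1# (+ suc m) ξ C.≈
          riemann B (λ x → onShell θ (+ 0) ξ C.* (indicator K.0# k x C.* ψ ((ξ K.- K.1#) K.* x)))
        inner ξ ξ∈ = C.trans (C.*-congˡ (on-1+𝔩 ξ (ξ K.- K.1# K.∈𝔩? + suc m)))
          (C.trans (solve 3 (λ k o i → k :* (o :* i) := o :* (k :* i)) C.refl (κ k) (onShell θ (+ 0) ξ) _)
          (C.trans (C.*-congˡ (C.trans (C.*-congˡ (C.trans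
              (indicator-≈ {K.1#} {K.0#} {+ suc m} {ξ} {ξ K.- K.1#} (K.∈-cong (SK.solve 2 (λ ξ o → SK.con (+ 0) SK.:= (ξ SK.:- o) SK.:- ((ξ SK.:- o) SK.:- SK.con (+ 0))) K.refl ξ K.1#) K.0∈))
              (C.reflexive (≡.cong (λ j → indicator K.0# j (ξ K.- K.1#)) (≡.sym (δ⁻-k δ⁻ (+ suc m)))))))
            (C.sym (ball {B} {k} {ξ K.- K.1#} k≤B (K.∈-- ξ∈ 1∈)))))
          (C.sym (riemann-* B (onShell θ (+ 0) ξ) _))))
        outer : ∀ x → x ∈𝔩 neg B → riemann B (λ ξ → onShell θ (+ 0) ξ C.* (indicator K.0# k x C.* ψ ((ξ K.- K.1#) K.* x))) C.≈ C.0#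
        outer x x∈ = begin
          riemann B (λ ξ → onShell θ (+ 0) ξ C.* (indicator K.0# k x C.* ψ ((ξ K.- K.1#) K.* x)))
            ≈⟨ riemann-cong B (λ ξ _ → C.trans (C.*-congˡ (C.*-congˡ (C.trans
                 (ψ-cong (SK.solve 3 (λ ξ x o → (ξ SK.:- o) SK.:* x SK.:= x SK.:* ξ SK.:+ SK.:- (o SK.:* x)) K.refl ξ x K.1#)) (ψ-+ (x K.* ξ) (K.- (K.1# K.* x))))))
                 (solve 4 (λ o i a b → o :* (i :* (a :* b)) := (i :* b) :* (o :* a)) C.refl (onShell θ (+ 0) ξ) (indicator K.0# k x) (ψ (x K.* ξ)) (ψ (K.- (K.1# K.* x))))) ⟩
          riemann B (λ ξ → (indicator K.0# k x C.* ψ (K.- (K.1# K.* x))) C.* twist (+ 0) x ξ)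
            ≈⟨ riemann-* B _ _ ⟩
          (indicator K.0# k x C.* ψ (K.- (K.1# K.* x))) C.* riemann B (twist (+ 0) x)
            ≈⟨ C.*-congˡ (C.trans (Γ-riemann (+ 0) le x∈) (C.trans (Γ-cases (+ 0) x) (C.trans (C.*-congʳ c≈0) (C.zeroˡ _)))) ⟩
          (indicator K.0# k x C.* ψ (K.- (K.1# K.* x))) C.* C.0#
            ≈⟨ C.zeroʳ _ ⟩
          C.0# ∎

-- The relation between the two families of coefficients.

module CoefficientRelation {ℓ p : ℕ} (S : Setting ℓ p) where
  open GaussSums S public
  open Analysis S public using (VanishesAt∞; IsFourierTransform)
  open K using (_∈𝔩_; Shell)

  -- aₙ - b aₙ₋₁ = c (eₙ₋ₖ - d eₙ₋ₖ₊₁), the coefficients of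
  -- (1 - b λ) Σ aₙ λⁿ = c λᵏ (1 - d λ⁻¹) Σ eₙ λⁿ.
  record Ratio : Set where
    constructor ratio
    field
      b c d : C.Carrier
      k     : ℤ

  Related : Ratio → (a e : ℤ → C.Carrier) → Set
  Related (ratio b c d k) a e =
    ∀ n → a n C.- b C.* a (ℤ.pred n) C.≈ c C.* (e (n ℤ.- k) C.- d C.* e (ℤ.suc (n ℤ.- k)))

  module Transform {f f̂ : Fun} (ft : IsFourierTransform f f̂) (f̂-vanishes : VanishesAt∞ f̂) where

    abstract
      f-uniform : Uniform f
      f-uniform N = let B , res = integral-uniform (ft K.0#) N in
        B , resolved-~ (λ x → C.Approx.≈⇒~ [ N ] (C.trans (C.*-congˡ (ψ-trivial (K.∈-cong (K.sym (K.zeroʳ x)) K.0∈))) (C.*-identityʳ _))) res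

    f̂-riemann : ∀ {N B ξ} → Resolved [ N ] B f → ξ ∈𝔩 neg B → C.Approx._~_ [ N ] (riemann B (λ x → f x C.* ψ (x K.* ξ))) (f̂ ξ)
    f̂-riemann {ξ = ξ} res ξ∈ = integral-riemann (ft ξ) (resolved-product res (λ x → ψ-integral (x K.* ξ)) (ψ-periodic-* ξ∈))

    -- Modulo N only the x in 𝔩⁻ᴮ matter, and for them ψ(x ξ) depends on ξ modulo 𝔩ᴮ, because ψ is
    -- trivial on the ring of integers.
    f̂-periodic : ∀ {N B} → Resolved [ N ] B f → Periodic [ N ] (+ B) f̂
    f̂-periodic {N} {B} res ξ η d∈ = at (∈-eventually ξ) (∈-eventually η)
      where
      open C.Approx [ N ]
      at : (∃[ B ] ∀ B′ → B ℕ.≤ B′ → ξ ∈𝔩 neg B′) → (∃[ B ] ∀ B′ → B ℕ.≤ B′ → η ∈𝔩 neg B′) → f̂ ξ ~ f̂ η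
      at (B₁ , ξ∈) (B₂ , η∈) = ~-trans (~-sym (f̂-riemann res′ (ξ∈ B′ (ℕ.≤-trans (ℕ.m≤n+m B₁ B) (ℕ.m≤m+n _ B₂)))))
        (~-trans (riemann-~ B′ (λ x _ → same x (x K.∈𝔩? neg B))) (f̂-riemann res′ (η∈ B′ (ℕ.m≤n+m B₂ _))))
        where
        B′ = B ℕ.+ B₁ ℕ.+ B₂
        res′ = resolved-mono (ℕ.≤-trans (ℕ.m≤m+n B B₁) (ℕ.m≤m+n _ B₂)) res
        off : ∀ x → ¬ (x ∈𝔩 neg B) → ∀ ξ → f x C.* ψ (x K.* ξ) ~ C.0#
        off x x∉ ξ = ⇒~0 (C.≤v-resp (C.*-comm _ _) (C.≤v-scale (ψ-integral (x K.* ξ)) (small res x x∉)))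
        same : ∀ x → Dec (x ∈𝔩 neg B) → f x C.* ψ (x K.* ξ) ~ f x C.* ψ (x K.* η)
        same x (no x∉)  = ~-trans (off x x∉ ξ) (~-sym (off x x∉ η))
        same x (yes x∈) = ≈⇒~ (C.*-congˡ (ψ-periodic (K.∈-mono δ⁻≤0 (K.∈-≡ (ℤ.+-inverseˡ (+ B))
          (K.∈-cong (SK.solve 3 (λ x ξ η → x SK.:* (ξ SK.:- η) SK.:= x SK.:* ξ SK.:- x SK.:* η) K.refl x ξ η) (K.∈-* x∈ d∈))))))

    abstract
      f̂-uniform : Uniform f̂
      f̂-uniform N =
        let B , res = f-uniform N
            M , van = f̂-vanishes N
            B′ , _ , -B′≤M = K.archimedean M
        in B ℕ.+ B′ , resolved
        (λ ξ ξ∉ → let m , m< , sξ = K.∉⇒shell ξ∉ in van ξ (⁺-trans (⁺-reflexive (K.v≡ sξ))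
          [ ℚ.≤-trans (K.mul-mono-≤ (ℤ.≤-trans (ℤ.<⇒≤ m<) (neg-mono (ℕ.m≤n+m B′ B)))) -B′≤M ]))
        (λ ξ η d∈ → f̂-periodic res ξ η (K.∈-mono (ℤ.+≤+ (ℕ.m≤m+n B B′)) d∈))

    module _ (f0 : f K.0# C.≈ C.0#) (f̂0 : f̂ K.0# C.≈ C.0#) {θ : Fun} (t : Tame θ) where
      private
        module A = Coefficients f-uniform f0 t
        module E = Coefficients f̂-uniform f̂0 (tame-invert t)
        module G = Gauss (tame-invert t)

      -- The index -n and the power of q in e arise because the unramified character with χ(π) = q
      -- λ⁻¹ takes the value q⁻ⁿ λⁿ at order -n.
      a e : ℤ → C.Carrier
      a = A.coef
      e n = E.coef (ℤ.- n) C.* q′ C.^ℤ (ℤ.- n)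

      -- At a common level B every integral is a finite sum, exactly for Γ, and modulo N for f̂ and
      -- the coefficient. What remains is the interchange of two finite sums.
      fubini : ∀ n {N B} → Resolved [ N ] B f → Resolved [ N ] B f̂ → shell-precision (tame-invert t) n ℕ.≤ B →
        C.Approx._~_ [ N ] (riemann B (λ x → f x C.* G.Γ n x)) (E.coef n)
      fubini n {N} {B} res res^ le = ~-trans (≈⇒~ swapped)
        (~-trans (riemann-~ B (λ ξ ξ∈ → ~-trans (~-scale (onShell-integral (tame-invert t) n ξ) (f̂-riemann res ξ∈)) (≈⇒~ (C.*-comm _ _))))
          (integral-riemann (E.coef-integral n) (resolved-onShell (tame-invert t) res^ n le)))
        where
        open C.Approx [ N ]
        χ⁻¹ = onShell (invert θ) n
        swapped : riemann B (λ x → f x C.* G.Γ n x) C.≈ riemann B (λ ξ → χ⁻¹ ξ C.* riemann B (λ x → f x C.* ψ (x K.* ξ)))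
        swapped = C.trans (riemann-cong B (λ x x∈ → C.trans (C.*-congˡ (C.sym (G.Γ-riemann n {x} {B} le x∈))) (C.sym (riemann-* B (f x) _))))
          (C.trans (riemann-swap B B (λ x ξ → f x C.* G.twist n x ξ))
            (riemann-cong B (λ ξ _ → C.trans (riemann-cong B (λ x _ →
                solve 3 (λ f o p → f :* (o :* p) := o :* (f :* p)) C.refl (f x) (χ⁻¹ ξ) (ψ (x K.* ξ))))
              (riemann-* B (χ⁻¹ ξ) _))))

      Common : ℚ → ℕ → ℕ → ℕ → Set
      Common N k₁ k₂ B = Resolved [ N ] B f × Resolved [ N ] B f̂ × k₁ ℕ.≤ B × k₂ ℕ.≤ B

      common : ∀ N k₁ k₂ → ∃ (Common N k₁ k₂)
      common N k₁ k₂ = let B , res = f-uniform N ; B′ , res′ = f̂-uniform N in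
        B ℕ.+ B′ ℕ.+ (k₁ ℕ.+ k₂) , resolved-mono (ℕ.≤-trans (ℕ.m≤m+n B B′) (ℕ.m≤m+n _ _)) res
                                 , resolved-mono (ℕ.≤-trans (ℕ.m≤n+m B′ B) (ℕ.m≤m+n _ _)) res′
                                 , ℕ.≤-trans (ℕ.m≤m+n k₁ k₂) (ℕ.m≤n+m _ (B ℕ.+ B′))
                                 , ℕ.≤-trans (ℕ.m≤n+m k₂ k₁) (ℕ.m≤n+m _ (B ℕ.+ B′))

      onShell-invert² : ∀ n x → onShell (invert (invert θ)) n x C.≈ onShell θ n x
      onShell-invert² n x = by (onShell-cases θ n x)
        where
        by : _ → onShell (invert (invert θ)) n x C.≈ onShell θ n x
        by (inj₁ (sx , eq))  = C.trans (onShell-in (invert (invert θ)) sx) (C.trans (invert-at (invert θ) x≉0)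
          (C.trans (C.inv-cong (invert-at θ x≉0)) (C.trans (C.inv-involutive (θ-≉0 (Tame.multiplicative t) x≉0)) (C.sym eq))))
          where x≉0 = K.shell⇒≉0 sx
        by (inj₂ (¬sx , eq)) = C.trans (onShell-out (invert (invert θ)) ¬sx) (C.sym eq)

      module _ (m : ℕ) (triv : ∀ u → u K.- K.1# ∈𝔩 + suc m → invert θ u C.≈ C.1#)
               (u₀ : K.Carrier) (su₀ : Shell (+ 0) u₀) (u₀∈ : u₀ K.- K.1# ∈𝔩 + m) (θu₀≉1 : ¬ (invert θ u₀ C.≈ C.1#)) where
        private module R = G.Ramified m triv u₀ su₀ u₀∈ θu₀≉1

        -- By `Γ-cases` the kernel is a Gauss sum times the inverse of χ̃⁻¹ on one shell, that is,
        -- times χ̃ there; integrating f against it gives a single coefficient of f.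
        ê-ramified : ∀ n → E.coef n C.≈ R.constant n C.* a (R.order n)
        ê-ramified n = C.close⇒≈ λ N → at N (common N (shell-precision (tame-invert t) n) (shell-precision t (R.order n)))
          where
          h : Fun
          h x = f x C.* onShell θ (R.order n) x
          pointwise : ∀ x → f x C.* G.Γ n x C.≈ R.constant n C.* h x
          pointwise x = C.trans (C.*-congˡ (C.trans (R.Γ-cases n x) (C.*-congˡ (onShell-invert² (R.order n) x))))
            (solve 3 (λ f c o → f :* (c :* o) := c :* (f :* o)) C.refl (f x) (R.constant n) (onShell θ (R.order n) x))
          at : ∀ N → ∃ (Common N (shell-precision (tame-invert t) n) (shell-precision t (R.order n))) → C.Close N (E.coef n) (R.constant n C.* a (R.order n))
          at N (B , res , res^ , le₁ , le₂) = ~-trans (~-sym (fubini n res res^ le₁))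
            (~-trans (≈⇒~ (C.trans (riemann-cong B (λ x _ → pointwise x)) (riemann-* B (R.constant n) h)))
              (~-scale (R.constant-integral n) (integral-riemann {h} (A.coef-integral (R.order n)) (resolved-onShell t res (R.order n) le₂))))
            where open C.Approx [ N ]

        related-ramified : Related (ratio C.0# (C.inv (R.constant (+ 0))) C.0# (δ⁻ ℤ.- + suc m)) a e
        related-ramified n = C.trans (solve 2 (λ a a′ → a :- con (+ 0) :* a′ := a) C.refl (a n) (a (ℤ.pred n)))
          (C.sym (C.trans (C.*-congˡ (C.trans (solve 2 (λ a a′ → a :- con (+ 0) :* a′ := a) C.refl (e j) (e (ℤ.suc j))) e-j))
            (C.trans (C.sym (C.*-assoc _ _ _)) (C.trans (C.*-congʳ (C.inverseˡ R.constant≉0)) (C.*-identityˡ _)))))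
          where
          j = n ℤ.- (δ⁻ ℤ.- + suc m)
          order-j : ∀ n d m → d ℤ.- (ℤ.- (n ℤ.- (d ℤ.- m)) ℤ.+ m) ≡ n
          order-j = ℤ-Ring.solve-∀
          e-j : e j C.≈ R.constant (+ 0) C.* a n
          e-j = C.trans (C.*-congʳ (ê-ramified (ℤ.- j))) (C.trans
            (solve 3 (λ c a q → (c :* a) :* q := (c :* q) :* a) C.refl (R.constant (ℤ.- j)) (a (R.order (ℤ.- j))) (q′ C.^ℤ (ℤ.- j)))
            (C.*-cong (R.constant-^ (ℤ.- j)) (C.reflexive (≡.cong a (order-j n δ⁻ (+ suc m))))))

      module _ (triv : ∀ u → Shell (+ 0) u → invert θ u C.≈ C.1#) where
        -1# : C.Carrier
        -1# = C.- C.1#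

        invert-1 : ∀ {x} → x K.≉ K.0# → invert θ x C.≈ C.1#
        invert-1 {x} x≉0 = let n , sx = K.shell-exists x≉0 in C.trans (unit-factor mult sx)
          (C.trans (C.*-cong (triv _ (unit-part sx)) (C.trans (C.^ℤ-cong (Tame.θ-π (tame-invert t)) n) (1^ℤ n))) (C.*-identityˡ _))
          where mult = Tame.multiplicative (tame-invert t)

        θ≈1 : ∀ {x} → x K.≉ K.0# → θ x C.≈ C.1#
        θ≈1 x≉0 = C.trans (C.sym (C.inv-involutive (θ-≉0 (Tame.multiplicative t) x≉0)))
          (C.trans (C.inv-cong (C.trans (C.sym (invert-at θ x≉0)) (invert-1 x≉0))) (C.sym (C.inv-unique (C.*-identityˡ C.1#))))

        ind : ℤ → Fun
        ind = indicator K.0#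

        ind-∈ : ∀ {n x} → x ∈𝔩 n → ind n x C.≈ C.1#
        ind-∈ {n} {x} x∈ = indicator-∈ (K.∈--0 x∈)

        ind-∉ : ∀ {n x} → ¬ (x ∈𝔩 n) → ind n x C.≈ C.0#
        ind-∉ {n} {x} x∉ = indicator-∉ (λ x∈ → x∉ (K.∈--0⁻¹ x∈))

        shell-difference : ∀ {φ} → (∀ {x} → x K.≉ K.0# → φ x C.≈ C.1#) → ∀ n x → onShell φ n x C.≈ ind n x C.+ -1# C.* ind (ℤ.suc n) x
        shell-difference {φ} φ≈1 n x = by (onShell-cases φ n x) (x K.∈𝔩? n) (x K.∈𝔩? ℤ.suc n)
          where
          1-0 : C.1# C.+ -1# C.* C.0# C.≈ C.1#
          1-0 = solve 0 (con (+ 1) :+ :- con (+ 1) :* con (+ 0) := con (+ 1)) C.refl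
          1-1 : C.1# C.+ -1# C.* C.1# C.≈ C.0#
          1-1 = solve 0 (con (+ 1) :+ :- con (+ 1) :* con (+ 1) := con (+ 0)) C.refl
          0-0 : C.0# C.+ -1# C.* C.0# C.≈ C.0#
          0-0 = solve 0 (con (+ 0) :+ :- con (+ 1) :* con (+ 0) := con (+ 0)) C.refl
          by : _ → Dec (x ∈𝔩 n) → Dec (x ∈𝔩 ℤ.suc n) → onShell φ n x C.≈ ind n x C.+ -1# C.* ind (ℤ.suc n) x
          by (inj₁ (sx , eq)) _ _ = C.trans eq (C.trans (φ≈1 (K.shell⇒≉0 sx)) (C.sym (C.trans
            (C.+-cong (ind-∈ (K.shell⇒∈ sx)) (C.*-congˡ (ind-∉ (K.shell⇒∉ sx (i<suc[i] n))))) 1-0)))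
          by (inj₂ (¬sx , eq)) (no x∉) _ = C.trans eq (C.sym (C.trans
            (C.+-cong (ind-∉ x∉) (C.*-congˡ (ind-∉ (λ x∈ → x∉ (K.∈-mono (ℤ.<⇒≤ (i<suc[i] n)) x∈))))) 0-0))
          by (inj₂ (¬sx , eq)) (yes x∈) (yes x∈′) = C.trans eq (C.sym (C.trans
            (C.+-cong (ind-∈ x∈) (C.*-congˡ (ind-∈ x∈′))) 1-1))
          by (inj₂ (¬sx , eq)) (yes x∈) (no x∉′) = ⊥-elim (¬sx (K.∈∧∉⇒shell x∈ x∉′))

        resolved-ball : ∀ {N B} → Resolved N B f → ∀ k → ℤ.∣ k ∣ ℕ.≤ B → Resolved N B (λ x → f x C.* ind k x)
        resolved-ball res k |k|≤B = resolved-product res (indicator-integral K.0# k)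
          (λ x y d∈ → indicator-periodic ⊤⁺ K.0# k x y (K.∈-mono (proj₂ (∣n∣-bounds {k} |k|≤B)) d∈))

        abstract
          ball-exists : ∀ k → ∃[ I ] ∫ (λ x → f x C.* ind k x) ≈ I
          ball-exists k = integral-exists λ N → let B , res = f-uniform N in
            B ℕ.+ ℤ.∣ k ∣ , resolved-ball (resolved-mono (ℕ.m≤m+n B _) res) k (ℕ.m≤n+m _ B)

        -- A shell is the difference of two consecutive balls, and so is its transform up to
        -- factors. Hence the coefficients of both zeta integrals are combinations of two
        -- consecutive values of this one sequence.
        Ball : ℤ → C.Carrier
        Ball k = proj₁ (ball-exists k)

        ball-riemann : ∀ {N B} → Resolved [ N ] B f → ∀ k → ℤ.∣ k ∣ ℕ.≤ B → C.Approx._~_ [ N ] (riemann B (λ x → f x C.* ind k x)) (Ball k)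
        ball-riemann res k |k|≤B = integral-riemann (proj₂ (ball-exists k)) (resolved-ball res k |k|≤B)

        a-unramified : ∀ n → a n C.≈ Ball n C.+ -1# C.* Ball (ℤ.suc n)
        a-unramified n = C.close⇒≈ λ N → at N (common N (shell-precision t n) (ℤ.∣ n ∣ ℕ.+ ℤ.∣ ℤ.suc n ∣))
          where
          g h : Fun
          g x = f x C.* ind n x
          h x = f x C.* ind (ℤ.suc n) x
          pointwise : ∀ x → f x C.* onShell θ n x C.≈ g x C.+ -1# C.* h x
          pointwise x = C.trans (C.*-congˡ (shell-difference θ≈1 n x))
            (solve 4 (λ f i z j → f :* (i :+ z :* j) := f :* i :+ z :* (f :* j)) C.refl (f x) (ind n x) -1# (ind (ℤ.suc n) x))
          at : ∀ N → ∃ (Common N (shell-precision t n) (ℤ.∣ n ∣ ℕ.+ ℤ.∣ ℤ.suc n ∣)) → C.Close N (a n) (Ball n C.+ -1# C.* Ball (ℤ.suc n))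
          at N (B , res , _ , le₁ , le₂) = ~-trans (~-sym (integral-riemann (A.coef-integral n) (resolved-onShell t res n le₁)))
            (~-trans (≈⇒~ (C.trans (riemann-cong B (λ x _ → pointwise x))
                (C.trans (riemann-+ B g (λ x → -1# C.* h x)) (C.+-congˡ (riemann-* B -1# h)))))
              (~-+ (ball-riemann res n (ℕ.≤-trans (ℕ.m≤m+n ℤ.∣ n ∣ _) le₂))
                (~-scale (C.unit-integral C.v-‿1) (ball-riemann res (ℤ.suc n) (ℕ.≤-trans (ℕ.m≤n+m _ ℤ.∣ n ∣) le₂)))))
            where open C.Approx [ N ]

        Γ-unramified : ∀ n x → G.Γ n x C.≈ κ n C.* ind (δ⁻ ℤ.- n) x C.+ -1# C.* (κ (ℤ.suc n) C.* ind (δ⁻ ℤ.- ℤ.suc n) x)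
        Γ-unramified n x = at (∈-eventually x)
          where
          at : (∃[ B ] ∀ B′ → B ℕ.≤ B′ → x ∈𝔩 neg B′) → G.Γ n x C.≈ κ n C.* ind (δ⁻ ℤ.- n) x C.+ -1# C.* (κ (ℤ.suc n) C.* ind (δ⁻ ℤ.- ℤ.suc n) x)
          at (B₁ , x∈) = go (B₁ ℕ.+ shell-precision (tame-invert t) n ℕ.+ (ℤ.∣ n ∣ ℕ.+ ℤ.∣ ℤ.suc n ∣))
            (ℕ.≤-trans (ℕ.m≤n+m _ B₁) (ℕ.m≤m+n _ _)) (x∈ _ (ℕ.≤-trans (ℕ.m≤m+n B₁ _) (ℕ.m≤m+n _ _)))
            (ℕ.≤-trans (ℕ.m≤m+n ℤ.∣ n ∣ _) (ℕ.m≤n+m _ (B₁ ℕ.+ shell-precision (tame-invert t) n)))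
            (ℕ.≤-trans (ℕ.m≤n+m _ ℤ.∣ n ∣) (ℕ.m≤n+m _ (B₁ ℕ.+ shell-precision (tame-invert t) n)))
            where
            go : ∀ B → shell-precision (tame-invert t) n ℕ.≤ B → x ∈𝔩 neg B → ℤ.∣ n ∣ ℕ.≤ B → ℤ.∣ ℤ.suc n ∣ ℕ.≤ B →
              G.Γ n x C.≈ κ n C.* ind (δ⁻ ℤ.- n) x C.+ -1# C.* (κ (ℤ.suc n) C.* ind (δ⁻ ℤ.- ℤ.suc n) x)
            go B le x∈ n≤ 1+n≤ = C.trans (C.sym (G.Γ-riemann n {x} {B} le x∈))
              (C.trans (riemann-cong B (λ ξ _ → pointwise ξ))
              (C.trans (riemann-+ B g (λ ξ → -1# C.* h ξ)) (C.+-cong (ball {B} {n} n≤ x∈)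
                (C.trans (riemann-* B -1# h) (C.*-congˡ (ball {B} {ℤ.suc n} 1+n≤ x∈))))))
              where
              g h : Fun
              g ξ = ind n ξ C.* ψ (x K.* ξ)
              h ξ = ind (ℤ.suc n) ξ C.* ψ (x K.* ξ)
              pointwise : ∀ ξ → G.twist n x ξ C.≈ g ξ C.+ -1# C.* h ξ
              pointwise ξ = C.trans (C.*-congʳ (shell-difference invert-1 n ξ))
                (solve 4 (λ p i z j → (i :+ z :* j) :* p := i :* p :+ z :* (j :* p)) C.refl (ψ (x K.* ξ)) (ind n ξ) -1# (ind (ℤ.suc n) ξ))

        ê-unramified : ∀ n → E.coef n C.≈ κ n C.* Ball (δ⁻ ℤ.- n) C.+ -1# C.* (κ (ℤ.suc n) C.* Ball (δ⁻ ℤ.- ℤ.suc n))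
        ê-unramified n = C.close⇒≈ λ N → at N (common N (shell-precision (tame-invert t) n) (ℤ.∣ k ∣ ℕ.+ ℤ.∣ k′ ∣))
          where
          k = δ⁻ ℤ.- n
          k′ = δ⁻ ℤ.- ℤ.suc n
          g h : Fun
          g x = f x C.* ind k x
          h x = f x C.* ind k′ x
          pointwise : ∀ x → f x C.* G.Γ n x C.≈ κ n C.* g x C.+ (-1# C.* κ (ℤ.suc n)) C.* h x
          pointwise x = C.trans (C.*-congˡ (Γ-unramified n x))
            (solve 6 (λ f c i z c′ j → f :* (c :* i :+ z :* (c′ :* j)) := c :* (f :* i) :+ (z :* c′) :* (f :* j)) C.refl
              (f x) (κ n) (ind k x) -1# (κ (ℤ.suc n)) (ind k′ x))
          at : ∀ N → ∃ (Common N (shell-precision (tame-invert t) n) (ℤ.∣ k ∣ ℕ.+ ℤ.∣ k′ ∣)) →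
            C.Close N (E.coef n) (κ n C.* Ball k C.+ -1# C.* (κ (ℤ.suc n) C.* Ball k′))
          at N (B , res , res^ , le₁ , le₂) = ~-trans (~-sym (fubini n res res^ le₁))
            (~-trans (≈⇒~ (C.trans (riemann-cong B (λ x _ → pointwise x))
                (C.trans (riemann-+ B (λ x → κ n C.* g x) (λ x → (-1# C.* κ (ℤ.suc n)) C.* h x))
                  (C.+-cong (riemann-* B (κ n) g) (riemann-* B (-1# C.* κ (ℤ.suc n)) h)))))
              (~-trans (~-+ (~-scale (C.unit-integral (v-κ n)) (ball-riemann res k (ℕ.≤-trans (ℕ.m≤m+n ℤ.∣ k ∣ _) le₂)))
                (~-scale (C.integral-* (C.unit-integral C.v-‿1) (C.unit-integral (v-κ (ℤ.suc n)))) (ball-riemann res k′ (ℕ.≤-trans (ℕ.m≤n+m _ ℤ.∣ k ∣) le₂))))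
                (≈⇒~ (C.+-congˡ (C.*-assoc _ _ _)))))
            where open C.Approx [ N ]

        q≉0 : q′ C.≉ C.0#
        q≉0 = C.v≡[]⇒≉0 C-v-q

        κ-q : ∀ n → κ n C.* q′ C.^ℤ n C.≈ κ (+ 0)
        κ-q (+ n)    = C.trans (C.*-congʳ (C.reflexive (≡.cong κ (≡.sym (ℤ.+-identityˡ (+ n)))))) (κ-^ (+ 0) n)
        κ-q -[1+ n ] = C.*-cancelˡ (C.^ℤ-≉0 q≉0 (+ suc n)) (C.trans
          (solve 3 (λ a k b → a :* (k :* b) := k :* (a :* b)) C.refl (q′ C.^ suc n) (κ -[1+ n ]) (q′ C.^ℤ -[1+ n ]))
          (C.trans (C.*-congˡ (C.^ℤ-inverse q≉0 (+ suc n))) (C.trans (C.*-identityʳ _) (C.trans (C.sym (κ-^ -[1+ n ] (suc n)))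
            (C.trans (C.*-congʳ (C.reflexive (≡.cong κ (ℤ.+-inverseˡ (+ suc n))))) (C.*-comm _ _))))))

        -- q^(-n) κ(-n) = κ 0 and q^(-n) κ(1-n) = κ 0 q⁻¹
        e-unramified : ∀ n → e n C.≈ κ (+ 0) C.* (Ball (δ⁻ ℤ.+ n) C.+ -1# C.* (C.inv q′ C.* Ball (ℤ.pred (δ⁻ ℤ.+ n))))
        e-unramified n = C.trans (C.*-congʳ (ê-unramified (ℤ.- n))) (C.trans
          (solve 6 (λ c A z c′ A′ q → (c :* A :+ z :* (c′ :* A′)) :* q := (c :* q) :* A :+ z :* ((c′ :* q) :* A′)) C.refl
            (κ (ℤ.- n)) (Ball (δ⁻ ℤ.- ℤ.- n)) -1# (κ (ℤ.suc (ℤ.- n))) (Ball (δ⁻ ℤ.- ℤ.suc (ℤ.- n))) (q′ C.^ℤ (ℤ.- n)))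
          (C.trans (C.+-cong (C.*-cong (κ-q (ℤ.- n)) (C.reflexive (≡.cong Ball (i₁ δ⁻ n))))
              (C.*-congˡ (C.*-cong κ′ (C.reflexive (≡.cong Ball (i₂ δ⁻ n))))))
            (solve 5 (λ c A z i A′ → c :* A :+ z :* ((c :* i) :* A′) := c :* (A :+ z :* (i :* A′))) C.refl
              (κ (+ 0)) (Ball (δ⁻ ℤ.+ n)) -1# (C.inv q′) (Ball (ℤ.pred (δ⁻ ℤ.+ n))))))
          where
          i₁ : ∀ d n → d ℤ.- ℤ.- n ≡ d ℤ.+ n
          i₁ = ℤ-Ring.solve-∀
          i₂ : ∀ d n → d ℤ.- (+ 1 ℤ.+ ℤ.- n) ≡ ℤ.- (+ 1) ℤ.+ (d ℤ.+ n)
          i₂ = ℤ-Ring.solve-∀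
          κ′ : κ (ℤ.suc (ℤ.- n)) C.* q′ C.^ℤ (ℤ.- n) C.≈ κ (+ 0) C.* C.inv q′
          κ′ = C.*-cancelˡ q≉0 (C.trans
            (solve 3 (λ q k x → q :* (k :* x) := k :* (q :* x)) C.refl q′ (κ (ℤ.suc (ℤ.- n))) (q′ C.^ℤ (ℤ.- n)))
            (C.trans (C.*-congˡ (C.sym (C.^ℤ-suc q≉0 (ℤ.- n)))) (C.trans (κ-q (ℤ.suc (ℤ.- n)))
              (C.sym (C.trans (solve 3 (λ q k i → q :* (k :* i) := k :* (q :* i)) C.refl q′ (κ (+ 0)) (C.inv q′))
                (C.trans (C.*-congˡ (C.inverse q′ q≉0)) (C.*-identityʳ _)))))))

        -- Let T be the shift of sequences by one and Bₙ the integral of f over 𝔩ⁿ. Then a = (1 - T)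
        -- B, and up to an index shift e = κ(0) (1 - q⁻¹ T⁻¹) B. Applying to each sequence the
        -- operator of the other gives the same result, as the operators commute.
        related-unramified : Related (ratio (C.inv q′) (C.inv (κ (+ 0))) C.1# δ⁻) a e
        related-unramified n = C.*-cancelˡ κ≉0 (begin
          κ (+ 0) C.* (a n C.- C.inv q′ C.* a (ℤ.pred n))
            ≈⟨ C.*-congˡ (C.+-cong (a-unramified n) (C.-‿cong (C.*-congˡ (C.trans (a-unramified (ℤ.pred n))
                 (C.+-congˡ (C.*-congˡ (C.reflexive (≡.cong Ball (ℤ.suc-pred n))))))))) ⟩
          κ (+ 0) C.* ((A₀ C.+ -1# C.* A₁) C.- C.inv q′ C.* (A₋ C.+ -1# C.* A₀))
            ≈⟨ solve 5 (λ k i A A₁ A₋ → k :* ((A :+ :- con (+ 1) :* A₁) :- i :* (A₋ :+ :- con (+ 1) :* A))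
                 := k :* (A :+ :- con (+ 1) :* (i :* A₋)) :- con (+ 1) :* (k :* (A₁ :+ :- con (+ 1) :* (i :* A)))) C.refl
                 (κ (+ 0)) (C.inv q′) A₀ A₁ A₋ ⟩
          κ (+ 0) C.* (A₀ C.+ -1# C.* (C.inv q′ C.* A₋)) C.- C.1# C.* (κ (+ 0) C.* (A₁ C.+ -1# C.* (C.inv q′ C.* A₀)))
            ≈⟨ C.+-cong e₀ (C.-‿cong (C.*-congˡ e₁)) ⟨
          e j C.- C.1# C.* e (ℤ.suc j)
            ≈⟨ C.trans (C.*-congʳ (C.inverse (κ (+ 0)) κ≉0)) (C.*-identityˡ _) ⟨
          κ (+ 0) C.* C.inv (κ (+ 0)) C.* (e j C.- C.1# C.* e (ℤ.suc j))
            ≈⟨ C.*-assoc _ _ _ ⟩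
          κ (+ 0) C.* (C.inv (κ (+ 0)) C.* (e j C.- C.1# C.* e (ℤ.suc j))) ∎)
          where
          open import Relation.Binary.Reasoning.Setoid C.setoid
          κ≉0 = C.v≡[]⇒≉0 (v-κ (+ 0))
          j = n ℤ.- δ⁻
          A₀ = Ball n
          A₁ = Ball (ℤ.suc n)
          A₋ = Ball (ℤ.pred n)
          i₁ : ∀ d n → d ℤ.+ (n ℤ.- d) ≡ n
          i₁ = ℤ-Ring.solve-∀
          i₂ : ∀ d n → d ℤ.+ (+ 1 ℤ.+ (n ℤ.- d)) ≡ + 1 ℤ.+ n
          i₂ = ℤ-Ring.solve-∀
          e₀ : e j C.≈ κ (+ 0) C.* (A₀ C.+ -1# C.* (C.inv q′ C.* A₋))
          e₀ = C.trans (e-unramified j) (C.reflexive (≡.cong (λ i → κ (+ 0) C.* (Ball i C.+ -1# C.* (C.inv q′ C.* Ball (ℤ.pred i)))) (i₁ δ⁻ n)))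
          e₁ : e (ℤ.suc j) C.≈ κ (+ 0) C.* (A₁ C.+ -1# C.* (C.inv q′ C.* A₀))
          e₁ = C.trans (e-unramified (ℤ.suc j)) (C.trans
            (C.reflexive (≡.cong (λ i → κ (+ 0) C.* (Ball i C.+ -1# C.* (C.inv q′ C.* Ball (ℤ.pred i)))) (i₂ δ⁻ n)))
            (C.reflexive (≡.cong (λ i → κ (+ 0) C.* (A₁ C.+ -1# C.* (C.inv q′ C.* Ball i))) (ℤ.pred-suc n))))

  -- Built from the character and its conductor alone; this is why ρ is independent of f.
  zeta-ratio : ∀ {θ} (t : Tame θ) → Conductor (invert θ) → Ratio
  zeta-ratio t (unramified _) = ratio (C.inv q′) (C.inv (κ (+ 0))) C.1# δ⁻
  zeta-ratio t (ramified m triv u₀ su₀ u₀∈ θu₀≉1) =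
    ratio C.0# (C.inv (Gauss.Ramified.constant (tame-invert t) m triv u₀ su₀ u₀∈ θu₀≉1 (+ 0))) C.0# (δ⁻ ℤ.- + suc m)

  related : ∀ {θ} (t : Tame θ) (cond : Conductor (invert θ)) {f f̂ : Fun} (ft : IsFourierTransform f f̂) (van : VanishesAt∞ f̂)
    (f0 : f K.0# C.≈ C.0#) (f̂0 : f̂ K.0# C.≈ C.0#) →
    Related (zeta-ratio t cond) (Transform.a {f} {f̂} ft van f0 f̂0 {θ} t) (Transform.e {f} {f̂} ft van f0 f̂0 {θ} t)
  related {θ} t (unramified triv) {f} {f̂} ft van f0 f̂0 = Transform.related-unramified {f} {f̂} ft van f0 f̂0 {θ} t triv
  related {θ} t (ramified m triv u₀ su₀ u₀∈ θu₀≉1) {f} {f̂} ft van f0 f̂0 =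
    Transform.related-ramified {f} {f̂} ft van f0 f̂0 {θ} t m triv u₀ su₀ u₀∈ θu₀≉1

-- Laurent series, meromorphic functions and continuation.

module RigidAnalytic {ℓ p : ℕ} (S : Setting ℓ p) where
  open CoefficientRelation S public
  open Analysis S public using (Analytic; value; Annulus; LaurentSum; NonZeroDivisor; Meromorphic; ℂₚ×; annulus; _∈[_,_]; _≈_·_; _Continues_)
  private
    module GC = GeometricSums C.valuedField

  series : (ℤ → C.Carrier) → C.Carrier → ℤ → C.Carrier
  series a x n = a n C.* x C.^ℤ n

  value-hasSum : ∀ {α β} (g : Analytic α β) x x∈ → HasSum (series (Analytic.coeff g) (proj₁ x)) (value g x x∈)
  value-hasSum g x x∈ = let s₊ , s₋ , c₊ , c₋ , eq = Analytic.converge g x x∈ in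
    hasSum-cong {series (Analytic.coeff g) (proj₁ x)} (λ n → C.refl) (C.sym eq) (convergent⇒hasSum {series (Analytic.coeff g) (proj₁ x)} c₊ c₋)

  value-decays : ∀ {α β} (g : Analytic α β) x → Annulus α β x → Decays (series (Analytic.coeff g) (proj₁ x))
  value-decays g x x∈ = let s₊ , s₋ , c₊ , c₋ , eq = Analytic.converge g x x∈ in
    convergent⇒decays {series (Analytic.coeff g) (proj₁ x)} c₊ c₋

  value-unique : ∀ {α β} (g : Analytic α β) x x∈ {s} → HasSum (series (Analytic.coeff g) (proj₁ x)) s → value g x x∈ C.≈ s
  value-unique g x x∈ h = hasSum-unique {series (Analytic.coeff g) (proj₁ x)} (value-hasSum g x x∈) h

  analytic : ∀ {α β} (a : ℤ → C.Carrier) → (∀ x → Annulus α β x → Decays (series a (proj₁ x))) → Analytic α β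
  analytic {α} {β} a d = record
    { coeff    = a
    ; value    = λ x x∈ → proj₁ (sums x x∈)
    ; converge = λ x x∈ → proj₂ (sums x x∈)
    }
    where
    abstract
      sums : ∀ x → Annulus α β x → ∃ (LaurentSum a x)
      sums x x∈ = let s₊ , s₋ , c₊ , c₋ = decays⇒convergent C.complete {series a (proj₁ x)} (d x x∈) in
        s₊ C.+ s₋ , s₊ , s₋ , c₊ , c₋ , C.refl

  single-shiftable : ∀ {t} k → (∀ n → ¬ (n ≡ k) → t n C.≈ C.0#) → Shiftable t (t k)
  single-shiftable {t} k off = (λ N → suc ℤ.∣ k ∣ , λ n le → C.≈0⇒≤v (off n (λ { ≡.refl → ℕ.1+n≰n le })))
    , λ N → suc ℤ.∣ k ∣ , λ B le → C.Approx.≈⇒~ [ N ] (at B le (position B k))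
    where
    at : ∀ B → suc ℤ.∣ k ∣ ℕ.≤ B → Position B k → window B t C.≈ t k
    at B le (inside single) = single t off
    at B le (near-0 B≤k)    = ⊥-elim (ℤ.<⇒≱ (ℤ.<-≤-trans (ℤ.≤-<-trans (proj₂ (∣n∣-bounds {k} ℕ.≤-refl)) (ℤ.+<+ ℕ.≤-refl)) (ℤ.+≤+ le)) B≤k)
    at B le (near-∞ k<-B)   = ⊥-elim (ℤ.<⇒≱ k<-B (ℤ.≤-trans (neg-mono (ℕ.≤-trans (ℕ.n≤1+n _) le)) (proj₁ (∣n∣-bounds {k} ℕ.≤-refl))))

  shiftable-+ : ∀ {t u s r} → Shiftable t s → Shiftable u r → Shiftable (λ n → t n C.+ u n) (s C.+ r)
  shiftable-+ {t} {u} (d , h) (d′ , h′) = decays-+ {t} {u} d d′ , hasSum-+ {t} {u} h h′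

  shiftable-* : ∀ {t s} c → Shiftable t s → Shiftable (λ n → c C.* t n) (c C.* s)
  shiftable-* {t} c (d , h) = decays-* {t} c d , hasSum-* {t} c h

  shiftable-sum : ∀ {t} → Decays t → ∃[ s ] Shiftable t s
  shiftable-sum {t} d = let s₊ , s₋ , c₊ , c₋ = decays⇒convergent C.complete {t} d in
    s₊ C.+ s₋ , d , convergent⇒hasSum {t} c₊ c₋

  monomial : C.Carrier → ℤ → ℤ → C.Carrier
  monomial c k n with n ℤ.≟ k
  ... | yes _ = c
  ... | no  _ = C.0#

  monomial-at : ∀ c k → monomial c k k C.≈ c
  monomial-at c k with k ℤ.≟ k
  ... | yes _   = C.refl
  ... | no  k≢k = ⊥-elim (k≢k ≡.refl)

  monomial-off : ∀ c {k n} → ¬ (n ≡ k) → monomial c k n C.≈ C.0#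
  monomial-off c {k} {n} n≢k with n ℤ.≟ k
  ... | yes n≡k = ⊥-elim (n≢k n≡k)
  ... | no  _   = C.refl

  monomial-shiftable : ∀ c k x → Shiftable (series (monomial c k) x) (monomial c k k C.* x C.^ℤ k)
  monomial-shiftable c k x = single-shiftable {series (monomial c k) x} k (λ n n≢k → C.trans (C.*-congʳ (monomial-off c n≢k)) (C.zeroˡ _))

  binomial : (c₀ : C.Carrier) (k₀ : ℤ) (c₁ : C.Carrier) (k₁ : ℤ) → ℤ → C.Carrier
  binomial c₀ k₀ c₁ k₁ n = monomial c₀ k₀ n C.+ monomial c₁ k₁ n

  binomial-shiftable : ∀ c₀ k₀ c₁ k₁ x → Shiftable (series (binomial c₀ k₀ c₁ k₁) x) (monomial c₀ k₀ k₀ C.* x C.^ℤ k₀ C.+ monomial c₁ k₁ k₁ C.* x C.^ℤ k₁)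
  binomial-shiftable c₀ k₀ c₁ k₁ x = shiftable-cong {u = series (binomial c₀ k₀ c₁ k₁) x} (λ n → C.sym (C.distribʳ _ _ _))
    (shiftable-+ {series (monomial c₀ k₀) x} {series (monomial c₁ k₁) x} (monomial-shiftable c₀ k₀ x) (monomial-shiftable c₁ k₁ x))

  binomial-analytic : ∀ {α β} (c₀ : C.Carrier) (k₀ : ℤ) (c₁ : C.Carrier) (k₁ : ℤ) → Analytic α β
  binomial-analytic c₀ k₀ c₁ k₁ = analytic (binomial c₀ k₀ c₁ k₁) (λ x _ → proj₁ (binomial-shiftable c₀ k₀ c₁ k₁ (proj₁ x)))

  binomial-value : ∀ {α β} c₀ k₀ c₁ k₁ x x∈ →
    value (binomial-analytic {α} {β} c₀ k₀ c₁ k₁) x x∈ C.≈ c₀ C.* proj₁ x C.^ℤ k₀ C.+ c₁ C.* proj₁ x C.^ℤ k₁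
  binomial-value {α} {β} c₀ k₀ c₁ k₁ x x∈ = C.trans
    (value-unique (binomial-analytic {α} {β} c₀ k₀ c₁ k₁) x x∈ (proj₂ (binomial-shiftable c₀ k₀ c₁ k₁ (proj₁ x))))
    (C.+-cong (C.*-congʳ (monomial-at c₀ k₀)) (C.*-congʳ (monomial-at c₁ k₁)))

  linear : ∀ {α β} → C.Carrier → Analytic α β
  linear b = binomial-analytic C.1# (+ 0) (C.- b) (+ 1)

  linear-value : ∀ {α β} b x x∈ → value (linear {α} {β} b) x x∈ C.≈ C.1# C.- b C.* proj₁ x
  linear-value {α} {β} b x x∈ = C.trans (binomial-value {α} {β} C.1# (+ 0) (C.- b) (+ 1) x x∈)
    (solve 2 (λ b x → con (+ 1) :* con (+ 1) :+ (:- b) :* (x :* con (+ 1)) := con (+ 1) :- b :* x) C.refl b (proj₁ x))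

  geometric-integral : ∀ {w} → C.Integral w → ∀ n → C.Integral (GC.geometric w n)
  geometric-integral w-int zero    = C.≤v-0
  geometric-integral w-int (suc n) = C.≤v-+ C.integral-1 (C.integral-* w-int (geometric-integral w-int n))

  ^-near-1 : ∀ {N w} → C.Integral w → N ≤⁺ C.v (w C.- C.1#) → ∀ n → N ≤⁺ C.v (w C.^ n C.- C.1#)
  ^-near-1 {N} {w} w-int h n = C.≤v-resp (C.trans (C.*-comm _ _) (C.sym (GC.^-1-factor w n))) (C.≤v-scale (geometric-integral w-int n) h)

  ^ℤ-near-1 : ∀ {N w} → C.v w ≡ [ 0ℚ ] → N ≤⁺ C.v (w C.- C.1#) → ∀ n → N ≤⁺ C.v (w C.^ℤ n C.- C.1#)
  ^ℤ-near-1 vw h (+ n)    = ^-near-1 (C.unit-integral vw) h n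
  ^ℤ-near-1 {N} {w} vw h -[1+ n ] = ^-near-1 (C.unit-integral (C.unit-inv vw)) inv-near (suc n)
    where
    inv-near : N ≤⁺ C.v (C.inv w C.- C.1#)
    inv-near = C.≤v-resp (C.trans (solve 2 (λ w i → i :* (:- (w :- con (+ 1))) := i :- w :* i) C.refl w (C.inv w))
        (C.+-congˡ (C.-‿cong (C.inverse w (C.v≡[]⇒≉0 vw)))))
      (C.≤v-scale (C.unit-integral (C.unit-inv vw)) (C.≤v-neg h))

  -- A power of p. The exponent `suc B` keeps the value positive even when N is negative.
  small-element : ∀ N → ∃[ y ] y C.≉ C.0# × [ N ] ≤⁺ C.v y × ∃[ ε ] 0ℚ ℚ.< ε × [ ε ] ≤⁺ C.v y
  small-element N = C.fromℕ p C.^ suc B , C.v≡[]⇒≉0 (v-p^ (suc B))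
      , ⁺-trans [ ℚ.≤-trans N≤B (mul-mono-≤ (ℤ.+≤+ (ℕ.n≤1+n B))) ] (⁺-reflexive (≡.sym (v-p^ (suc B))))
      , mul (+ suc B) , ≡.subst (ℚ._< mul (+ suc B)) mul-0 (mul-mono-< {+ 0} {+ suc B} (ℤ.+<+ (ℕ.s≤s ℕ.z≤n)))
      , ⁺-reflexive (≡.sym (v-p^ (suc B)))
    where
    open Multiples 1ℚ (ℚ.positive⁻¹ 1ℚ)
    arch = archimedean N
    B = proj₁ arch
    N≤B = proj₁ (proj₂ arch)
    v-p^ : ∀ n → C.v (C.fromℕ p C.^ n) ≡ [ mul (+ n) ]
    v-p^ zero    = ≡.trans C.v-1 (≡.cong [_] (≡.sym mul-0))
    v-p^ (suc n) = ≡.trans (C.v-*-[] C-v-p (v-p^ n)) (≡.cong [_] (≡.sym (mul-suc (+ n))))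

  hasSum-≤v : ∀ {N t s} → (∀ n → [ N ] ≤⁺ C.v (t n)) → HasSum t s → [ N ] ≤⁺ C.v s
  hasSum-≤v {N} {t} h hs =
    let B , c = hs N
        open C.Approx [ N ]
    in
    ~0⇒ (~-trans (~-sym (c B ℕ.≤-refl)) (⇒~0 (window-≤v B h)))

  -- The only possible zero of 1 - b λ is isolated, and analytic functions are
  -- continuous: compare x₀ = 1/b with x₀ (1 + y) for small y.
  linear-regular : ∀ {α β} b → NonZeroDivisor (linear {α} {β} b)
  linear-regular {α} {β} b g gh≈0 x₀ x₀∈ = by ((C.1# C.- b C.* proj₁ x₀) C.≈0?)
    where
    divide : ∀ x x∈ → C.1# C.- b C.* proj₁ x C.≉ C.0# → value g x x∈ C.≈ C.0#
    divide x x∈ h≉0 = C.*-≈0 h≉0 (C.trans (C.*-comm _ _) (C.trans (C.*-congˡ (C.sym (linear-value {α} {β} b x x∈))) (gh≈0 x x∈)))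
    by : Dec (C.1# C.- b C.* proj₁ x₀ C.≈ C.0#) → value g x₀ x₀∈ C.≈ C.0#
    by (no h≉0)  = divide x₀ x₀∈ h≉0
    by (yes h≈0) = C.unbounded⇒0 bounded
      where
      x = proj₁ x₀
      bx≈1 : b C.* x C.≈ C.1#
      bx≈1 = C.trans (solve 1 (λ y → y := con (+ 1) :- (con (+ 1) :- y)) C.refl (b C.* x))
        (C.trans (C.+-congˡ (C.-‿cong h≈0)) (solve 0 (con (+ 1) :- con (+ 0) := con (+ 1)) C.refl))
      bound = decays-bounded {series (Analytic.coeff g) x} (value-decays g x₀ x₀∈)
      M = proj₁ bound
      bounded : ∀ N → [ N ] ≤⁺ C.v (value g x₀ x₀∈)
      bounded N = at (small-element (N ℚ.- M))
        where
        at : (∃[ y ] y C.≉ C.0# × [ N ℚ.- M ] ≤⁺ C.v y × ∃[ ε ] 0ℚ ℚ.< ε × [ ε ] ≤⁺ C.v y) → [ N ] ≤⁺ C.v (value g x₀ x₀∈)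
        at (y , y≉0 , N-M≤y , ε , 0<ε , ε≤y) = C.≤v-resp (C.trans (C.+-congˡ (C.trans (C.*-congˡ g₁≈0) (C.zeroʳ _))) (C.+-identityʳ _))
          (hasSum-≤v term≤ (hasSum-+ {series a x} {λ n → C.- C.1# C.* series a x₁ n} (value-hasSum g x₀ x₀∈)
            (hasSum-* {series a x₁} (C.- C.1#) (value-hasSum g (x₁ , x₁≉0) x₁∈))))
          where
          a = Analytic.coeff g
          w = C.1# C.+ y
          w-1≈y : y C.≈ w C.- C.1#
          w-1≈y = solve 1 (λ y → y := (con (+ 1) :+ y) :- con (+ 1)) C.refl y
          vw : C.v w ≡ [ 0ℚ ]
          vw = C.v-unit-perturb C.v-1 0<ε (C.≤v-resp w-1≈y ε≤y)
          x₁ = x C.* w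
          x₁≉0 = C.*-≉0 (proj₂ x₀) (C.v≡[]⇒≉0 vw)
          v-x₁ : C.v x₁ ≡ C.v x
          v-x₁ = ≡.trans (C.v-* x w) (≡.trans (≡.cong (C.v x +⁺_) vw) (+⁺-identityʳ (C.v x)))
          x₁∈ : Annulus α β (x₁ , x₁≉0)
          x₁∈ = ≡.subst ([ α ] ≤⁺_) (≡.sym v-x₁) (proj₁ x₀∈) , ≡.subst (_≤⁺ [ β ]) (≡.sym v-x₁) (proj₂ x₀∈)
          g₁≈0 : value g (x₁ , x₁≉0) x₁∈ C.≈ C.0#
          g₁≈0 = divide (x₁ , x₁≉0) x₁∈ λ eq → y≉0 (C.trans
            (solve 1 (λ y → y := (con (+ 1) :* (con (+ 1) :+ y)) :- con (+ 1)) C.refl y)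
            (C.trans (C.+-congʳ (C.*-congʳ (C.sym bx≈1))) (C.trans
              (solve 3 (λ b x w → (b :* x) :* w :- con (+ 1) := :- (con (+ 1) :- b :* (x :* w))) C.refl b x w)
              (C.trans (C.-‿cong eq) (solve 0 (:- con (+ 0) := con (+ 0)) C.refl)))))
          -- The difference of the n-th terms is - aₙ x₀ⁿ (wⁿ - 1). The terms aₙ x₀ⁿ are bounded by
          -- M, and wⁿ - 1 is as small as y uniformly in n.
          term≤ : ∀ n → [ N ] ≤⁺ C.v (series a x n C.+ C.- C.1# C.* series a x₁ n)
          term≤ n = C.≤v-resp (C.trans
              (solve 3 (λ a X W → (a :* X) :* (:- (W :- con (+ 1))) := a :* X :+ :- con (+ 1) :* (a :* (X :* W))) C.refl (a n) (x C.^ℤ n) (w C.^ℤ n))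
              (C.+-congˡ (C.*-congˡ (C.*-congˡ (C.sym (C.^ℤ-distrib-* (proj₂ x₀) (C.v≡[]⇒≉0 vw) n))))))
            (≡.subst (λ K → [ K ] ≤⁺ C.v (series a x n C.* (C.- (w C.^ℤ n C.- C.1#)))) (y+[x-y]≡x N M)
              (C.≤v-* (proj₂ bound n) (C.≤v-neg (^ℤ-near-1 vw (C.≤v-resp w-1≈y N-M≤y) n))))

  series-shift : ∀ j {a x s} → x C.≉ C.0# → Shiftable (series a x) s → Shiftable (series (λ n → a (j ℤ.+ n)) x) (x C.^ℤ (ℤ.- j) C.* s)
  series-shift j {a} {x} {s} x≉0 sh = shiftable-cong {u = series (λ n → a (j ℤ.+ n)) x} (λ n → C.trans
      (solve 3 (λ i a y → i :* (a :* y) := a :* (i :* y)) C.refl (x C.^ℤ (ℤ.- j)) (a (j ℤ.+ n)) (x C.^ℤ (j ℤ.+ n)))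
      (C.*-congˡ (C.trans (C.sym (C.^ℤ-+ x≉0 (ℤ.- j) (j ℤ.+ n))) (C.reflexive (≡.cong (x C.^ℤ_) (cancel j n))))))
    (shiftable-* {λ n → series a x (j ℤ.+ n)} (x C.^ℤ (ℤ.- j)) (shiftable-shift j {series a x} sh))
    where
    cancel : ∀ j n → ℤ.- j ℤ.+ (j ℤ.+ n) ≡ n
    cancel = ℤ-Ring.solve-∀

  module _ (r : Ratio) where
    open Ratio r

    -- The coefficients of c λᵏ (1 - d λ⁻¹) Σ eₙ λⁿ. Under `Related` they are also those of (1 - b
    -- λ) Σ aₙ λⁿ, and the functional equation compares the two sums of this one series.
    dual : (ℤ → C.Carrier) → ℤ → C.Carrier
    dual e n = c C.* (e (n ℤ.- k) C.- d C.* e (ℤ.suc (n ℤ.- k)))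

    dual-shiftable : ∀ {e x s} → x C.≉ C.0# → Shiftable (series e x) s →
      Shiftable (series (dual e) x) ((c C.* x C.^ℤ k C.+ (C.- (c C.* d)) C.* x C.^ℤ (ℤ.pred k)) C.* s)
    dual-shiftable {e} {x} {s} x≉0 sh = (λ N → proj₁ shifted N) , hasSum-cong {series (dual e) x} (λ n → C.refl) total (proj₂ shifted)
      where
      j = ℤ.- k
      i₁ : ∀ k n → ℤ.- k ℤ.+ n ≡ n ℤ.- k
      i₁ = ℤ-Ring.solve-∀
      i₂ : ∀ k n → + 1 ℤ.+ ℤ.- k ℤ.+ n ≡ + 1 ℤ.+ (n ℤ.- k)
      i₂ = ℤ-Ring.solve-∀
      i₃ : ∀ k → ℤ.- (+ 1 ℤ.+ ℤ.- k) ≡ ℤ.- (+ 1) ℤ.+ k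
      i₃ = ℤ-Ring.solve-∀
      shifted : Shiftable (series (dual e) x) (c C.* (x C.^ℤ (ℤ.- j) C.* s) C.+ (C.- (c C.* d)) C.* (x C.^ℤ (ℤ.- ℤ.suc j) C.* s))
      shifted = shiftable-cong {u = series (dual e) x} (λ n → C.trans
          (C.+-cong (C.*-congˡ (C.*-congʳ (C.reflexive (≡.cong e (i₁ k n))))) (C.*-congˡ (C.*-congʳ (C.reflexive (≡.cong e (i₂ k n))))))
          (solve 5 (λ c d e₁ e₂ y → c :* (e₁ :* y) :+ (:- (c :* d)) :* (e₂ :* y) := (c :* (e₁ :- d :* e₂)) :* y) C.refl
            c d (e (n ℤ.- k)) (e (ℤ.suc (n ℤ.- k))) (x C.^ℤ n)))
        (shiftable-+ {λ n → c C.* series (λ n → e (j ℤ.+ n)) x n} {λ n → (C.- (c C.* d)) C.* series (λ n → e (ℤ.suc j ℤ.+ n)) x n}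
          (shiftable-* {series (λ n → e (j ℤ.+ n)) x} c (series-shift j {e} x≉0 sh))
          (shiftable-* {series (λ n → e (ℤ.suc j ℤ.+ n)) x} (C.- (c C.* d)) (series-shift (ℤ.suc j) {e} x≉0 sh)))
      total : c C.* (x C.^ℤ (ℤ.- j) C.* s) C.+ (C.- (c C.* d)) C.* (x C.^ℤ (ℤ.- ℤ.suc j) C.* s) C.≈
              (c C.* x C.^ℤ k C.+ (C.- (c C.* d)) C.* x C.^ℤ (ℤ.pred k)) C.* s
      total = C.trans (C.+-cong (C.*-congˡ (C.*-congʳ (C.reflexive (≡.cong (x C.^ℤ_) (ℤ.neg-involutive k)))))
          (C.*-congˡ (C.*-congʳ (C.reflexive (≡.cong (x C.^ℤ_) (i₃ k))))))
        (solve 5 (λ c m X Y s → c :* (X :* s) :+ m :* (Y :* s) := (c :* X :+ m :* Y) :* s) C.refl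
          c (C.- (c C.* d)) (x C.^ℤ k) (x C.^ℤ (ℤ.pred k)) s)

    primal-hasSum : ∀ {a e x s} → x C.≉ C.0# → Related r a e → Shiftable (series a x) s →
      HasSum (series (dual e) x) ((C.1# C.- b C.* x) C.* s)
    primal-hasSum {a} {e} {x} {s} x≉0 rel sh = hasSum-cong terms total
      (proj₂ (shiftable-+ {series a x} {λ n → (C.- b) C.* series (λ n → a (-[1+ 0 ] ℤ.+ n)) x n} sh
        (shiftable-* {series (λ n → a (-[1+ 0 ] ℤ.+ n)) x} (C.- b) (series-shift -[1+ 0 ] {a} x≉0 sh))))
      where
      terms : ∀ n → series a x n C.+ (C.- b) C.* series (λ n → a (-[1+ 0 ] ℤ.+ n)) x n C.≈ series (dual e) x n
      terms n = C.trans (solve 4 (λ b a₀ a₁ y → a₀ :* y :+ (:- b) :* (a₁ :* y) := (a₀ :- b :* a₁) :* y) C.refl b (a n) (a (ℤ.pred n)) (x C.^ℤ n))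
        (C.*-congʳ (rel n))
      total : s C.+ (C.- b) C.* (x C.^ℤ (+ 1) C.* s) C.≈ (C.1# C.- b C.* x) C.* s
      total = solve 3 (λ b x s → s :+ (:- b) :* ((x :* con (+ 1)) :* s) := (con (+ 1) :- b :* x) :* s) C.refl b x s

    numerator : ∀ {α β} → Analytic α β
    numerator = binomial-analytic c k (C.- (c C.* d)) (ℤ.pred k)

    -- Indexed by all closed annuli, so that each of them is covered by itself; the same two Laurent
    -- polynomials serve on every member.
    ratio-meromorphic : Meromorphic ℂₚ×
    ratio-meromorphic = record
      { Index      = ℚ × ℚ
      ; lo         = proj₁
      ; hi         = proj₂
      ; inside     = λ _ _ _ → tt
      ; admissible = λ α β _ → (α , β) ∷ [] , λ w w∈ → here w∈
      ; num        = λ _ → numerator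
      ; den        = λ _ → linear b
      ; regular    = λ i → linear-regular {proj₁ i} {proj₂ i} b
      ; compatible = λ i j x x∈i x∈j → C.*-cong
          (C.trans (binomial-value {proj₁ i} {proj₂ i} c k _ (ℤ.pred k) x x∈i) (C.sym (binomial-value {proj₁ j} {proj₂ j} c k _ (ℤ.pred k) x x∈j)))
          (C.trans (linear-value {proj₁ j} {proj₂ j} b x x∈j) (C.sym (linear-value {proj₁ i} {proj₂ i} b x x∈i)))
      }

    functional-equation : ∀ {α β} (Z Ẑ : Analytic α β) → Related r (Analytic.coeff Z) (Analytic.coeff Ẑ) →
      _≈_·_ {ℂₚ×} {α} {β} Z ratio-meromorphic Ẑ
    functional-equation Z Ẑ rel i x x∈ x∈i = C.trans (C.*-congʳ (linear-value {proj₁ i} {proj₂ i} b x x∈i)) (C.trans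
      (hasSum-unique {series (dual (Analytic.coeff Ẑ)) (proj₁ x)} (primal-hasSum {Analytic.coeff Z} {Analytic.coeff Ẑ} (proj₂ x) rel (value-decays Z x x∈ , value-hasSum Z x x∈))
        (proj₂ (dual-shiftable {Analytic.coeff Ẑ} (proj₂ x) (value-decays Ẑ x x∈ , value-hasSum Ẑ x x∈))))
      (C.*-congʳ (C.sym (binomial-value {proj₁ i} {proj₂ i} c k _ (ℤ.pred k) x x∈i))))

    -- Z itself on p^0 ≤ |λ| ≤ p^γ, and ρ Ẑ on p^(-γ) ≤ |λ| ≤ p^0.
    continuation : ∀ (γ : ℚ) → 0ℚ ℚ.≤ γ → (Z : Analytic 0ℚ 0ℚ) (e : ℤ → C.Carrier) → Related r (Analytic.coeff Z) e →
      (∀ x → Annulus (ℚ.- γ) 0ℚ x → Decays (series (Analytic.coeff Z) (proj₁ x))) →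
      (∀ x → Annulus 0ℚ γ x → Decays (series e (proj₁ x))) →
      Σ (Meromorphic (annulus (ℚ.- γ) γ)) λ M → _Continues_ {annulus (ℚ.- γ) γ} {0ℚ} {0ℚ} M Z
    continuation γ 0≤γ Z e rel d d^ = M , λ
      { true  x x∈ x∈i → C.trans (outer-value x x∈ x∈i) (C.sym (C.trans (C.*-congʳ (one x x∈i)) (C.*-identityˡ _)))
      ; false x x∈ x∈i → C.trans (inner-value x x∈ x∈i) (C.*-congʳ (C.sym (linear-value {0ℚ} {γ} b x x∈i))) }
      where
      -γ≤0 : ℚ.- γ ℚ.≤ 0ℚ
      -γ≤0 = ℚ.neg-antimono-≤ 0≤γ
      a = Analytic.coeff Z
      outer : Analytic (ℚ.- γ) 0ℚ
      outer = analytic a d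
      -- The product c λᵏ (1 - d λ⁻¹) Σ eₙ λⁿ as a single Laurent series; over the denominator 1 - b
      -- λ it represents ρ Ẑ.
      inner : Analytic 0ℚ γ
      inner = analytic (dual e) (λ x x∈ → proj₁ (dual-shiftable {e} (proj₂ x) (proj₂ (shiftable-sum {series e (proj₁ x)} (d^ x x∈)))))
      one : ∀ x x∈ → value (linear {ℚ.- γ} {0ℚ} C.0#) x x∈ C.≈ C.1#
      one x x∈ = C.trans (linear-value {ℚ.- γ} {0ℚ} C.0# x x∈) (solve 1 (λ x → con (+ 1) :- con (+ 0) :* x := con (+ 1)) C.refl (proj₁ x))
      outer-value : ∀ x (x∈ : Annulus 0ℚ 0ℚ x) x∈i → value outer x x∈i C.≈ value Z x x∈
      outer-value x x∈ x∈i = value-unique outer x x∈i (value-hasSum Z x x∈)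
      inner-value : ∀ x (x∈ : Annulus 0ℚ 0ℚ x) x∈i → value inner x x∈i C.≈ (C.1# C.- b C.* proj₁ x) C.* value Z x x∈
      inner-value x x∈ x∈i = value-unique inner x x∈i
        (primal-hasSum {a} {e} (proj₂ x) rel (value-decays Z x x∈ , value-hasSum Z x x∈))
      lo hi : Bool → ℚ
      lo true  = ℚ.- γ
      lo false = 0ℚ
      hi true  = 0ℚ
      hi false = γ
      num den : ∀ i → Analytic (lo i) (hi i)
      num true  = outer
      num false = inner
      den true  = linear C.0#
      den false = linear b
      same : ∀ {α β} (g : Analytic α β) x x∈ x∈′ → value g x x∈ C.≈ value g x x∈′
      same g x x∈ x∈′ = value-unique g x x∈ (value-hasSum g x x∈′)
      -- The two annuli meet only in |λ| = 1, where both pieces are compared with Z; their agreement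
      -- there is the functional equation with denominators cleared.
      glue : ∀ x (x∈o : Annulus (ℚ.- γ) 0ℚ x) (x∈i : Annulus 0ℚ γ x) →
        value outer x x∈o C.* value (linear {0ℚ} {γ} b) x x∈i C.≈ value inner x x∈i C.* value (linear {ℚ.- γ} {0ℚ} C.0#) x x∈o
      glue x x∈o x∈i = C.trans (C.*-cong (outer-value x x∈ x∈o) (linear-value {0ℚ} {γ} b x x∈i))
        (C.trans (C.*-comm _ _) (C.sym (C.trans (C.*-cong (inner-value x x∈ x∈i) (one x x∈o)) (C.*-identityʳ _))))
        where
        x∈ : Annulus 0ℚ 0ℚ x
        x∈ = proj₁ x∈i , proj₂ x∈o
      M : Meromorphic (annulus (ℚ.- γ) γ)
      M = record
        { Index      = Bool
        ; lo         = lo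
        ; hi         = hi
        ; inside     = λ { true w (l , h) → l , ℚ.≤-trans h 0≤γ ; false w (l , h) → ℚ.≤-trans -γ≤0 l , h }
        ; admissible = λ α β D → true ∷ false ∷ [] , λ w w∈ → cover w (D w w∈)
        ; num        = num
        ; den        = den
        ; regular    = λ { true → linear-regular {ℚ.- γ} {0ℚ} C.0# ; false → linear-regular {0ℚ} {γ} b }
        ; compatible = λ
          { true  true  x x∈i x∈j → C.*-cong (same outer x x∈i x∈j) (same (linear {ℚ.- γ} {0ℚ} C.0#) x x∈j x∈i)
          ; true  false x x∈i x∈j → glue x x∈i x∈j
          ; false true  x x∈i x∈j → C.sym (glue x x∈j x∈i)
          ; false false x x∈i x∈j → C.*-cong (same inner x x∈i x∈j) (same (linear {0ℚ} {γ} b) x x∈j x∈i) }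
        }
        where
        cover : ∀ w → w ∈[ ℚ.- γ , γ ] → Any (λ i → w ∈[ lo i , hi i ]) (true ∷ false ∷ [])
        cover w (l , h) = by (ℚ.≤-total w 0ℚ)
          where
          by : w ℚ.≤ 0ℚ ⊎ 0ℚ ℚ.≤ w → Any (λ i → w ∈[ lo i , hi i ]) (true ∷ false ∷ [])
          by (inj₁ w≤0) = here (l , w≤0)
          by (inj₂ 0≤w) = there (here (0≤w , h))

-- Zeta functions, the Schwartz class and the functional equation.

module ZetaFunctions {ℓ p : ℕ} (S : Setting ℓ p) where
  open RigidAnalytic S public
  open Analysis S public using (Zeta_,_≈_; ExtendedProduct; SchwartzClass; IntegerValued; _∙_; qᵘ) renaming (_⁻¹ to _⁻¹ᵘ)
  open K using (_∈𝔩_; Shell)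

  unramified-value : ∀ (φ : Character) → Unramified φ → ∀ {n x} → Shell n x → extend (χ φ) x C.≈ proj₁ (χ φ K.π) C.^ℤ n
  unramified-value φ unr {n} {x} sx = C.trans (unit-factor mult sx) (C.trans
    (C.*-cong (C.trans (extend-at φ (u , K.shell⇒≉0 su)) (unr (u , K.shell⇒≉0 su) (K.shell⇒unit su))) (C.^ℤ-cong (extend-at φ K.π) n))
    (C.*-identityˡ _))
    where
    mult = extend-multiplicative φ
    u = x K.* K.π^ (ℤ.- n)
    su = unit-part sx

  circle : ∀ {z} → Annulus 0ℚ 0ℚ z → C.v (proj₁ z) ≡ [ 0ℚ ]
  circle (l , h) = ≤⁺-antisym-≡ ℚ.≤-antisym h l

  decays-circle : ∀ {a w} → Decays a → C.v w ≡ [ 0ℚ ] → Decays (series a w)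
  decays-circle d vw N = let B , h = d N in B , λ n le →
    C.≤v-resp (C.*-comm _ _) (C.≤v-scale (C.unit-integral (C.unit-^ℤ vw n)) (h n le))

  module Extension {g : Fun} (ug : Uniform g) (g0 : g K.0# C.≈ C.0#) {θ : Fun} (t : Tame θ) (θ0 : ∀ {x} → x K.≈ K.0# → θ x C.≈ C.0#)
                   (φ : Character) (unr : Unramified φ) (vφ : C.v (proj₁ (χ φ K.π)) ≡ [ 0ℚ ]) where
    open Coefficients ug g0 t

    product : Fun
    product x = g x C.* (θ x C.* extend (χ φ) x)

    product-0 : ∀ {x} → x K.≈ K.0# → product x C.≈ C.0#
    product-0 x≈0 = C.trans (C.*-congˡ (C.trans (C.*-congʳ (θ0 x≈0)) (C.zeroˡ _))) (C.zeroʳ _)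

    -- The character takes integral values, so the product tends to 0 at 0 together with g.
    product-extends : (Φ : Fun×) → (∀ x → proj₁ (Φ x) C.≈ θ (proj₁ x) C.* proj₁ (χ φ x)) → ExtendedProduct g Φ product
    product-extends Φ Φ≈ = record
      { away-from-0 = λ x → C.*-congˡ (C.trans (C.*-congˡ (extend-at φ x)) (C.sym (Φ≈ x)))
      ; limit-at-0  = λ N → let B , res = ug N in K.mul (+ B) , λ x M≤ → C.≤v-resp
          (C.sym (C.trans (C.+-congˡ (C.-‿cong (product-0 K.refl))) (solve 1 (λ y → y :- con (+ 0) := y) C.refl _)))
          (C.≤v-resp (C.*-comm _ _) (C.≤v-scale (C.≤v-resp (C.sym (Φ≈ x))
            (C.integral-* (C.unit-integral (Tame.v-θ t (proj₂ x))) (φ-integral x))) (small-near-0 res (K.mem M≤))))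
      }
      where
      φ-integral : ∀ x → C.Integral (proj₁ (χ φ x))
      φ-integral x = let n , sx = K.shell-exists (proj₂ x) in
        C.≤v-resp (C.trans (C.sym (unramified-value φ unr sx)) (extend-at φ x)) (C.unit-integral (C.unit-^ℤ vφ n))

    zeta : (Φ : Fun×) → (∀ x → proj₁ (Φ x) C.≈ θ (proj₁ x) C.* proj₁ (χ φ x)) →
      ∀ {s} → HasSum (series coef (proj₁ (χ φ K.π))) s → Zeta g , Φ ≈ s
    zeta Φ Φ≈ hs = product , product-extends Φ Φ≈ ,
      zeta-integral vφ hs (λ sx → C.*-congˡ (C.*-congˡ (unramified-value φ unr sx))) product-0

  -- Allows L = 0 to be inferred from L = -L, also for p = 2, where 2 has value 1.
  2≉0 : C.fromℕ 2 C.≉ C.0#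
  2≉0 = by (p ℕ.∣? 2)
    where
    p-prime = Setting.p-prime S
    by : Dec (p ∣ 2) → C.fromℕ 2 C.≉ C.0#
    by (no p∤2)  = C.v≡[]⇒≉0 (≡.trans (C-v-fromℕ 2) (ℚₚ.v-coprime 2 p∤2))
    by (yes p∣2) = C.v≡[]⇒≉0 (≡.subst (λ n → C.v (C.fromℕ n) ≡ [ 1ℚ ])
      (ℕ.≤-antisym (ℕ.∣⇒≤ p∣2) (ℕ.nonTrivial⇒n>1 p {{Prime.prime⇒nonTrivial p-prime}})) C-v-p)

  v-^ : ∀ (F : ValuedField) {x a} → ValuedField.v F x ≡ [ a ] → ∀ n → ValuedField.v F (ValuedField._^_ F x n) ≡ [ (+ n) ℚ./ 1 ℚ.* a ]
  v-^ F {x} {a} vx zero    = ≡.trans (ValuedFieldProperties.v-1 F) (≡.cong [_] (≡.sym (ℚ.*-zeroˡ a)))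
  v-^ F {x} {a} vx (suc n) = ≡.trans (ValuedFieldProperties.v-*-[] F vx (v-^ F vx n))
    (≡.cong [_] (≡.sym (≡.trans (≡.cong (ℚ._* a) (/1-+ (+ 1) (+ n))) (≡.trans (ℚ.*-distribʳ-+ a ((+ 1) ℚ./ 1) ((+ n) ℚ./ 1)) (≡.cong (ℚ._+ (+ n) ℚ./ 1 ℚ.* a) (ℚ.*-identityˡ a))))))

  module _ where
    private
      module A = AlgebraicClosure C.closure
      module AP = ValuedFieldProperties A.valuedField

    -- Algebraic closedness applied to the polynomial Xᵐ⁺¹ - P.
    root : ∀ m P → ∃[ x ] x A.^ suc m A.≈ P
    root m P = let x , eq = A.closed {m} coefficients in x , AP.~⊤⇒≈ (AP.≈0⇒≤v (A.trans (A.+-congˡ (A.sym (sum≈ x))) eq))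
      where
      coefficients : Fin (suc m) → A.Carrier
      coefficients fzero    = A.- P
      coefficients (fsuc _) = A.0#
      sum≈ : ∀ x → A.sum (λ i → coefficients i A.* x A.^ toℕ i) A.≈ A.- P
      sum≈ x = A.trans (A.+-cong (A.*-identityʳ _) (A.trans (Sum.sum-cong-≋ {m} (λ i → A.zeroˡ _)) (Sum.sum-replicate-zero m))) (A.+-identityʳ _)
        where module Sum = SemiringSum A.semiring

    -- For γ = k/(m+1) the inverse of an (m+1)-st root of pᵏ will do. It provides a value for χ(π)
    -- with which the Schwartz condition can be tested.
    valuation-attained : ∀ γ → 0ℚ ℚ.≤ γ → ∃[ z ] C.v z ≡ [ ℚ.- γ ]
    valuation-attained γ@(ℚ.mkℚ (+ k) m _) 0≤γ = C.inv y , C.v-inv vy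
      where
      x = proj₁ (root m (A.fromℕ p A.^ k))
      x^ : x A.^ suc m A.≈ A.fromℕ p A.^ k
      x^ = proj₂ (root m (A.fromℕ p A.^ k))
      v-p^k : A.v (A.fromℕ p A.^ k) ≡ [ (+ k) ℚ./ 1 ℚ.* 1ℚ ]
      v-p^k = v-^ A.valuedField (≡.trans (ℚ̄ₚ/ℚₚ.v-fromℕ p) ℚₚ.v-r) k
      x≉0 : x A.≉ A.0#
      x≉0 x≈0 = AP.v≡[]⇒≉0 v-p^k (A.trans (A.sym x^) (A.trans (A.*-congʳ x≈0) (A.zeroˡ _)))
      a = proj₁ (AP.val x≉0)
      va = proj₂ (AP.val x≉0)
      m+1 = (+ suc m) ℚ./ 1
      m+1≢0 : ℚ.Positive m+1
      m+1≢0 = ℚ.positive (/1-mono-< {+ 0} {+ suc m} (ℤ.+<+ (ℕ.s≤s ℕ.z≤n)))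
      scaled-γ : m+1 ℚ.* γ ≡ (+ k) ℚ./ 1
      scaled-γ = ℚ.toℚᵘ-injective (ℚᵘ.≃-trans (ℚ.toℚᵘ-homo-* m+1 γ) (ℚᵘ.≃-trans (ℚᵘ.*-congʳ {ℚ.toℚᵘ γ} (toℚᵘ-/1 (+ suc m)))
        (ℚᵘ.≃-trans (ℚᵘ.*≡* (cross (+ suc m) (+ k))) (ℚᵘ.≃-sym (toℚᵘ-/1 (+ k))))))
        where
        cross : ∀ s k → (s ℤ.* k) ℤ.* + 1 ≡ k ℤ.* (+ 1 ℤ.* s)
        cross = ℤ-Ring.solve-∀
      scaled-a : m+1 ℚ.* a ≡ (+ k) ℚ./ 1
      scaled-a = ≡.trans ([]-injective (≡.trans (≡.sym (v-^ A.valuedField va (suc m))) (≡.trans (A.v-cong x^) v-p^k))) (ℚ.*-identityʳ _)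
      a≡γ : a ≡ γ
      a≡γ = ℚ.≤-antisym
        (ℚ.*-cancelˡ-≤-pos m+1 {{m+1≢0}} (ℚ.≤-reflexive (≡.trans scaled-a (≡.sym scaled-γ))))
        (ℚ.*-cancelˡ-≤-pos m+1 {{m+1≢0}} (ℚ.≤-reflexive (≡.trans scaled-γ (≡.sym scaled-a))))
      module E = ValuedExtension C.extension
      y = E.⟦ x ⟧
      vy : C.v y ≡ [ γ ]
      vy = ≡.trans (E.v-⟦_⟧ x) (≡.trans va (≡.cong [_] a≡γ))
    valuation-attained (ℚ.mkℚ -[1+ k ] m _) (ℚ.*≤* ())

  module SchwartzDecay {g : Fun} (ug : Uniform g) (g0 : g K.0# C.≈ C.0#) {θ : Fun} (t : Tame θ)
    (χ[_] : C.Units → Character) (χ-unr : ∀ z → Unramified χ[ z ] × proj₁ (χ χ[ z ] K.π) C.≈ proj₁ z)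
    (γ : ℚ) (0≤γ : 0ℚ ℚ.≤ γ) (schwartz : SchwartzClass γ g) where
    open Coefficients ug g0 t

    zᵘ : C.Units
    zᵘ = let z , vz = valuation-attained γ 0≤γ in z , C.v≡[]⇒≉0 vz
    z = proj₁ zᵘ
    vz : C.v z ≡ [ ℚ.- γ ]
    vz = proj₂ (valuation-attained γ 0≤γ)

    -- The Schwartz condition is applied to the unramified character with χ(π) = w, which is
    -- constantly wⁿ on the shell of order n.
    limit-along : ∀ (w : C.Units) → C.v (proj₁ w) ≡ [ ℚ.- γ ] →
      ∃[ L ] ∀ N → ∃[ B ] ∀ n → B ℕ.≤ n → ∀ {x} → Shell (+ n) x → C.Close N (g x C.* proj₁ w C.^ n) L
    limit-along w vw = at (proj₂ (proj₂ schwartz) χ[ w ] (≡.trans (C.v-cong (proj₂ (χ-unr w))) vw))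
      where
      at : _ → _
      at (F , ext , _) = F K.0# , λ N →
        let M , h = ExtendedProduct.limit-at-0 ext N
            B , M≤B , _ = K.archimedean M
        in B , λ n B≤n {x} sx → C.≤v-resp
          (C.+-congʳ (C.*-congˡ (C.trans (C.sym (extend-at χ[ w ] (x , K.shell⇒≉0 sx))) (C.trans (unramified-value χ[ w ] (proj₁ (χ-unr w)) sx) (C.^ℤ-cong (proj₂ (χ-unr w)) (+ n))))))
          (h (x , K.shell⇒≉0 sx) (⁺-trans [ M≤B ] (K.≤v (K.∈-mono (ℤ.+≤+ B≤n) (K.shell⇒∈ sx)))))

    -zᵘ : C.Units
    -zᵘ = C.- z , C.v≡[]⇒≉0 (≡.trans (C.v-neg z) vz)

    L L′ : C.Carrier
    L  = proj₁ (limit-along zᵘ vz)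
    L′ = proj₁ (limit-along -zᵘ (≡.trans (C.v-neg z) vz))

    neg-^-even : ∀ n → (C.- z) C.^ (n ℕ.+ n) C.≈ z C.^ (n ℕ.+ n)
    neg-^-even zero    = C.refl
    neg-^-even (suc n) = C.trans (C.reflexive (≡.cong (λ k → (C.- z) C.^ suc k) (ℕ.+-suc n n)))
      (C.trans (C.*-congˡ (C.*-congˡ (neg-^-even n)))
        (C.trans (solve 2 (λ z y → (:- z) :* ((:- z) :* y) := z :* (z :* y)) C.refl z (z C.^ (n ℕ.+ n)))
          (C.reflexive (≡.cong (λ k → z C.^ suc k) (≡.sym (ℕ.+-suc n n))))))

    -- The limits of g(x) χ(x) at 0 for the unramified χ with χ(π) = ± z agree
    -- along the even powers of π and are opposite along the odd ones.
    L≈0 : L C.≈ C.0#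
    L≈0 = C.*-≈0 2≉0 (C.close⇒≈ at)
      where
      at : ∀ N → C.Close N (C.fromℕ 2 C.* L) C.0#
      at N = ~-trans (≈⇒~ (solve 2 (λ o L → (o :+ (o :+ con (+ 0))) :* L := o :* L :+ o :* L) C.refl C.1# L))
          (~-trans (~-+ (≈⇒~ (C.*-identityˡ L)) (~-trans (≈⇒~ (C.*-identityˡ L)) L~-L))
            (≈⇒~ (C.-‿inverseʳ L)))
        where
        open C.Approx [ N ]
        B = proj₁ (proj₂ (limit-along zᵘ vz) N)
        h = proj₂ (proj₂ (limit-along zᵘ vz) N)
        B′ = proj₁ (proj₂ (limit-along -zᵘ (≡.trans (C.v-neg z) vz)) N)
        h′ = proj₂ (proj₂ (limit-along -zᵘ (≡.trans (C.v-neg z) vz)) N)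
        n = B ℕ.+ B′
        e = n ℕ.+ n
        B≤e : B ℕ.≤ e
        B≤e = ℕ.≤-trans (ℕ.m≤m+n B B′) (ℕ.m≤m+n n n)
        B′≤e : B′ ℕ.≤ e
        B′≤e = ℕ.≤-trans (ℕ.m≤n+m B′ B) (ℕ.m≤m+n n n)
        even : L ~ L′
        even = ~-trans (~-sym (h e B≤e (K.shell-π^ (+ e))))
          (~-trans (≈⇒~ (C.*-congˡ (C.sym (neg-^-even n)))) (h′ e B′≤e (K.shell-π^ (+ e))))
        odd : L′ ~ (C.- L)
        odd = ~-trans (~-sym (h′ (suc e) (ℕ.m≤n⇒m≤1+n B′≤e) (K.shell-π^ (+ suc e))))
          (~-trans (≈⇒~ (C.trans (C.*-congˡ (C.*-congˡ (neg-^-even n)))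
              (solve 3 (λ g z y → g :* ((:- z) :* y) := :- (g :* (z :* y))) C.refl (g (K.π^ (+ suc e))) z (z C.^ e))))
            (~-neg (h (suc e) (ℕ.m≤n⇒m≤1+n B≤e) (K.shell-π^ (+ suc e)))))
        L~-L : L ~ (C.- L)
        L~-L = ~-trans even odd

    -- As the limit at 0 vanishes, g(x) zⁿ is small on the shell of order n. There |θ| = 1, so the
    -- bound on g passes to the coefficient, whatever the ramification of θ.
    coef-near-0 : ∀ N → ∃[ B ] ∀ n → B ℕ.≤ n → [ N ] ≤⁺ C.v (coef (+ n) C.* z C.^ n)
    coef-near-0 N = B , λ n B≤n → at n B≤n (C.val (C.^ℤ-≉0 (proj₂ zᵘ) (+ n)))
      where
      B = proj₁ (proj₂ (limit-along zᵘ vz) N)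
      h = proj₂ (proj₂ (limit-along zᵘ vz) N)
      at : ∀ n → B ℕ.≤ n → ∃[ s ] C.v (z C.^ n) ≡ [ s ] → [ N ] ≤⁺ C.v (coef (+ n) C.* z C.^ n)
      at n B≤n (s , vs) = ≡.subst (λ M → [ M ] ≤⁺ C.v (coef (+ n) C.* z C.^ n)) (x-y+y≡x N s)
        (C.≤v-* (coef-≤v (+ n) g≤) (⁺-reflexive (≡.sym vs)))
        where
        z^n≉0 = C.v≡[]⇒≉0 vs
        g≤ : ∀ {x} → Shell (+ n) x → [ N ℚ.- s ] ≤⁺ C.v (g x)
        g≤ {x} sx = C.≤v-resp (C.trans (C.*-assoc _ _ _) (C.trans (C.*-congˡ (C.inverse _ z^n≉0)) (C.*-identityʳ _)))
          (C.≤v-* (C.≤v-resp (C.trans (C.+-congˡ (C.-‿cong L≈0)) (solve 1 (λ y → y :- con (+ 0) := y) C.refl (g x C.* z C.^ n)))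
              (h n B≤n sx))
            (⁺-reflexive (≡.sym (C.v-inv vs))))

    -- For n ≥ 0 the terms are compared with those at z, since |w| ≤ |z|. For n < 0 the powers of w
    -- are integral, since |w| ≥ 1, and the coefficients themselves tend to 0.
    series-decays : ∀ {w} → [ ℚ.- γ ] ≤⁺ C.v w → C.v w ≤⁺ [ 0ℚ ] → w C.≉ C.0# → Decays (series coef w)
    series-decays {w} -γ≤w w≤0 w≉0 N = suc (B ℕ.+ B′) , λ
      { (+ n) le → C.≤v-resp (C.trans
            (solve 3 (λ c z r → r :* (c :* z) := c :* (r :* z)) C.refl (coef (+ n)) (z C.^ n) ((w C.* C.inv z) C.^ n))
            (C.*-congˡ (C.trans (C.sym (Exp.^-distrib-* (w C.* C.inv z) z n)) (Exp.^-congˡ n (C.trans (C.*-assoc _ _ _) (C.trans (C.*-congˡ (C.inverseˡ (proj₂ zᵘ))) (C.*-identityʳ w)))))))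
          (C.≤v-scale (C.integral-^ w/z-integral n) (h n (ℕ.≤-trans (ℕ.≤-trans (ℕ.m≤m+n B B′) (ℕ.n≤1+n _)) le)))
      ; -[1+ n ] le → C.≤v-resp (C.*-comm _ _) (C.≤v-scale (C.integral-^ w⁻¹-integral (suc n)) (h′ -[1+ n ] (ℕ.≤-trans (ℕ.≤-trans (ℕ.m≤n+m B′ B) (ℕ.n≤1+n _)) le))) }
      where
      module Exp where
        open import Algebra.Properties.CommutativeSemiring.Exp C.commutativeSemiring public
      B = proj₁ (coef-near-0 N)
      h = proj₂ (coef-near-0 N)
      B′ = proj₁ (coef-decays N)
      h′ = proj₂ (coef-decays N)
      w/z-integral : C.Integral (w C.* C.inv z)
      w/z-integral = ≡.subst (λ M → [ M ] ≤⁺ C.v (w C.* C.inv z)) (ℚ.+-inverseʳ (ℚ.- γ))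
        (C.≤v-* -γ≤w (⁺-reflexive (≡.sym (C.v-inv vz))))
      w⁻¹-integral : C.Integral (C.inv w)
      w⁻¹-integral = by (C.val w≉0)
        where
        by : ∃[ a ] C.v w ≡ [ a ] → C.Integral (C.inv w)
        by (a , va) with ≡.subst (_≤⁺ [ 0ℚ ]) va w≤0
        ... | [ a≤0 ] = ⁺-trans [ ℚ.neg-antimono-≤ a≤0 ] (⁺-reflexive (≡.sym (C.v-inv va)))

  module Equation {f f̂ : Fun} (ft : IsFourierTransform f f̂) (van : VanishesAt∞ f̂) (f0 : f K.0# C.≈ C.0#) (f̂0 : f̂ K.0# C.≈ C.0#)
    (χ̃ : Character) (t : Tame (extend (χ χ̃))) (cond : Conductor (invert (extend (χ χ̃))))
    (χ[_] : C.Units → Character) (χ-unr : ∀ z → Unramified χ[ z ] × proj₁ (χ χ[ z ] K.π) C.≈ proj₁ z) where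

    θ : Fun
    θ = extend (χ χ̃)
    t⁻¹ : Tame (invert θ)
    t⁻¹ = tame-invert t

    private
      module T = Transform {f} {f̂} ft van
      module A = Coefficients T.f-uniform f0 t
      module E = Coefficients T.f̂-uniform f̂0 t⁻¹

    a e : ℤ → C.Carrier
    a = T.a f0 f̂0 t
    e = T.e f0 f̂0 t

    q/_ : C.Carrier → C.Carrier
    q/ z = q′ C.* C.inv z

    -- The power q⁻ⁿ that comes from (q/z)⁻ⁿ is the one built into eₙ.
    reflect : ∀ {z} → z C.≉ C.0# → ∀ n → series E.coef (q/ z) (ℤ.- n) C.≈ series e z n
    reflect {z} z≉0 n = C.trans (C.*-congˡ (C.trans (C.^ℤ-distrib-* (C.v≡[]⇒≉0 C-v-q) (C.inv-≉0 z≉0) (ℤ.- n))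
        (C.*-congˡ (C.trans (C.inv-^ℤ z≉0 (ℤ.- n)) (C.reflexive (≡.cong (z C.^ℤ_) (ℤ.neg-involutive n)))))))
      (C.sym (C.*-assoc _ _ _))

    reflect-decays : ∀ {z} → z C.≉ C.0# → Decays (series E.coef (q/ z)) → Decays (series e z)
    reflect-decays {z} z≉0 d N = let B , h = decays-neg {series E.coef (q/ z)} d N in
      B , λ n le → C.≤v-resp (reflect z≉0 n) (h n le)

    v-q/ : ∀ {z} → C.v z ≡ [ 0ℚ ] → C.v (q/ z) ≡ [ 0ℚ ]
    v-q/ vz = C.unit-* C-v-q (C.unit-inv vz)

    Z Ẑ : Analytic 0ℚ 0ℚ
    Z = analytic a (λ z z∈ → decays-circle A.coef-decays (circle {z} z∈))
    Ẑ = analytic e (λ z z∈ → reflect-decays (proj₂ z) (decays-circle E.coef-decays (v-q/ (circle {z} z∈))))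

    zeta-Z : ∀ z (z∈ : Annulus 0ℚ 0ℚ z) → Zeta f , (χ χ̃ ∙ χ χ[ z ]) ≈ value Z z z∈
    zeta-Z z z∈ = Extension.zeta T.f-uniform f0 t (extend-0 χ̃) χ[ z ] (proj₁ (χ-unr z)) (≡.trans (C.v-cong (proj₂ (χ-unr z))) (circle {z} z∈))
      (χ χ̃ ∙ χ χ[ z ]) (λ x → C.*-congʳ (C.sym (extend-at χ̃ x)))
      (hasSum-cong {series a (proj₁ z)} (λ n → C.*-congˡ (C.^ℤ-cong (C.sym (proj₂ (χ-unr z))) n)) C.refl (value-hasSum Z z z∈))

    zeta-Ẑ : ∀ z (z∈ : Annulus 0ℚ 0ℚ z) → Zeta f̂ , ((χ χ̃ ⁻¹ᵘ) ∙ χ χ[ qᵘ C.*ᵘ C.invᵘ z ]) ≈ value Ẑ z z∈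
    zeta-Ẑ z z∈ = Extension.zeta T.f̂-uniform f̂0 t⁻¹ (invert-0 θ) χ[ w ] (proj₁ (χ-unr w)) (≡.trans (C.v-cong (proj₂ (χ-unr w))) (v-q/ (circle {z} z∈)))
      ((χ χ̃ ⁻¹ᵘ) ∙ χ χ[ w ]) (λ x → C.*-congʳ (C.sym (C.trans (invert-at θ (proj₂ x)) (C.inv-cong (extend-at χ̃ x)))))
      (hasSum-cong {λ n → series e (proj₁ z) (ℤ.- n)} (λ n → C.trans (C.sym (reflect (proj₂ z) (ℤ.- n)))
          (C.trans (C.reflexive (≡.cong (series E.coef (q/ proj₁ z)) (ℤ.neg-involutive n))) (C.*-congˡ (C.^ℤ-cong (C.sym (proj₂ (χ-unr w))) n))))
        C.refl (hasSum-neg {series e (proj₁ z)} (value-decays Ẑ z z∈) (value-hasSum Ẑ z z∈)))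
      where
      w : C.Units
      w = qᵘ C.*ᵘ C.invᵘ z

    r : Ratio
    r = zeta-ratio t cond

    rel : Related r a e
    rel = related t cond {f} {f̂} ft van f0 f̂0

    equation : _≈_·_ {ℂₚ×} {0ℚ} {0ℚ} Z (ratio-meromorphic r) Ẑ
    equation = functional-equation r Z Ẑ rel

    continued : ∀ (γ : ℚ) → 0ℚ ℚ.≤ γ → SchwartzClass γ f → SchwartzClass γ f̂ →
      Σ (Meromorphic (annulus (ℚ.- γ) γ)) λ M → _Continues_ {annulus (ℚ.- γ) γ} {0ℚ} {0ℚ} M Z
    continued γ 0≤γ sf sf̂ = continuation r γ 0≤γ Z e rel
      (λ x x∈ → SchwartzDecay.series-decays T.f-uniform f0 t χ[_] χ-unr γ 0≤γ sf (proj₁ x∈) (proj₂ x∈) (proj₂ x))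
      (λ x x∈ → reflect-decays (proj₂ x) (dual-decays x x∈ (C.val (proj₂ x))))
      where
      -- Since |q| = 1, the condition p^(-γ) ≤ |λ| ≤ 1 becomes 1 ≤ |q/λ| ≤ p^γ, so the Schwartz
      -- class of f̂ applies at q/λ.
      dual-decays : ∀ x → Annulus 0ℚ γ x → ∃[ b ] C.v (proj₁ x) ≡ [ b ] → Decays (series E.coef (q/ proj₁ x))
      dual-decays x (0≤x , x≤γ) (b , vb) = SchwartzDecay.series-decays T.f̂-uniform f̂0 t⁻¹ χ[_] χ-unr γ 0≤γ sf̂
          (≡.subst ([ ℚ.- γ ] ≤⁺_) (≡.sym v-w) (lower (≡.subst (_≤⁺ [ γ ]) vb x≤γ)))
          (≡.subst (_≤⁺ [ 0ℚ ]) (≡.sym v-w) (upper (≡.subst ([ 0ℚ ] ≤⁺_) vb 0≤x)))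
          (C.v≡[]⇒≉0 v-w)
        where
        v-w : C.v (q/ proj₁ x) ≡ [ ℚ.- b ]
        v-w = ≡.trans (C.v-*-[] C-v-q (C.v-inv vb)) (≡.cong [_] (ℚ.+-identityˡ (ℚ.- b)))
        lower : [ b ] ≤⁺ [ γ ] → [ ℚ.- γ ] ≤⁺ [ ℚ.- b ]
        lower [ b≤γ ] = [ ℚ.neg-antimono-≤ b≤γ ]
        upper : [ 0ℚ ] ≤⁺ [ b ] → [ ℚ.- b ] ≤⁺ [ 0ℚ ]
        upper [ 0≤b ] = [ ℚ.neg-antimono-≤ 0≤b ]

mainTheorem2 : ∀ {ℓ p : ℕ} (S : Setting ℓ p) →
    let open Analysis S in
    (χ̃ : Character) → proj₁ (χ χ̃ K.π) C.≈ C.1# →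
    (χ[_] : C.Units → Character) →
    (∀ z → Unramified χ[ z ] × proj₁ (χ χ[ z ] K.π) C.≈ proj₁ z) →
    Σ (Meromorphic ℂₚ×) λ ρ →
    ∀ (f f̂ : Fun) → Continuous f → IntegerValued f → VanishesAt∞ f →
    IsFourierTransform f f̂ → VanishesAt∞ f̂ → f K.0# C.≈ C.0# → f̂ K.0# C.≈ C.0# →
    Σ (Analytic 0ℚ 0ℚ) λ Z → Σ (Analytic 0ℚ 0ℚ) λ Ẑ →
    (∀ z (z∈ : Annulus 0ℚ 0ℚ z) →
    Zeta f , (χ χ̃ ∙ χ χ[ z ]) ≈ value Z z z∈)
    × (∀ z (z∈ : Annulus 0ℚ 0ℚ z) →
    Zeta f̂ , ((χ χ̃ ⁻¹) ∙ χ χ[ qᵘ C.*ᵘ C.invᵘ z ]) ≈ value Ẑ z z∈)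
    × (Z ≈ ρ · Ẑ)
    × (∀ (γ : ℚ) → 0ℚ ℚ.≤ γ → SchwartzClass γ f → SchwartzClass γ f̂ →
    Σ (Meromorphic (annulus (ℚ.- γ) γ)) λ M → M Continues Z)
mainTheorem2 S χ̃ χ̃π≈1 χ[_] χ-unr = ratio-meromorphic (zeta-ratio t cond) , λ f f̂ _ _ _ ft van f0 f̂0 →
  let module Eq = Equation {f} {f̂} ft van f0 f̂0 χ̃ t cond χ[_] χ-unr in
  Eq.Z , Eq.Ẑ , Eq.zeta-Z , Eq.zeta-Ẑ , Eq.equation , Eq.continued
  where
  open ZetaFunctions S
  t : Tame (extend (χ χ̃))
  t = tame χ̃ χ̃π≈1
  cond : Conductor (invert (extend (χ χ̃)))
  cond = conductor (tame-invert t)
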